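{- $\mathrm{DAGR}(\mathsf{PSPACE})=\mathsf{PSPACE}$ and $\mathrm{DAGR}(\mathsf{NP})=\mathsf{NP}$.
   Context: For a language $L\subseteq\Sigma^*$, $\mathrm{DAGREACH}(L)$ is the set of triples $(G,s,t)$ where $G$ is a directed acyclic graph with edges labelled by symbols of $\Sigma$ and $s,t$ are vertices, such that some path from $s$ to $t$ has yield (concatenation of edge labels in order) in $L$. For a complexity class $\mathcal{C}$, $\mathrm{DAGR}(\mathcal{C})=\{L : \mathrm{DAGREACH}(L)\in\mathcal{C}\}$. -}

module Defs where

open import Data.Nat using (ℕ; zero; suc; _+_; _*_; _^_; _≤_)
open import Data.Fin using (Fin; zero; suc; toℕ; _≟_)
open import Data.List using (List; []; _∷_; _++_; map; length; concatMap; [_])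
open import Data.List.Membership.Propositional using (_∈_)
open import Data.Product using (Σ; ∃; _×_; _,_)
open import Data.Sum using (_⊎_)
open import Data.Bool using (Bool; true; false; _∨_; if_then_else_)
open import Relation.Nullary using (¬_; does)
open import Relation.Binary.PropositionalEquality using (_≡_)
open import Function.Bundles using (_⇔_)

Language : ℕ → Set₁
Language k = List (Fin k) → Set

poly : ℕ → ℕ → ℕ → ℕ
poly c d n = c * (suc n) ^ d

data Move : Set where
  left right stay : Move

record Config (Q G : ℕ) : Set where
  constructor conf
  field
    state : Fin Q
    lft   : List (Fin G)   -- cells left of the head, nearest first
    hd    : Fin G
    rgt   : List (Fin G)   -- cells right of the head, nearest first
open Config public

-- number of tape cells visited so far (including the input)
space : ∀ {Q G} → Config Q G → ℕ
space c = length (lft c) + suc (length (rgt c))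

act : ∀ {Q G} → Fin G → Config Q G → Fin Q → Fin G → Move → Config Q G
act b (conf _ l _ r) q' a left with l
... | []     = conf q' [] a r
... | x ∷ l' = conf q' l' x (a ∷ r)
act b (conf _ l _ r) q' a right with r
... | []     = conf q' (a ∷ l) b []
... | x ∷ r' = conf q' (a ∷ l) x r'
act b (conf _ l _ r) q' a stay = conf q' l a r

initial : ∀ {k Q G} → Fin G → (Fin k → Fin G) → Fin Q → List (Fin k) → Config Q G
initial b inp q []      = conf q [] b []
initial b inp q (a ∷ w) = conf q [] (inp a) (map inp w)

record DTM (k : ℕ) : Set where
  field
    Q G    : ℕ
    blank  : Fin G
    inp    : Fin k → Fin G
    start accept reject : Fin Q
    δ      : Fin Q → Fin G → Fin Q × Fin G × Move

module _ {k : ℕ} (M : DTM k) where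
  open DTM M

  halted : Fin Q → Bool
  halted q = does (q ≟ accept) ∨ does (q ≟ reject)

  dstep : Config Q G → Config Q G
  dstep c with δ (state c) (hd c)
  ... | (q' , a , m) = if halted (state c) then c else act blank c q' a m

  drun : ℕ → Config Q G → Config Q G
  drun zero    c = c
  drun (suc n) c = drun n (dstep c)

  dinit : List (Fin k) → Config Q G
  dinit = initial blank inp start

record NTM (k : ℕ) : Set where
  field
    Q G    : ℕ
    blank  : Fin G
    inp    : Fin k → Fin G
    start accept : Fin Q
    δ      : Fin Q → Fin G → List (Fin Q × Fin G × Move)

module _ {k : ℕ} (M : NTM k) where
  open NTM M

  data Reach : ℕ → Config Q G → Config Q G → Set where
    here : ∀ {c} → Reach zero c c
    step : ∀ {n c c' q' a m} → (q' , a , m) ∈ δ (state c) (hd c) →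
           Reach n (act blank c q' a m) c' → Reach (suc n) c c'

  ninit : List (Fin k) → Config Q G
  ninit = initial blank inp start

InPSPACE : ∀ {k} → Language k → Set
InPSPACE {k} L =
  Σ (DTM k) λ M → Σ ℕ λ c → Σ ℕ λ d → ∀ w → Σ ℕ λ n →
    ((i : ℕ) → i ≤ n → space (drun M i (dinit M w)) ≤ poly c d (length w)) ×
    (halted M (state (drun M n (dinit M w))) ≡ true) ×
    (L w ⇔ (state (drun M n (dinit M w)) ≡ DTM.accept M))

InNP : ∀ {k} → Language k → Set
InNP {k} L =
  Σ (NTM k) λ M → Σ ℕ λ c → Σ ℕ λ d → ∀ w →
    L w ⇔ (Σ ℕ λ n → Σ (Config (NTM.Q M) (NTM.G M)) λ c' →
             n ≤ poly c d (length w) × Reach M n (ninit M w) c' ×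
             state c' ≡ NTM.accept M)

record Instance (k : ℕ) : Set where
  constructor inst
  field
    n     : ℕ
    s t   : Fin n
    edges : List (Fin n × Fin k × Fin n)

data Path {k n : ℕ} (E : List (Fin n × Fin k × Fin n)) :
          Fin n → Fin n → List (Fin k) → Set where
  nil  : ∀ {v} → Path E v v []
  cons : ∀ {u v w a y} → (u , a , v) ∈ E → Path E v w y → Path E u w (a ∷ y)

Acyclic : ∀ {k n} → List (Fin n × Fin k × Fin n) → Set
Acyclic {k} {n} E = ∀ (v : Fin n) (a : Fin k) (y : List (Fin k)) → ¬ Path E v v (a ∷ y)

-- Encoding alphabet Fin (2 + k): zero = '1', suc zero = '#', suc (suc a) = label a
one# sep# : ∀ {k} → Fin (suc (suc k))
one# = zero
sep# = suc zero

unary : ∀ {k} → ℕ → List (Fin (suc (suc k)))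
unary zero    = []
unary (suc m) = one# ∷ unary m

encEdge : ∀ {k n} → Fin n × Fin k × Fin n → List (Fin (suc (suc k)))
encEdge (u , a , v) = unary (toℕ u) ++ sep# ∷ suc (suc a) ∷ unary (toℕ v) ++ [ sep# ]

encode : ∀ {k} → Instance k → List (Fin (suc (suc k)))
encode (inst n s t E) =
  unary n ++ sep# ∷ unary (toℕ s) ++ sep# ∷ unary (toℕ t) ++ sep# ∷ concatMap encEdge E

DAGREACH : ∀ {k} → Language k → Language (suc (suc k))
DAGREACH {k} L x = Σ (Instance k) λ I → encode I ≡ x × Acyclic (Instance.edges I) ×
  Σ (List (Fin k)) λ y → Path (Instance.edges I) (Instance.s I) (Instance.t I) y × L y

InDAGR : (∀ {m} → Language m → Set) → ∀ {k} → Language k → Set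
InDAGR C L = C (DAGREACH L)

-- From DAGREACH(L) to L: a word w is mapped to its line graph, whose only path from end to end has
-- yield w.  From L to DAGREACH(L): some path has its yield in L, and a path of an acyclic graph is
-- described by polynomially many bits, telling for each of |x| rounds over the edge list which
-- edges to take; acyclicity is tested deterministically by repeatedly deleting edges whose source
-- has no incoming edge.  Both reductions have the form "x is in L₁ iff some certificate selects a
-- word y of L₂ in polynomial time".  NP is closed under such reductions because the certificate,
-- together with the choices of the machine for L₂, can be guessed, and PSPACE because all
-- certificates can be tried one after the other in the same space.
-- Polynomial time is guaranteed syntactically, by programs whose loops range over the input only;
-- these are compiled to multi-stack programs and those to single-tape Turing machines.
module Submission where

open import Defs
open import Data.Nat using (ℕ; zero; suc; _+_; _*_; _^_; _≤_; _<_; z≤n; s≤s; _∸_; pred)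
import Data.Nat as ℕ
open import Data.Nat.Properties
open import Data.Nat.Tactic.RingSolver using (solve-∀)
open import Data.Fin using (Fin; zero; suc; toℕ; fromℕ; fromℕ<)
import Data.Fin as F
import Data.Fin.Properties as F
open import Data.List using (List; []; _∷_; _++_; map; length; concatMap; [_]; foldl; reverse; _ʳ++_; replicate; allFin)
open import Data.List.Properties using (length-map; length-++; length-reverse; length-replicate; length-ʳ++; ʳ++-defn; ʳ++-ʳ++; ++-ʳ++; ++-assoc; ++-identityʳ; foldl-++; map-++; unfold-reverse; reverse-involutive; reverse-map; reverse-injective; map-injective; ∷-injectiveʳ; ∷-injectiveˡ; map-∘; map-id; map-cong; concatMap-map)
open import Data.List.Membership.Propositional using (_∈_)
open import Data.List.Membership.Propositional.Properties using (∈-map⁺; ∈-map⁻; ∈-allFin)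
open import Data.List.Relation.Unary.Any using (Any) renaming (here to first; there to later)
open import Data.List.Relation.Unary.All using (All; []; _∷_)
open import Data.Vec using (Vec; []; _∷_; lookup; _[_]≔_)
import Data.Vec as V
import Data.Vec.Properties as V
open import Data.Maybe using (Maybe; just; nothing; maybe)
open import Data.Bool.Properties using (∨-zeroʳ; ∧-zeroʳ)
open import Data.Bool using (Bool; true; false; _∨_; _∧_; not; if_then_else_)
open import Data.Product using (Σ; ∃; _×_; _,_; proj₁; proj₂)
open import Data.Sum using (_⊎_; inj₁; inj₂)
open import Data.Unit using (⊤; tt)
open import Data.Empty using (⊥; ⊥-elim)
open import Relation.Nullary using (¬_; Dec; yes; no; does)
open import Relation.Nullary.Decidable using (dec-true; dec-false; False; toWitnessFalse)
open import Relation.Binary.PropositionalEquality hiding ([_])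
open import Function.Base using (_∘_; id; case_of_)
open import Function.Bundles using (_⇔_; Equivalence; mk⇔)

-- A machine for a PSPACE language may run for exponential time, so its simulation cannot be a
-- program with loops over the input. Hence two layers: the selection of y is bounded syntactically,
-- whereas the simulation is a stack command whose loop refills its own control stack. Executions
-- therefore carry a time bound and a condition on stack heights separately. Where the time is
-- polynomial, heights come for free, as an instruction pushes at most one symbol; during the
-- simulation the space bound of the simulated machine takes over. For NP the obstacle is a
-- different one: membership is defined by accepting runs of polynomial length, but longer accepting
-- runs may exist, so the simulation is given a clock. The |x|² bits of a certificate are |x| rounds
-- times at most |x| edges. As many rounds suffice because a path of an acyclic graph has fewer
-- edges than there are vertices, and vertices are written in unary. Ill-formed certificates cause
-- no harm: bits that make no sense are skipped, so every certificate describes some walk from s,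
-- and the guessed moves are checked one by one.

record Finite (A : Set) : Set where
  field
    card    : ℕ
    enc     : A → Fin card
    dec     : Fin card → A
    dec-enc : ∀ a → dec (enc a) ≡ a
open Finite

enc-injective : ∀ {A : Set} (F : Finite A) {a b : A} → enc F a ≡ enc F b → a ≡ b
enc-injective F {a} {b} e = trans (sym (dec-enc F a)) (trans (cong (dec F) e) (dec-enc F b))

finRetract : ∀ {A B : Set} → Finite B → (f : A → B) (g : B → A) → (∀ a → g (f a) ≡ a) → Finite A
finRetract F f g gf = record
  { card = card F ; enc = enc F ∘ f ; dec = g ∘ dec F
  ; dec-enc = λ a → trans (cong g (dec-enc F (f a))) (gf a) }

abstract

  finFin : ∀ n → Finite (Fin n)
  finFin n = record { card = n ; enc = id ; dec = id ; dec-enc = λ _ → refl }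

  fin⊤ : Finite ⊤
  fin⊤ = finRetract (finFin 1) (λ _ → zero) (λ _ → tt) (λ _ → refl)

  fin⊎ : ∀ {A B : Set} → Finite A → Finite B → Finite (A ⊎ B)
  fin⊎ {A} {B} F G = record
    { card = card F + card G ; enc = to ; dec = from ∘ F.splitAt (card F) ; dec-enc = ok }
    where
    to : A ⊎ B → Fin (card F + card G)
    to (inj₁ a) = enc F a F.↑ˡ card G
    to (inj₂ b) = card F F.↑ʳ enc G b
    from : Fin (card F) ⊎ Fin (card G) → A ⊎ B
    from (inj₁ i) = inj₁ (dec F i)
    from (inj₂ j) = inj₂ (dec G j)
    ok : ∀ x → from (F.splitAt (card F) (to x)) ≡ x
    ok (inj₁ a) rewrite F.splitAt-↑ˡ (card F) (enc F a) (card G) = cong inj₁ (dec-enc F a)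
    ok (inj₂ b) rewrite F.splitAt-↑ʳ (card F) (card G) (enc G b) = cong inj₂ (dec-enc G b)

  fin× : ∀ {A B : Set} → Finite A → Finite B → Finite (A × B)
  fin× {A} {B} F G = record
    { card = card F * card G
    ; enc = λ (a , b) → F.combine (enc F a) (enc G b)
    ; dec = from ∘ F.remQuot (card G)
    ; dec-enc = λ (a , b) → trans (cong from (F.remQuot-combine (enc F a) (enc G b)))
        (cong₂ _,_ (dec-enc F a) (dec-enc G b)) }
    where
    from : Fin (card F) × Fin (card G) → A × B
    from (i , j) = dec F i , dec G j

  finBool : Finite Bool
  finBool = finRetract (fin⊎ fin⊤ fin⊤) (λ b → if b then inj₁ tt else inj₂ tt)
    (λ { (inj₁ _) → true ; (inj₂ _) → false }) (λ { true → refl ; false → refl })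

  finMaybe : ∀ {A : Set} → Finite A → Finite (Maybe A)
  finMaybe F = finRetract (fin⊎ fin⊤ F) (maybe inj₂ (inj₁ tt))
    (λ { (inj₁ _) → nothing ; (inj₂ a) → just a }) (λ { (just a) → refl ; nothing → refl })

  finVec : ∀ {A : Set} → Finite A → ∀ n → Finite (Vec A n)
  finVec F zero = finRetract fin⊤ (λ _ → tt) (λ _ → []) (λ { [] → refl })
  finVec F (suc n) = finRetract (fin× F (finVec F n)) (λ { (x ∷ xs) → x , xs }) (λ (x , xs) → x ∷ xs)
    (λ { (x ∷ xs) → refl })

  finΣFin : ∀ n (P : Fin n → Set) → (∀ i → Finite (P i)) → Finite (Σ (Fin n) P)
  finΣFin zero P F = record { card = 0 ; enc = λ { (() , _) } ; dec = λ () ; dec-enc = λ { (() , _) } }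
  finΣFin (suc n) P F = finRetract (fin⊎ (F zero) (finΣFin n (P ∘ suc) (F ∘ suc)))
    (λ { (zero , p) → inj₁ p ; (suc i , p) → inj₂ (i , p) })
    (λ { (inj₁ p) → zero , p ; (inj₂ (i , p)) → suc i , p })
    (λ { (zero , p) → refl ; (suc i , p) → refl })

  finΣ : ∀ {A : Set} {P : A → Set} → Finite A → (∀ a → Finite (P a)) → Finite (Σ A P)
  finΣ {A} {P} F G = finRetract (finΣFin (card F) (P ∘ dec F) (G ∘ dec F))
    (λ (a , p) → enc F a , subst P (sym (dec-enc F a)) p)
    (λ (i , p) → dec F i , p)
    (λ (a , p) → back (dec-enc F a) p)
    where
    back : ∀ {a b} (e : a ≡ b) (p : P b) → _≡_ {A = Σ A P} (a , subst P (sym e) p) (b , p)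
    back refl p = refl

  finMove : Finite Move
  finMove = finRetract (finFin 3)
    (λ { left → zero ; right → suc zero ; stay → suc (suc zero) })
    (λ { zero → left ; (suc zero) → right ; (suc (suc _)) → stay })
    (λ { left → refl ; right → refl ; stay → refl })

-- Tapes

nth : ∀ {A : Set} → A → List A → ℕ → A
nth b [] i = b
nth b (x ∷ xs) zero = x
nth b (x ∷ xs) (suc i) = nth b xs i

AgreeOff : ∀ {A : Set} → A → ℕ → List A → List A → Set
AgreeOff b m t t' = ∀ i → i ≢ m → nth b t i ≡ nth b t' i

agree-ʳ++ : ∀ {A : Set} (b : A) l {m t t'} → AgreeOff b m t t' → AgreeOff b (length l + m) (l ʳ++ t) (l ʳ++ t')
agree-ʳ++ b [] ag = ag
agree-ʳ++ b (x ∷ l) {m} {t} {t'} ag = subst (λ p → AgreeOff b p (l ʳ++ (x ∷ t)) (l ʳ++ (x ∷ t'))) (+-suc (length l) m)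
  (agree-ʳ++ b l {suc m} {x ∷ t} {x ∷ t'} λ { zero _ → refl ; (suc i) ne → ag i (ne ∘ cong suc) })

nth-ʳ++ : ∀ {A : Set} (b : A) l t i → nth b (l ʳ++ t) (length l + i) ≡ nth b t i
nth-ʳ++ b [] t i = refl
nth-ʳ++ b (x ∷ l) t i = trans (cong (nth b (l ʳ++ (x ∷ t))) (sym (+-suc (length l) i))) (nth-ʳ++ b l (x ∷ t) (suc i))

nth-ʳ++-head : ∀ {A : Set} (b : A) l x t → nth b (l ʳ++ (x ∷ t)) (length l) ≡ x
nth-ʳ++-head b l x t = trans (cong (nth b (l ʳ++ (x ∷ t))) (sym (+-identityʳ (length l)))) (nth-ʳ++ b l (x ∷ t) 0)

agree-head : ∀ {A : Set} (b : A) l {x y t t'} → (∀ i → nth b t i ≡ nth b t' i) →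
  AgreeOff b (length l) (l ʳ++ (x ∷ t)) (l ʳ++ (y ∷ t'))
agree-head b l {x} {y} {t} {t'} e = subst (λ p → AgreeOff b p (l ʳ++ (x ∷ t)) (l ʳ++ (y ∷ t'))) (+-identityʳ (length l))
  (agree-ʳ++ b l {0} {x ∷ t} {y ∷ t'} λ { zero ne → ⊥-elim (ne refl) ; (suc i) _ → e i })

pos : ∀ {Q G} → Config Q G → ℕ
pos c = length (lft c)

-- `pred` sends 0 to 0, as the head stays where it is when it moves left at the end of the tape.
movePos : Move → ℕ → ℕ
movePos left  p = pred p
movePos right p = suc p
movePos stay  p = p

module _ {Q G : ℕ} (b : Fin G) where

  -- `lft` has the nearest cell first, so `ʳ++` lists the tape from left to right. Cell numbers are
  -- thus absolute and unaffected by the head.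
  tape : Config Q G → ℕ → Fin G
  tape c = nth b (lft c ʳ++ (hd c ∷ rgt c))

  hd-tape : ∀ c → tape c (pos c) ≡ hd c
  hd-tape (conf _ l h r) = nth-ʳ++-head b l h r

  act-state : ∀ (c : Config Q G) q a m → state (act b c q a m) ≡ q
  act-state (conf _ [] _ r) q a left = refl
  act-state (conf _ (x ∷ l) _ r) q a left = refl
  act-state (conf _ l _ []) q a right = refl
  act-state (conf _ l _ (x ∷ r)) q a right = refl
  act-state (conf _ l _ r) q a stay = refl

  act-pos : ∀ (c : Config Q G) q a m → pos (act b c q a m) ≡ movePos m (pos c)
  act-pos (conf _ [] _ r) q a left = refl
  act-pos (conf _ (x ∷ l) _ r) q a left = refl
  act-pos (conf _ l _ []) q a right = refl
  act-pos (conf _ l _ (x ∷ r)) q a right = refl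
  act-pos (conf _ l _ r) q a stay = refl

  act-written : ∀ (c : Config Q G) q a m → tape (act b c q a m) (pos c) ≡ a
  act-written (conf _ [] _ r) q a left = refl
  act-written (conf _ (x ∷ l) _ r) q a left = nth-ʳ++-head b (x ∷ l) a r
  act-written (conf _ l _ []) q a right = nth-ʳ++-head b l a (b ∷ [])
  act-written (conf _ l _ (x ∷ r)) q a right = nth-ʳ++-head b l a (x ∷ r)
  act-written (conf _ l _ r) q a stay = nth-ʳ++-head b l a r

  private
    nth-blank : ∀ i → nth b (b ∷ []) i ≡ nth b [] i
    nth-blank zero = refl
    nth-blank (suc i) = refl

  act-kept : ∀ (c : Config Q G) q a m i → i ≢ pos c → tape (act b c q a m) i ≡ tape c i
  act-kept (conf _ [] _ r) q a left = agree-head b [] λ _ → refl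
  act-kept (conf _ (x ∷ l) _ r) q a left = agree-head b (x ∷ l) λ _ → refl
  act-kept (conf _ l _ []) q a right = agree-head b l nth-blank
  act-kept (conf _ l _ (x ∷ r)) q a right = agree-head b l λ _ → refl
  act-kept (conf _ l _ r) q a stay = agree-head b l λ _ → refl

  -- The bound on `pos c` pays for the only move that allocates a cell, a right move with nothing to
  -- the right of the head.
  act-space : ∀ (c : Config Q G) q a m N → space c ≤ N → suc (suc (pos c)) ≤ N → space (act b c q a m) ≤ N
  act-space (conf _ [] _ r) q a left N s p = s
  act-space (conf _ (x ∷ l) _ r) q a left N s p = ≤-trans (≤-reflexive (+-suc (length l) (suc (length r)))) s
  act-space (conf _ l _ []) q a right N s p = ≤-trans (≤-reflexive (cong suc (+-comm (length l) 1))) p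
  act-space (conf _ l _ (x ∷ r)) q a right N s p = ≤-trans (≤-reflexive (sym (+-suc (length l) (suc (length r))))) s
  act-space (conf _ l _ r) q a stay N s p = s

-- Stacks on the tape of a Turing machine

-- Stacks are listed top first; bot l i is the entry at height i above the bottom.
bot : ∀ {A : Set} → List A → ℕ → Maybe A
bot [] i = nothing
bot (a ∷ l) i = if does (i ℕ.≟ length l) then just a else bot l i

bot-top : ∀ {A : Set} (a : A) l → bot (a ∷ l) (length l) ≡ just a
bot-top a l rewrite dec-true (length l ℕ.≟ length l) refl = refl

bot-off : ∀ {A : Set} (a : A) l i → i ≢ length l → bot (a ∷ l) i ≡ bot l i
bot-off a l i ne rewrite dec-false (i ℕ.≟ length l) ne = refl

bot-≥ : ∀ {A : Set} (l : List A) i → length l ≤ i → bot l i ≡ nothing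
bot-≥ [] i le = refl
bot-≥ (a ∷ l) i le = trans (bot-off a l i λ { refl → <-irrefl refl le }) (bot-≥ l i (≤-trans (n≤1+n _) le))

bot-< : ∀ {A : Set} (l : List A) i → i < length l → ∃ λ a → bot l i ≡ just a
bot-< (a ∷ l) i lt with i ℕ.≟ length l
... | yes refl = a , bot-top a l
... | no ne = let (x , e) = bot-< l i (≤∧≢⇒< (≤-pred lt) ne) in x , trans (bot-off a l i ne) e

private
  bot-ʳ++-< : ∀ {A : Set} (w acc : List A) i → i < length acc → bot (w ʳ++ acc) i ≡ bot acc i
  bot-ʳ++-< [] acc i lt = refl
  bot-ʳ++-< (a ∷ w) acc i lt = trans (bot-ʳ++-< w (a ∷ acc) i (m<n⇒m<1+n lt)) (bot-off a acc i λ { refl → <-irrefl refl lt })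

  bot-ʳ++ : ∀ {A : Set} (w acc : List A) i → bot (w ʳ++ acc) (length acc + i) ≡ nth nothing (map just w) i
  bot-ʳ++ [] acc i = bot-≥ acc (length acc + i) (m≤m+n _ i)
  bot-ʳ++ (a ∷ w) acc zero = trans (cong (bot (w ʳ++ (a ∷ acc))) (+-identityʳ (length acc)))
    (trans (bot-ʳ++-< w (a ∷ acc) (length acc) ≤-refl) (bot-top a acc))
  bot-ʳ++ (a ∷ w) acc (suc i) = trans (cong (bot (w ʳ++ (a ∷ acc))) (+-suc (length acc) i)) (bot-ʳ++ w (a ∷ acc) i)

-- A word written from cell 0 onwards has its first symbol at the bottom, so it already is a stack,
-- namely its own reversal. The input can be used as a stack without being copied.
bot-reverse : ∀ {A : Set} (w : List A) i → bot (reverse w) i ≡ nth nothing (map just w) i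
bot-reverse w i = bot-ʳ++ w [] i

-- Stack programs: syntax, control points and executions.

record Storage (Γ : Set) : Set₁ where
  field
    Name Store : Set
    finName : Finite Name
    get : Name → Store → List Γ
    set : Name → List Γ → Store → Store
    get-set   : ∀ j l s → get j (set j l s) ≡ l
    get-set-≢ : ∀ {i j} l s → i ≢ j → get i (set j l s) ≡ get i s

data Instr (Name Γ S : Set) : Set where
  ipush : Name → Γ → S → Instr Name Γ S
  ipop  : Name → (Maybe Γ → S) → Instr Name Γ S
  inop  : S → Instr Name Γ S
  ihalt : Bool → Instr Name Γ S

-- `loop j f` pops `j` until it is empty and runs `f` on each popped symbol. Since `f` may push onto
-- `j` again, this is a general while loop, and commands need not terminate.
data Cmd (Name Γ : Set) : Set where
  skip : Cmd Name Γ
  push : Name → Γ → Cmd Name Γ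
  pop  : Name → (Maybe Γ → Cmd Name Γ) → Cmd Name Γ
  _⨾_  : Cmd Name Γ → Cmd Name Γ → Cmd Name Γ
  loop : Name → (Γ → Cmd Name Γ) → Cmd Name Γ
infixr 5 _⨾_

module _ {Name Γ : Set} where

  -- The control points of a command. Each popped symbol has a branch of its own, so popped symbols
  -- are remembered in the finite control.
  Lbl : Cmd Name Γ → Set
  Lbl skip       = ⊤
  Lbl (push j a) = ⊤
  Lbl (pop j f)  = ⊤ ⊎ Σ (Maybe Γ) (λ m → Lbl (f m))
  Lbl (c ⨾ d)    = Lbl c ⊎ Lbl d
  Lbl (loop j f) = ⊤ ⊎ Σ Γ (λ a → Lbl (f a))

  finLbl : Finite Γ → ∀ c → Finite (Lbl c)
  finLbl F skip       = fin⊤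
  finLbl F (push j a) = fin⊤
  finLbl F (pop j f)  = fin⊎ fin⊤ (finΣ (finMaybe F) (λ m → finLbl F (f m)))
  finLbl F (c ⨾ d)    = fin⊎ (finLbl F c) (finLbl F d)
  finLbl F (loop j f) = fin⊎ fin⊤ (finΣ F (λ a → finLbl F (f a)))

  entry : ∀ c → Lbl c
  entry skip       = tt
  entry (push j a) = tt
  entry (pop j f)  = inj₁ tt
  entry (c ⨾ d)    = inj₁ (entry c)
  entry (loop j f) = inj₁ tt

  -- `emb` places the labels of a subcommand among those of the whole program, and `ex` is the label
  -- at which control continues after it.
  code : ∀ {S : Set} c → (Lbl c → S) → S → Lbl c → Instr Name Γ S
  code skip       emb ex _              = inop ex
  code (push j a) emb ex _              = ipush j a ex
  code (pop j f)  emb ex (inj₁ _)       = ipop j (λ m → emb (inj₂ (m , entry (f m))))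
  code (pop j f)  emb ex (inj₂ (m , l)) = code (f m) (λ l → emb (inj₂ (m , l))) ex l
  code (c ⨾ d)    emb ex (inj₁ l)       = code c (emb ∘ inj₁) (emb (inj₂ (entry d))) l
  code (c ⨾ d)    emb ex (inj₂ l)       = code d (emb ∘ inj₂) ex l
  code (loop j f) emb ex (inj₁ _)       = ipop j (maybe (λ a → emb (inj₂ (a , entry (f a)))) ex)
  code (loop j f) emb ex (inj₂ (a , l)) = code (f a) (λ l → emb (inj₂ (a , l))) (emb (inj₁ tt)) l

module _ {Γ : Set} (St : Storage Γ) where
  open Storage St

  -- t bounds the number of executed instructions; Ok holds of the height of every accessed stack.
  data Exec (Ok : ℕ → Set) : ℕ → Cmd Name Γ → Store → Store → Set where
    weak  : ∀ {t t' c s s'} → t ≤ t' → Exec Ok t c s s' → Exec Ok t' c s s'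
    eskip : ∀ {s} → Exec Ok 1 skip s s
    epush : ∀ {j a s} → Ok (length (get j s)) → Exec Ok 1 (push j a) s (set j (a ∷ get j s) s)
    epop[] : ∀ {t j f s s'} → get j s ≡ [] → Exec Ok t (f nothing) s s' → Exec Ok (suc t) (pop j f) s s'
    epop∷ : ∀ {t j f s s' a l} → get j s ≡ a ∷ l → Ok (suc (length l)) →
      Exec Ok t (f (just a)) (set j l s) s' → Exec Ok (suc t) (pop j f) s s'
    eseq  : ∀ {t t' c d s s' s''} → Exec Ok t c s s' → Exec Ok t' d s' s'' → Exec Ok (t + t') (c ⨾ d) s s''
    eloop[] : ∀ {j f s} → get j s ≡ [] → Exec Ok 1 (loop j f) s s
    eloop∷ : ∀ {t t' j f s s' s'' a l} → get j s ≡ a ∷ l → Ok (suc (length l)) →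
      Exec Ok t (f a) (set j l s) s' → Exec Ok t' (loop j f) s' s'' → Exec Ok (suc (t + t')) (loop j f) s s''

-- The stack bottoms lie at cell 0, which carries a home mark.  An instruction walks right to
-- the top of its stack, acts there and walks back home.
module Machine {Γ : Set} (finΓ : Finite Γ) (St : Storage Γ) {S : Set} (finS : Finite S)
               (instr : S → Instr (Storage.Name St) Γ S) (begin : S) where
  open Storage St

  Cell : Set
  Cell = Bool × Vec (Maybe Γ) (card finName)

  abstract
    finCell : Finite Cell
    finCell = fin× finBool (finVec (finMaybe finΓ) _)

  -- `seek` recognises the top of a stack only at the first free cell beyond it, so a pop needs
  -- `read` for the cell one step to the left. `mark` and `guess` serve before the program starts:
  -- they set the home mark and write a certificate.
  data Ctl : Set where
    seek read back : S → Ctl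
    done : Bool → Ctl
    mark guess : Ctl

  abstract
    finCtl : Finite Ctl
    finCtl = finRetract (fin⊎ (fin× (finFin 3) finS) (fin⊎ finBool finBool))
      (λ { (seek s) → inj₁ (zero , s) ; (read s) → inj₁ (suc zero , s) ; (back s) → inj₁ (suc (suc zero) , s)
         ; (done b) → inj₂ (inj₁ b) ; mark → inj₂ (inj₂ true) ; guess → inj₂ (inj₂ false) })
      (λ { (inj₁ (zero , s)) → seek s ; (inj₁ (suc zero , s)) → read s ; (inj₁ (suc (suc _) , s)) → back s
         ; (inj₂ (inj₁ b)) → done b ; (inj₂ (inj₂ true)) → mark ; (inj₂ (inj₂ false)) → guess })
      (λ { (seek s) → refl ; (read s) → refl ; (back s) → refl ; (done b) → refl ; mark → refl ; guess → refl })

  -- The controls in which the deterministic and the nondeterministic machine below both just follow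
  -- `δ` and have not halted. A trace through them can be replayed on either machine.
  Plain : Ctl → Set
  Plain (seek _) = ⊤
  Plain (read _) = ⊤
  Plain (back _) = ⊤
  Plain _        = ⊥

  track : Name → Cell → Maybe Γ
  track j (_ , v) = lookup v (enc finName j)

  put : Name → Maybe Γ → Cell → Cell
  put j x (h , v) = h , v [ enc finName j ]≔ x

  blankCell : Cell
  blankCell = false , V.replicate _ nothing

  Action : Set
  Action = Ctl × Cell × Move

  δseek : S → Instr Name Γ S → Cell → Action
  δseek s (ipush j a s') c = maybe (λ _ → seek s , c , right) (back s' , put j (just a) c , stay) (track j c)
  δseek s (ipop j f)     c = maybe (λ _ → seek s , c , right)
    -- A free cell at home means that the stack is empty; there is no top to step back to.
    (if proj₁ c then (back (f nothing) , c , stay) else (read s , c , left)) (track j c)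
  δseek s (inop s')      c = seek s' , c , stay
  δseek s (ihalt b)      c = done b , c , stay

  δread : Instr Name Γ S → Cell → Action
  δread (ipop j f) c = back (f (track j c)) , put j nothing c , stay
  δread _          c = done false , c , stay

  δ : Ctl → Cell → Action
  δ (seek s) c = δseek s (instr s) c
  δ (read s) c = δread (instr s) c
  δ (back s) c = if proj₁ c then (seek s , c , stay) else (back s , c , left)
  δ (done b) c = done b , c , stay
  δ mark     c = back begin , (true , proj₂ c) , stay
  δ guess    c = done false , c , stay

  Conf : Set
  Conf = Config (card finCtl) (card finCell)

  blank : Fin (card finCell)
  blank = enc finCell blankCell

  ctl : Conf → Ctl
  ctl c = dec finCtl (state c)

  scanned : Conf → Cell
  scanned c = dec finCell (hd c)

  encAction : Action → Fin (card finCtl) × Fin (card finCell) × Move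
  encAction (q , a , m) = enc finCtl q , enc finCell a , m

  apply : Conf → Action → Conf
  apply c (q , a , m) = act blank c (enc finCtl q) (enc finCell a) m

  tstep : Conf → Conf
  tstep c = apply c (δ (ctl c) (scanned c))

  cell : Conf → ℕ → Cell
  cell c i = dec finCell (tape blank c i)

  data Trace (B : ℕ) : ℕ → Conf → Conf → Set where
    stop : ∀ {c} → space c ≤ B → Trace B 0 c c
    next : ∀ {n c c'} → space c ≤ B → Plain (ctl c) → Trace B n (tstep c) c' → Trace B (suc n) c c'

  _++ᵗ_ : ∀ {B m n c c' c''} → Trace B m c c' → Trace B n c' c'' → Trace B (m + n) c c''
  stop _ ++ᵗ u = u
  next b p t ++ᵗ u = next b p (t ++ᵗ u)

  -- The conditions on cells hold for all numbers `i`, visited or not: a blank cell has `nothing` on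
  -- every track and no home mark, and `bot` is `nothing` above the top of a stack.
  record At (B : ℕ) (q : Ctl) (p : ℕ) (s : Store) (c : Conf) : Set where
    constructor at
    field
      state≡ : state c ≡ enc finCtl q
      pos≡   : pos c ≡ p
      space≤ : space c ≤ B
      home≡  : ∀ i → proj₁ (cell c i) ≡ does (i ℕ.≟ 0)
      track≡ : ∀ i j → track j (cell c i) ≡ bot (get j s) i
  open At

  ctl≡ : ∀ {B q p s c} → At B q p s c → ctl c ≡ q
  ctl≡ {q = q} a = trans (cong (dec finCtl) (state≡ a)) (dec-enc finCtl q)

  scanned-cell : ∀ {B q p s c} → At B q p s c → scanned c ≡ cell c p
  scanned-cell {c = c} a = sym (trans (cong (cell c) (sym (pos≡ a))) (cong (dec finCell) (hd-tape blank c)))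

  scanned-home : ∀ {B q p s c} → At B q p s c → proj₁ (scanned c) ≡ does (p ℕ.≟ 0)
  scanned-home {p = p} a = trans (cong proj₁ (scanned-cell a)) (home≡ a p)

  scanned-track : ∀ {B q p s c} → At B q p s c → ∀ j → track j (scanned c) ≡ bot (get j s) p
  scanned-track {p = p} a j = trans (cong (track j) (scanned-cell a)) (track≡ a p j)

  -- A step changes a single cell, so the store after it need only match the written cell at height
  -- `p` and the old store at all other heights. `suc (suc p) ≤ B` leaves room for a move to the
  -- right.
  one : ∀ {B q p s c} q' x m {s'} → At B q p s c → suc (suc p) ≤ B →
    proj₁ x ≡ proj₁ (scanned c) → (∀ j → track j x ≡ bot (get j s') p) →
    (∀ i j → i ≢ p → bot (get j s) i ≡ bot (get j s') i) →
    At B q' (movePos m p) s' (apply c (q' , x , m))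
  one {B} {q} {p} {s} {c} q' x m {s'} a pB hx tx keep = record
    { state≡ = act-state blank c (enc finCtl q') (enc finCell x) m
    ; pos≡ = trans (act-pos blank c (enc finCtl q') (enc finCell x) m) (cong (movePos m) (pos≡ a))
    ; space≤ = act-space blank c (enc finCtl q') (enc finCell x) m B (space≤ a) (subst (λ p → suc (suc p) ≤ B) (sym (pos≡ a)) pB)
    ; home≡ = λ i → case i ℕ.≟ p of λ
        { (yes refl) → trans (cong proj₁ new) (trans hx (scanned-home a))
        ; (no ne) → trans (cong proj₁ (old i ne)) (home≡ a i) }
    ; track≡ = λ i j → case i ℕ.≟ p of λ
        { (yes refl) → trans (cong (track j) new) (tx j)
        ; (no ne) → trans (cong (track j) (old i ne)) (trans (track≡ a i j) (keep i j ne)) } }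
    where
    c₁ = apply c (q' , x , m)
    new : cell c₁ p ≡ x
    new = trans (cong (cell c₁) (sym (pos≡ a)))
      (trans (cong (dec finCell) (act-written blank c (enc finCtl q') (enc finCell x) m)) (dec-enc finCell x))
    old : ∀ i → i ≢ p → cell c₁ i ≡ cell c i
    old i ne = cong (dec finCell) (act-kept blank c (enc finCtl q') (enc finCell x) m i λ e → ne (trans e (pos≡ a)))

  tstep-apply : ∀ {B q p s c x} → At B q p s c → δ q (scanned c) ≡ x → tstep c ≡ apply c x
  tstep-apply {c = c} a e = cong (apply c) (trans (cong (λ q → δ q (scanned c)) (ctl≡ a)) e)

  one-keep : ∀ {B q q' p s c m} → At B q p s c → suc (suc p) ≤ B → δ q (scanned c) ≡ (q' , scanned c , m) →
    At B q' (movePos m p) s (tstep c)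
  one-keep {B} {q} {q'} {p} {s} {c} {m} a pB e = subst (At B q' (movePos m p) s) (sym (tstep-apply a e))
    (one q' (scanned c) m a pB refl (scanned-track a) (λ _ _ _ → refl))

  one-put : ∀ {B q q' p s c m j x} l → At B q p s c → suc (suc p) ≤ B → δ q (scanned c) ≡ (q' , put j x (scanned c) , m) →
    x ≡ bot l p → (∀ i → i ≢ p → bot (get j s) i ≡ bot l i) →
    At B q' (movePos m p) (set j l s) (tstep c)
  one-put {B} {q} {q'} {p} {s} {c} {m} {j} {x} l a pB e ex keep =
    subst (At B q' (movePos m p) (set j l s)) (sym (tstep-apply a e)) (one q' (put j x (scanned c)) m a pB refl tx kp)
    where
    tx : ∀ i → track i (put j x (scanned c)) ≡ bot (get i (set j l s)) p
    tx i with enc finName i F.≟ enc finName j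
    ... | yes e with enc-injective finName e
    ... | refl = trans (V.lookup∘update (enc finName j) (proj₂ (scanned c)) x) (trans ex (cong (λ l → bot l p) (sym (get-set j l s))))
    tx i | no ne = trans (V.lookup∘update′ ne (proj₂ (scanned c)) x)
      (trans (scanned-track a i) (cong (λ l → bot l p) (sym (get-set-≢ l s (ne ∘ cong (enc finName))))))
    kp : ∀ i k → i ≢ p → bot (get k s) i ≡ bot (get k (set j l s)) i
    kp i k ne with enc finName k F.≟ enc finName j
    ... | yes e with enc-injective finName e
    ... | refl = trans (keep i ne) (cong (λ l → bot l i) (sym (get-set j l s)))
    kp i k ne | no ne' = cong (λ l → bot l i) (sym (get-set-≢ l s (ne' ∘ cong (enc finName))))

  plain : ∀ {B q p s c} → At B q p s c → Plain q → Plain (ctl c)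
  plain a pl = subst Plain (sym (ctl≡ a)) pl

  walk : ∀ {B st s c} j → (∀ {x} c → track j c ≡ just x → δseek st (instr st) c ≡ (seek st , c , right)) →
    suc (suc (length (get j s))) ≤ B → ∀ d p → p + d ≡ length (get j s) → At B (seek st) p s c →
    Σ Conf λ c' → Trace B d c c' × At B (seek st) (length (get j s)) s c'
  walk {B} {st} {s} {c} j go lB zero p e a = c , stop (space≤ a) , subst (λ p → At B (seek st) p s c) (trans (sym (+-identityʳ p)) e) a
  walk {B} {st} {s} {c} j go lB (suc d) p e a =
    let p<l = subst (suc p ≤_) (trans (sym (+-suc p d)) e) (m≤m+n (suc p) d)
        a₁ = one-keep a (≤-trans (s≤s p<l) (≤-trans (n≤1+n _) lB))
               (go (scanned c) (trans (scanned-track a j) (proj₂ (bot-< (get j s) p p<l))))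
        (c' , t , a') = walk j go lB d (suc p) (trans (sym (+-suc p d)) e) a₁
    in c' , next (space≤ a) (plain a tt) t , a'

  homeward : ∀ {B st s c} p → suc (suc p) ≤ B → At B (back st) p s c →
    Σ Conf λ c' → Trace B (suc p) c c' × At B (seek st) 0 s c'
  homeward {st = st} {c = c} zero pB a =
    let a₁ = one-keep {q' = seek st} {m = stay} a pB (cong (λ b → if b then (seek st , scanned c , stay) else (back st , scanned c , left)) (scanned-home a))
    in tstep c , next (space≤ a) (plain a tt) (stop (space≤ a₁)) , a₁
  homeward {st = st} {c = c} (suc p) pB a =
    let a₁ = one-keep {q' = back st} {m = left} a pB (cong (λ b → if b then (seek st , scanned c , stay) else (back st , scanned c , left)) (scanned-home a))
        (c' , t , a') = homeward p (≤-trans (n≤1+n _) pB) a₁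
    in c' , next (space≤ a) (plain a tt) t , a'

  Goes : ℕ → ℕ → Conf → S → Store → Set
  Goes B N c st s = Σ ℕ λ n → Σ Conf λ c' → n ≤ N × Trace B n c c' × At B (seek st) 0 s c'

  goes-trans : ∀ {B M N c st s st' s'} → Goes B M c st s → (∀ {c'} → At B (seek st) 0 s c' → Goes B N c' st' s') →
    Goes B (M + N) c st' s'
  goes-trans (m , c' , le , t , a) f =
    let (n , c'' , le' , t' , a') = f a in m + n , c'' , +-mono-≤ le le' , t ++ᵗ t' , a'

  goes-weak : ∀ {B M N c st s} → M ≤ N → Goes B M c st s → Goes B N c st s
  goes-weak MN (m , c' , le , r) = m , c' , ≤-trans le MN , r

  private
    -- A push onto a stack of height l takes l steps out, one to act, and l + 1 to walk home and
    -- leave `back`. A pop spends one more step on moving left, which also brings the head one cell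
    -- nearer to home.
    cost : ℕ → ℕ
    cost l = suc (suc (l + l))

    cost-mono : ∀ {l m} → l ≤ m → cost l ≤ cost m
    cost-mono le = s≤s (s≤s (+-mono-≤ le le))

  goes-push : ∀ {B st st' j a s c} → instr st ≡ ipush j a st' → suc (suc (length (get j s))) ≤ B →
    At B (seek st) 0 s c → Goes B (cost (length (get j s))) c st' (set j (a ∷ get j s) s)
  goes-push {B} {st} {st'} {j} {x} {s} {c} e lB a =
    let l = length (get j s)
        (c₁ , t₁ , a₁) = walk j go lB l 0 refl a
        a₂ = one-put (x ∷ get j s) a₁ lB (δtop c₁ a₁) (sym (bot-top x (get j s))) (λ i ne → sym (bot-off x (get j s) i ne))
        (c₃ , t₃ , a₃) = homeward l lB a₂
    in l + suc (suc l) , c₃ , ≤-reflexive (trans (+-suc l (suc l)) (cong suc (+-suc l l))) ,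
       (t₁ ++ᵗ next (space≤ a₁) (plain a₁ tt) t₃) , a₃
    where
    go : ∀ {y} c → track j c ≡ just y → δseek st (instr st) c ≡ (seek st , c , right)
    go c tr rewrite e | tr = refl
    δtop : ∀ c → At B (seek st) (length (get j s)) s c → δ (seek st) (scanned c) ≡ (back st' , put j (just x) (scanned c) , stay)
    δtop c a rewrite e | trans (scanned-track a j) (bot-≥ (get j s) (length (get j s)) ≤-refl) = refl

  goes-pop[] : ∀ {B st j f s c} → instr st ≡ ipop j f → get j s ≡ [] → 2 ≤ B →
    At B (seek st) 0 s c → Goes B 2 c (f nothing) s
  goes-pop[] {B} {st} {j} {f} {s} {c} e g lB a =
    let a₁ = one-keep {m = stay} a lB δtop
        (c₂ , t₂ , a₂) = homeward 0 lB a₁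
    in 2 , c₂ , ≤-refl , next (space≤ a) (plain a tt) t₂ , a₂
    where
    δtop : δ (seek st) (scanned c) ≡ (back (f nothing) , scanned c , stay)
    δtop rewrite e | trans (scanned-track a j) (cong (λ l → bot l 0) g) | scanned-home a = refl

  goes-pop∷ : ∀ {B st j f s c x l} → instr st ≡ ipop j f → get j s ≡ x ∷ l → suc (suc (suc (length l))) ≤ B →
    At B (seek st) 0 s c → Goes B (cost (suc (length l))) c (f (just x)) (set j l s)
  goes-pop∷ {B} {st} {j} {f} {s} {c} {x} {l} e g lB a =
    let n = length l
        gl = cong length g
        (c₁ , t₁ , a₁) = walk j go (subst (λ n → suc (suc n) ≤ B) (sym gl) lB) (suc n) 0 (sym gl) a
        a₁ = subst (λ n → At B (seek st) n s c₁) gl a₁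
        a₂ = one-keep {q' = read st} {m = left} a₁ lB (δtop c₁ a₁)
        nB = ≤-trans (n≤1+n _) lB
        a₃ = one-put l a₂ nB (δrd (tstep c₁) a₂) (sym (bot-≥ l n ≤-refl))
               (λ i ne → trans (cong (λ l → bot l i) g) (bot-off x l i ne))
        (c₄ , t₄ , a₄) = homeward n nB a₃
    in suc n + suc (suc (suc n)) , c₄ ,
       ≤-reflexive (trans (+-suc (suc n) (suc (suc n))) (cong suc (+-suc (suc n) (suc n)))) ,
       (t₁ ++ᵗ next (space≤ a₁) (plain a₁ tt) (next (space≤ a₂) (plain a₂ tt) t₄)) , a₄
    where
    go : ∀ {y} c → track j c ≡ just y → δseek st (instr st) c ≡ (seek st , c , right)
    go c tr rewrite e | tr = refl
    δtop : ∀ c → At B (seek st) (suc (length l)) s c → δ (seek st) (scanned c) ≡ (read st , scanned c , left)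
    δtop c a rewrite e | trans (scanned-track a j) (bot-≥ (get j s) (suc (length l)) (≤-reflexive (cong length g)))
                   | scanned-home a = refl
    δrd : ∀ c → At B (read st) (length l) s c → δ (read st) (scanned c) ≡ (back (f (just x)) , put j nothing (scanned c) , stay)
    δrd c a rewrite e = cong (λ m → back (f m) , put j nothing (scanned c) , stay)
      (trans (scanned-track a j) (trans (cong (λ k → bot k (length l)) g) (bot-top x l)))

  goes-nop : ∀ {B st st' s c} → instr st ≡ inop st' → 2 ≤ B → At B (seek st) 0 s c → Goes B 1 c st' s
  goes-nop {st = st} {st'} {c = c} e lB a =
    let a₁ = one-keep {q' = seek st'} {m = stay} a lB (δnop (scanned c))
    in 1 , tstep c , ≤-refl , next (space≤ a) (plain a tt) (stop (space≤ a₁)) , a₁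
    where
    δnop : ∀ c → δseek st (instr st) c ≡ (seek st' , c , stay)
    δnop c rewrite e = refl

  module _ (B₀ : ℕ) where
    private
      B K : ℕ
      -- The head gets as far as cell `B₀`, just beyond a stack of that height, and `one` asks for
      -- two cells more than its position.
      B = suc (suc B₀)
      K = cost B₀
      1≤K : 1 ≤ K
      1≤K = s≤s z≤n
      2≤K : 2 ≤ K
      2≤K = s≤s (s≤s z≤n)

    goes-exec : ∀ {t c s s' x} (emb : Lbl c → S) (ex : S) → (∀ l → instr (emb l) ≡ code c emb ex l) →
      Exec St (_≤ B₀) t c s s' → At B (seek (emb (entry c))) 0 s x → Goes B (t * K) x ex s'
    goes-exec emb ex i (weak le d) a = goes-weak (*-monoˡ-≤ K le) (goes-exec emb ex i d a)
    goes-exec emb ex i eskip a = goes-weak (≤-trans 1≤K (m≤m+n K 0)) (goes-nop (i tt) (s≤s (s≤s z≤n)) a)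
    goes-exec emb ex i (epush ok) a = goes-weak (≤-trans (cost-mono ok) (m≤m+n K 0)) (goes-push (i tt) (s≤s (s≤s ok)) a)
    goes-exec {t = suc t} {c = pop j f} emb ex i (epop[] g d) a = goes-weak (+-monoˡ-≤ (t * K) 2≤K)
      (goes-trans (goes-pop[] (i (inj₁ tt)) g (s≤s (s≤s z≤n)) a)
        (goes-exec (λ l → emb (inj₂ (nothing , l))) ex (λ l → i (inj₂ (nothing , l))) d))
    goes-exec {t = suc t} {c = pop j f} emb ex i (epop∷ {a = x} g ok d) a = goes-weak (+-monoˡ-≤ (t * K) (cost-mono ok))
      (goes-trans (goes-pop∷ (i (inj₁ tt)) g (s≤s (s≤s ok)) a)
        (goes-exec (λ l → emb (inj₂ (just x , l))) ex (λ l → i (inj₂ (just x , l))) d))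
    goes-exec {c = c ⨾ d} emb ex i (eseq {t} {t'} e₁ e₂) a = goes-weak (≤-reflexive (sym (*-distribʳ-+ K t t')))
      (goes-trans (goes-exec (emb ∘ inj₁) _ (i ∘ inj₁) e₁ a) (goes-exec (emb ∘ inj₂) ex (i ∘ inj₂) e₂))
    goes-exec {c = loop j f} emb ex i (eloop[] g) a = goes-weak (≤-trans 2≤K (m≤m+n K 0))
      (goes-pop[] (i (inj₁ tt)) g (s≤s (s≤s z≤n)) a)
    goes-exec {c = loop j f} emb ex i (eloop∷ {t} {t'} {a = x} g ok e₁ e₂) a =
      goes-weak (+-mono-≤ (cost-mono ok) (≤-reflexive (sym (*-distribʳ-+ K t t'))))
      (goes-trans (goes-pop∷ (i (inj₁ tt)) g (s≤s (s≤s ok)) a) λ a₁ →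
        goes-trans (goes-exec (λ l → emb (inj₂ (x , l))) (emb (inj₁ tt)) (λ l → i (inj₂ (x , l))) e₁ a₁)
          (goes-exec emb ex i e₂))

  goes-halt : ∀ {B st b s c} → instr st ≡ ihalt b → 2 ≤ B → At B (seek st) 0 s c →
    Trace B 1 c (tstep c) × state (tstep c) ≡ enc finCtl (done b)
  goes-halt {st = st} {b} {c = c} e lB a =
    let a₁ = one-keep {q' = done b} {m = stay} a lB (δhalt (scanned c))
    in next (space≤ a) (plain a tt) (stop (space≤ a₁)) , state≡ a₁
    where
    δhalt : ∀ c → δseek st (instr st) c ≡ (done b , c , stay)
    δhalt c rewrite e = refl

-- Polynomial bounds

-- Domination by some `poly c d`, the form in which the complexity classes state their bounds.
Poly : (ℕ → ℕ) → Set
Poly f = Σ ℕ λ c → Σ ℕ λ d → ∀ n → f n ≤ poly c d n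

poly-const : ∀ k → Poly (λ _ → k)
poly-const k = k , 0 , λ n → ≤-reflexive (sym (*-identityʳ k))

poly-id : Poly (λ n → n)
poly-id = 1 , 1 , λ n → ≤-trans (n≤1+n n) (≤-reflexive (sym (trans (+-identityʳ _) (*-identityʳ (suc n)))))

poly-* : ∀ {f g} → Poly f → Poly g → Poly (λ n → f n * g n)
poly-* (c , d , p) (c' , d' , p') = c * c' , d + d' , λ n → ≤-trans (*-mono-≤ (p n) (p' n))
  (≤-reflexive (trans (regroup c (suc n ^ d) c' (suc n ^ d')) (cong (c * c' *_) (sym (^-distribˡ-+-* (suc n) d d')))))
  where
  regroup : ∀ a b x y → a * b * (x * y) ≡ a * x * (b * y)
  regroup = solve-∀

-- Both exponents can be raised to `d + d'` because the base of `poly` is `suc n`, hence at least 1.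
poly-+ : ∀ {f g} → Poly f → Poly g → Poly (λ n → f n + g n)
poly-+ (c , d , p) (c' , d' , p') = c + c' , d + d' , λ n → ≤-trans
  (+-mono-≤ (≤-trans (p n) (*-monoʳ-≤ c (^-monoʳ-≤ (suc n) (m≤m+n d d'))))
            (≤-trans (p' n) (*-monoʳ-≤ c' (^-monoʳ-≤ (suc n) (m≤n+m d' d)))))
  (≤-reflexive (sym (*-distribʳ-+ (suc n ^ (d + d')) c c')))

poly-suc : ∀ {f} → Poly f → Poly (λ n → suc (f n))
poly-suc = poly-+ (poly-const 1)

poly-^ : ∀ {f} → Poly f → ∀ d → Poly (λ n → f n ^ d)
poly-^ p zero = poly-const 1
poly-^ p (suc d) = poly-* p (poly-^ p d)

poly-poly : ∀ c d {f} → Poly f → Poly (λ n → poly c d (f n))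
poly-poly c d p = poly-* (poly-const c) (poly-^ (poly-suc p) d)

poly-mono : ∀ c d {m n} → m ≤ n → poly c d m ≤ poly c d n
poly-mono c d le = *-monoʳ-≤ c (^-monoˡ-≤ d (s≤s le))

-- From stack programs to complexity classes

module _ {Γ : Set} (St : Storage Γ) where
  open Storage St

  Heights : ℕ → Store → Set
  Heights m s = ∀ j → length (get j s) ≤ m

  heights-set : ∀ {m s} j l → length l ≤ m → Heights m s → Heights m (set j l s)
  heights-set {m} {s} j l le h i with enc finName i F.≟ enc finName j
  ... | no ne = subst (λ l → length l ≤ m) (sym (get-set-≢ l s (ne ∘ cong (enc finName)))) (h i)
  ... | yes e with enc-injective finName e
  ... | refl = subst (λ l → length l ≤ m) (sym (get-set j l s)) le

  heights-≤ : ∀ {m n s} → m ≤ n → Heights m s → Heights n s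
  heights-≤ le h j = ≤-trans (h j) le

  private
    popped : ∀ {m s} j {a l} → get j s ≡ a ∷ l → Heights m s → suc (length l) ≤ m
    popped {m} j g h = subst (λ l → length l ≤ m) g (h j)

  -- An instruction lengthens a stack by at most one symbol. So from heights at most `m`, nothing
  -- exceeds `m + t` within `t` instructions, and an execution without height conditions acquires
  -- them.
  exec-bounded : ∀ {B m t c s s'} → Exec St (λ _ → ⊤) t c s s' → Heights m s → m + t ≤ B →
    Exec St (_≤ B) t c s s' × Heights (m + t) s'
  exec-bounded {B} {m} {s = s} (weak {t} {t'} le e) h b =
    let (e' , h') = exec-bounded e h (≤-trans (+-monoʳ-≤ m le) b) in weak le e' , heights-≤ (+-monoʳ-≤ m le) h'
  exec-bounded eskip h b = eskip , heights-≤ (m≤m+n _ 1) h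
  exec-bounded {m = m} {s = s} (epush {j} {a} _) h b =
    epush (≤-trans (h j) (m+n≤o⇒m≤o m b)) ,
    heights-set j (a ∷ get j s) (≤-trans (s≤s (h j)) (≤-reflexive (+-comm 1 m))) (heights-≤ (m≤m+n m 1) h)
  exec-bounded {m = m} (epop[] {t} g e) h b =
    let le = +-monoʳ-≤ m (n≤1+n t) ; (e' , h') = exec-bounded e h (≤-trans le b) in epop[] g e' , heights-≤ le h'
  exec-bounded {m = m} (epop∷ {t} {j} {l = l} g _ e) h b =
    let le = +-monoʳ-≤ m (n≤1+n t) ; lm = popped j g h
        (e' , h') = exec-bounded e (heights-set j l (≤-trans (n≤1+n _) lm) h) (≤-trans le b)
    in epop∷ g (≤-trans lm (m+n≤o⇒m≤o m b)) e' , heights-≤ le h'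
  exec-bounded {B} {m = m} (eseq {t} {t'} e₁ e₂) h b =
    let b' = subst (_≤ B) (sym (+-assoc m t t')) b
        (e₁' , h₁) = exec-bounded e₁ h (m+n≤o⇒m≤o (m + t) b')
        (e₂' , h₂) = exec-bounded e₂ h₁ b'
    in eseq e₁' e₂' , heights-≤ (≤-reflexive (+-assoc m t t')) h₂
  exec-bounded {m = m} (eloop[] g) h b = eloop[] g , heights-≤ (m≤m+n m 1) h
  exec-bounded {B} {m} (eloop∷ {t} {t'} {j} {l = l} g _ e₁ e₂) h b =
    let lm = popped j g h
        le = ≤-trans (≤-reflexive (+-assoc m t t')) (+-monoʳ-≤ m (n≤1+n (t + t')))
        b' = ≤-trans le b
        (e₁' , h₁) = exec-bounded e₁ (heights-set j l (≤-trans (n≤1+n _) lm) h) (m+n≤o⇒m≤o (m + t) b')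
        (e₂' , h₂) = exec-bounded e₂ h₁ b'
    in eloop∷ g (≤-trans lm (m+n≤o⇒m≤o m b)) e₁' e₂' , heights-≤ le h₂

record InputStorage (Γ : Set) : Set₁ where
  field
    storage : Storage Γ
  open Storage storage public
  field
    IN CERT : Name
    s₀ : List Γ → List Γ → Store
    get-IN    : ∀ a c → get IN (s₀ a c) ≡ a
    get-CERT  : ∀ a c → get CERT (s₀ a c) ≡ c
    get-other : ∀ j a c → j ≢ IN → j ≢ CERT → get j (s₀ a c) ≡ []

-- A command is turned into a decider and into a nondeterministic machine that first guesses the
-- stack `CERT`. Both accept when the stack `res` is nonempty at the end.
module Program {Γ : Set} (finΓ : Finite Γ) (Is : InputStorage Γ) (cmd : Cmd (InputStorage.Name Is) Γ)
               (res : InputStorage.Name Is) (yea : Γ) {k : ℕ} (sym# : Fin k → Γ) where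
  open InputStorage Is

  verdict : Bool → List Γ
  verdict b = if b then yea ∷ [] else []

  private
    S : Set
    S = Lbl cmd ⊎ (⊤ ⊎ Bool)

    instr : S → Instr Name Γ S
    instr (inj₁ l)        = code cmd inj₁ (inj₂ (inj₁ tt)) l
    instr (inj₂ (inj₁ _)) = ipop res (maybe (λ _ → inj₂ (inj₂ true)) (inj₂ (inj₂ false)))
    instr (inj₂ (inj₂ b)) = ihalt b

  open Machine finΓ storage (fin⊎ (finLbl finΓ cmd) (fin⊎ fin⊤ finBool)) instr (inj₁ (entry cmd))

  inpCell : Fin k → Cell
  inpCell a = put IN (just (sym# a)) blankCell

  init : List (Fin k) → Conf
  init = initial blank (enc finCell ∘ inpCell) (enc finCtl mark)

  input : List (Fin k) → List Γ
  input w = reverse (map sym# w)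

  length-input : ∀ w → length (input w) ≡ length w
  length-input w = trans (length-reverse (map sym# w)) (length-map sym# w)

  private
    tape-init : ∀ w i → cell (init w) i ≡ nth blankCell (map inpCell w) i
    tape-init [] zero = dec-enc finCell blankCell
    tape-init [] (suc i) = dec-enc finCell blankCell
    tape-init (a ∷ w) i = go (a ∷ w) i
      where
      go : ∀ w i → dec finCell (nth blank (map (enc finCell ∘ inpCell) w) i) ≡ nth blankCell (map inpCell w) i
      go [] i = dec-enc finCell blankCell
      go (a ∷ w) zero = dec-enc finCell (inpCell a)
      go (a ∷ w) (suc i) = go w i

    blank-track : ∀ j → track j blankCell ≡ nothing
    blank-track j = V.lookup-replicate (enc finName j) nothing

    track-IN : ∀ w i → track IN (nth blankCell (map inpCell w) i) ≡ nth nothing (map just (map sym# w)) i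
    track-IN [] i = blank-track IN
    track-IN (a ∷ w) zero = V.lookup∘update (enc finName IN) (proj₂ blankCell) (just (sym# a))
    track-IN (a ∷ w) (suc i) = track-IN w i

    track-other : ∀ j → j ≢ IN → ∀ w i → track j (nth blankCell (map inpCell w) i) ≡ nothing
    track-other j ne [] i = blank-track j
    track-other j ne (a ∷ w) zero =
      trans (V.lookup∘update′ (ne ∘ enc-injective finName) (proj₂ blankCell) (just (sym# a))) (blank-track j)
    track-other j ne (a ∷ w) (suc i) = track-other j ne w i

    home-init : ∀ w i → proj₁ (nth blankCell (map inpCell w) i) ≡ false
    home-init [] i = refl
    home-init (a ∷ w) zero = refl
    home-init (a ∷ w) (suc i) = home-init w i

    _≟ⁿ_ : (i j : Name) → Dec (i ≡ j)
    i ≟ⁿ j with enc finName i F.≟ enc finName j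
    ... | yes e = yes (enc-injective finName e)
    ... | no ne = no (ne ∘ cong (enc finName))

    track-init : ∀ w i j → track j (nth blankCell (map inpCell w) i) ≡ bot (get j (s₀ (input w) [])) i
    track-init w i j with j ≟ⁿ IN
    ... | yes refl = trans (track-IN w i)
      (trans (sym (bot-reverse (map sym# w) i)) (cong (λ l → bot l i) (sym (get-IN (input w) []))))
    ... | no ne with j ≟ⁿ CERT
    ... | yes refl = trans (track-other j ne w i) (cong (λ l → bot l i) (sym (get-CERT (input w) [])))
    ... | no ne' = trans (track-other j ne w i) (cong (λ l → bot l i) (sym (get-other j (input w) [] ne ne')))

    space-init : ∀ w → space (init w) ≤ suc (length w)
    space-init [] = s≤s z≤n
    space-init (a ∷ w) = s≤s (≤-trans (≤-reflexive (length-map _ w)) (n≤1+n _))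

    pos-init : ∀ w → pos (init w) ≡ 0
    pos-init [] = refl
    pos-init (a ∷ w) = refl

    ctl-init : ∀ w → ctl (init w) ≡ mark
    ctl-init [] = dec-enc finCtl mark
    ctl-init (a ∷ w) = dec-enc finCtl mark

  heights-init : ∀ w c m → length w ≤ m → length c ≤ m → Heights storage m (s₀ (input w) c)
  heights-init w c m wm cm j with j ≟ⁿ IN
  ... | yes refl = subst (λ l → length l ≤ m) (sym (get-IN (input w) c)) (subst (_≤ m) (sym (length-input w)) wm)
  ... | no ne with j ≟ⁿ CERT
  ... | yes refl = subst (λ l → length l ≤ m) (sym (get-CERT (input w) c)) cm
  ... | no ne' = subst (λ l → length l ≤ m) (sym (get-other j (input w) c ne ne')) z≤n

  -- The input map of a machine sees a symbol but not its position, so the home mark cannot be part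
  -- of the initial tape and is written by the first step. `q` is left open because the two machines
  -- continue differently.
  marked : ∀ q w {B} → suc (suc (length w)) ≤ B →
    At B q 0 (s₀ (input w) []) (apply (init w) (q , (true , proj₂ (scanned (init w))) , stay))
  marked q w {B} wB = at
    (act-state blank c (enc finCtl q) (enc finCell x) stay)
    (trans (act-pos blank c (enc finCtl q) (enc finCell x) stay) (pos-init w))
    (act-space blank c (enc finCtl q) (enc finCell x) stay B (≤-trans (space-init w) (≤-trans (n≤1+n _) wB))
      (subst (λ p → suc (suc p) ≤ B) (sym (pos-init w)) (≤-trans (s≤s (s≤s z≤n)) wB)))
    home
    tracks
    where
    c = init w
    x : Cell
    x = true , proj₂ (scanned c)
    c₁ = apply c (q , x , stay)
    new : cell c₁ 0 ≡ x
    new = trans (cong (cell c₁) (sym (pos-init w)))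
      (trans (cong (dec finCell) (act-written blank c (enc finCtl q) (enc finCell x) stay)) (dec-enc finCell x))
    old : ∀ i → cell c₁ (suc i) ≡ cell c (suc i)
    old i = cong (dec finCell) (act-kept blank c (enc finCtl q) (enc finCell x) stay (suc i) λ e → case trans e (pos-init w) of λ ())
    home : ∀ i → proj₁ (cell c₁ i) ≡ does (i ℕ.≟ 0)
    home zero = cong proj₁ new
    home (suc i) = trans (cong proj₁ (trans (old i) (tape-init w (suc i)))) (home-init w (suc i))
    hd≡ : scanned c ≡ cell c 0
    hd≡ = sym (trans (cong (cell c) (sym (pos-init w))) (cong (dec finCell) (hd-tape blank c)))
    tracks : ∀ i j → track j (cell c₁ i) ≡ bot (get j (s₀ (input w) [])) i
    tracks zero j = trans (cong (track j) new)
      (trans (cong (track j) (trans hd≡ (tape-init w 0))) (track-init w 0 j))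
    tracks (suc i) j = trans (cong (track j) (trans (old i) (tape-init w (suc i)))) (track-init w (suc i) j)

  -- `suc p` steps lead home from cell `p`, the extra instruction in `suc t` is the final pop of the
  -- result, and the last step halts.
  runTime : ℕ → ℕ → ℕ → ℕ
  runTime B₀ t p = suc p + (suc t * suc (suc (B₀ + B₀)) + 1)

  runs : ∀ B₀ {t s s' b p c} → Exec storage (_≤ B₀) t cmd s s' → get res s' ≡ verdict b → 1 ≤ B₀ → p ≤ B₀ →
    At (2 + B₀) (back (inj₁ (entry cmd))) p s c →
    Σ ℕ λ n → Σ Conf λ c' → n ≤ runTime B₀ t p × Trace (2 + B₀) n c c' × state c' ≡ enc finCtl (done b)
  runs B₀ {t} {s} {s'} {b} {p} e r 1≤B pB a =
    let (c₁ , t₁ , a₁) = homeward p (s≤s (s≤s pB)) a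
        (n₃ , c₃ , le , t₃ , a₃) = goes-weak (≤-reflexive (+-comm (t * K) K)) (goes-trans (goes-exec B₀ inj₁ _ (λ _ → refl) e a₁) (final b r))
        (t₄ , d) = goes-halt refl (s≤s (s≤s z≤n)) a₃
    in suc p + (n₃ + 1) , _ , +-monoʳ-≤ (suc p) (+-monoˡ-≤ 1 le) , (t₁ ++ᵗ (t₃ ++ᵗ t₄)) , d
    where
    K : ℕ
    K = suc (suc (B₀ + B₀))
    final : ∀ b → get res s' ≡ verdict b → ∀ {c} → At (2 + B₀) (seek (inj₂ (inj₁ tt))) 0 s' c →
      Goes (2 + B₀) K c (inj₂ (inj₂ b)) (if b then set res [] s' else s')
    final true r a = goes-weak (s≤s (s≤s (+-mono-≤ 1≤B 1≤B))) (goes-pop∷ refl r (s≤s (s≤s 1≤B)) a)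
    final false r a = goes-weak (s≤s (s≤s z≤n)) (goes-pop[] refl r (s≤s (s≤s z≤n)) a)

  dtm : DTM k
  dtm = record
    { Q = card finCtl ; G = card finCell ; blank = blank ; inp = enc finCell ∘ inpCell
    ; start = enc finCtl mark ; accept = enc finCtl (done true) ; reject = enc finCtl (done false)
    ; δ = λ q g → encAction (δ (dec finCtl q) (dec finCell g)) }

  private
    not-done : ∀ c b → ctl c ≢ done b → does (state c F.≟ enc finCtl (done b)) ≡ false
    not-done c b ne = dec-false (state c F.≟ _) λ e → ne (trans (cong (dec finCtl) e) (dec-enc finCtl (done b)))

    done-injective : ∀ {b b'} → done b ≡ done b' → b ≡ b'
    done-injective refl = refl

    Busy : Ctl → Set
    Busy q = ∀ b → q ≢ done b

    plain-busy : ∀ q → Plain q → Busy q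
    plain-busy (seek s) _ b ()
    plain-busy (read s) _ b ()
    plain-busy (back s) _ b ()

    dstep≡tstep : ∀ c → Busy (ctl c) → dstep dtm c ≡ tstep c
    dstep≡tstep c bs rewrite not-done c true (bs true) | not-done c false (bs false) = refl

    drun-trace : ∀ {B n c c'} → Trace B n c c' → drun dtm n c ≡ c'
    drun-trace (stop _) = refl
    drun-trace {n = suc n} {c} (next _ p t) = trans (cong (drun dtm n) (dstep≡tstep c (plain-busy _ p))) (drun-trace t)

    space-trace : ∀ {B n c c'} → Trace B n c c' → ∀ i → i ≤ n → space (drun dtm i c) ≤ B
    space-trace (stop b) zero le = b
    space-trace (next b p t) zero le = b
    space-trace {B} {c = c} (next b p t) (suc i) (s≤s le) =
      subst (λ c → space (drun dtm i c) ≤ B) (sym (dstep≡tstep c (plain-busy _ p))) (space-trace t i le)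

  -- The execution time `t` may be arbitrarily large; the space of the machine depends on the stack
  -- heights alone.
  inPSPACE : (L : Language k) (B : ℕ → ℕ) → Poly B →
    (∀ w → length w ≤ B (length w) × 1 ≤ B (length w) × Σ ℕ λ t → Σ Store λ s' → Σ Bool λ b →
      Exec storage (_≤ B (length w)) t cmd (s₀ (input w) []) s' × get res s' ≡ verdict b × (L w ⇔ b ≡ true)) →
    InPSPACE L
  inPSPACE L B pB dcd = dtm , proj₁ pB' , proj₁ (proj₂ pB') , λ w → ok w (dcd w)
    where
    pB' : Poly (λ n → 2 + B n)
    pB' = poly-suc (poly-suc pB)
    P : ℕ → ℕ
    P = poly (proj₁ pB') (proj₁ (proj₂ pB'))
    ok : ∀ w → length w ≤ B (length w) × 1 ≤ B (length w) × (Σ ℕ λ t → Σ Store λ s' → Σ Bool λ b →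
      Exec storage (_≤ B (length w)) t cmd (s₀ (input w) []) s' × get res s' ≡ verdict b × (L w ⇔ b ≡ true)) →
      Σ ℕ λ n → ((i : ℕ) → i ≤ n → space (drun dtm i (dinit dtm w)) ≤ P (length w)) ×
      (halted dtm (state (drun dtm n (dinit dtm w))) ≡ true) ×
      (L w ⇔ (state (drun dtm n (dinit dtm w)) ≡ DTM.accept dtm))
    ok w (wB , 1B , t , s' , b , e , r , Lw) = finish (runs (B (length w)) e r 1B z≤n (marked (back (inj₁ (entry cmd))) w (s≤s (s≤s wB))))
      where
      finish : (Σ ℕ λ n → Σ Conf λ c' → n ≤ runTime (B (length w)) t 0 ×
        Trace (2 + B (length w)) n (apply (init w) (back (inj₁ (entry cmd)) , (true , proj₂ (scanned (init w))) , stay)) c' ×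
        state c' ≡ enc finCtl (done b)) →
        Σ ℕ λ n → ((i : ℕ) → i ≤ n → space (drun dtm i (dinit dtm w)) ≤ P (length w)) ×
        (halted dtm (state (drun dtm n (dinit dtm w))) ≡ true) ×
        (L w ⇔ (state (drun dtm n (dinit dtm w)) ≡ DTM.accept dtm))
      finish (n , c' , _ , tr , d) = suc n , sp , ends , Lw'
       where
       c₀ = init w
       step₀ : dstep dtm c₀ ≡ apply c₀ (back (inj₁ (entry cmd)) , (true , proj₂ (scanned c₀)) , stay)
       step₀ = trans (dstep≡tstep c₀ (subst Busy (sym (ctl-init w)) λ b ()))
                 (cong (λ q → apply c₀ (δ q (scanned c₀))) (ctl-init w))
       run≡ : state (drun dtm n (dstep dtm c₀)) ≡ enc finCtl (done b)
       run≡ = trans (cong state (trans (cong (drun dtm n) step₀) (drun-trace tr))) d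
       sp : ∀ i → i ≤ suc n → space (drun dtm i c₀) ≤ P (length w)
       sp zero _ = ≤-trans (≤-trans (space-init w) (≤-trans (n≤1+n _) (s≤s (s≤s wB)))) (proj₂ (proj₂ pB') (length w))
       sp (suc i) (s≤s le) = ≤-trans (subst (λ c → space (drun dtm i c) ≤ _) (sym step₀) (space-trace tr i le)) (proj₂ (proj₂ pB') (length w))
       done-halted : ∀ b → halted dtm (enc finCtl (done b)) ≡ true
       done-halted true = cong (_∨ does (enc finCtl (done true) F.≟ enc finCtl (done false))) (dec-true (enc finCtl (done true) F.≟ enc finCtl (done true)) refl)
       done-halted false = trans (cong (does (enc finCtl (done false) F.≟ enc finCtl (done true)) ∨_) (dec-true (enc finCtl (done false) F.≟ enc finCtl (done false)) refl)) (∨-zeroʳ _)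
       ends : halted dtm (state (drun dtm n (dstep dtm c₀))) ≡ true
       ends = trans (cong (halted dtm) run≡) (done-halted b)
       Lw' : L w ⇔ (state (drun dtm n (dstep dtm c₀)) ≡ enc finCtl (done true))
       Lw' = mk⇔ (λ l → trans run≡ (cong (enc finCtl ∘ done) (Equivalence.to Lw l)))
         (λ e → Equivalence.from Lw (done-injective (enc-injective finCtl {done b} {done true} (trans (sym run≡) e))))

  guesses : Cell → List Action
  guesses c = map (λ i → guess , put CERT (just (dec finΓ i)) c , right) (allFin (card finΓ))

  -- In `guess` the head either writes a symbol on the track of `CERT` and moves right, so that the
  -- certificate grows at its top, or it ends the guessing. A `done` control has no successor, so no
  -- run continues after a verdict.
  δᴺ : Ctl → Cell → List Action
  δᴺ (seek s) c = [ δ (seek s) c ]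
  δᴺ (read s) c = [ δ (read s) c ]
  δᴺ (back s) c = [ δ (back s) c ]
  δᴺ (done b) c = []
  δᴺ mark     c = [ (guess , (true , proj₂ c) , stay) ]
  δᴺ guess    c = (back (inj₁ (entry cmd)) , c , stay) ∷ guesses c

  ntm : NTM k
  ntm = record
    { Q = card finCtl ; G = card finCell ; blank = blank ; inp = enc finCell ∘ inpCell
    ; start = enc finCtl mark ; accept = enc finCtl (done true)
    ; δ = λ q g → map encAction (δᴺ (dec finCtl q) (dec finCell g)) }

  private
    step-to : ∀ {n c c' x} → x ∈ δᴺ (ctl c) (scanned c) → Reach ntm n (apply c x) c' → Reach ntm (suc n) c c'
    step-to x∈ r = step (∈-map⁺ encAction x∈) r

    step-from : ∀ {n c c'} → Reach ntm (suc n) c c' → Σ Action λ x → x ∈ δᴺ (ctl c) (scanned c) × Reach ntm n (apply c x) c'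
    step-from (step x∈ r) with ∈-map⁻ encAction x∈
    ... | x , x∈' , refl = x , x∈' , r

    δᴺ-plain : ∀ q c → Plain q → δᴺ q c ≡ [ δ q c ]
    δᴺ-plain (seek s) c _ = refl
    δᴺ-plain (read s) c _ = refl
    δᴺ-plain (back s) c _ = refl

    plain-not-done : ∀ {c : Conf} {b} → Plain (ctl c) → state c ≢ enc finCtl (done b)
    plain-not-done {c} {b} p e = plain-busy (ctl c) p b (trans (cong (dec finCtl) e) (dec-enc finCtl (done b)))

    reach-trans : ∀ {m n c c' c''} → Reach ntm m c c' → Reach ntm n c' c'' → Reach ntm (m + n) c c''
    reach-trans here r = r
    reach-trans (step x∈ r) r' = step x∈ (reach-trans r r')

    reach-trace : ∀ {B n c c'} → Trace B n c c' → Reach ntm n c c'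
    reach-trace (stop _) = here
    reach-trace {c = c} (next _ p t) = step-to (subst (δ (ctl c) (scanned c) ∈_) (sym (δᴺ-plain _ _ p)) (first refl)) (reach-trace t)

    -- The machine is deterministic along the trace, not accepting before its end and stuck there. A
    -- run that ends in acceptance can therefore only be the whole trace.
    trace-reach : ∀ {B n m c c' c''} → Trace B n c c' → Σ Bool (λ b → state c' ≡ enc finCtl (done b)) → Reach ntm m c c'' →
      state c'' ≡ enc finCtl (done true) → state c' ≡ enc finCtl (done true)
    trace-reach (stop _) _ here e = e
    trace-reach {c = c} (stop _) (b , e) r@(step _ _) _ with step-from r
    ... | x , x∈ , _ with subst (λ q → x ∈ δᴺ q (scanned c)) (trans (cong (dec finCtl) e) (dec-enc finCtl (done b))) x∈
    ... | ()
    trace-reach {c = c} (next _ p t) d here e = ⊥-elim (plain-not-done {c} p e)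
    trace-reach {c = c} (next _ p t) d r@(step _ _) e with step-from r
    ... | x , x∈ , r' with subst (x ∈_) (δᴺ-plain _ _ p) x∈
    ... | first refl = trace-reach t d r' e

    guessed : ∀ γ i c {B} {x : Conf} → At B guess (length c) (s₀ i c) x → suc (suc (length c)) ≤ B →
      At B guess (suc (length c)) (s₀ i (γ ∷ c)) (apply x (guess , put CERT (just γ) (scanned x) , right))
    guessed γ i c {B} {x} a lB = one guess (put CERT (just γ) (scanned x)) right a lB refl tx kp
      where
      same : ∀ j → j ≢ CERT → get j (s₀ i c) ≡ get j (s₀ i (γ ∷ c))
      same j ne with j ≟ⁿ IN
      ... | yes refl = trans (get-IN i c) (sym (get-IN i (γ ∷ c)))
      ... | no ne' = trans (get-other j i c ne' ne) (sym (get-other j i (γ ∷ c) ne' ne))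
      tx : ∀ j → track j (put CERT (just γ) (scanned x)) ≡ bot (get j (s₀ i (γ ∷ c))) (length c)
      tx j with j ≟ⁿ CERT
      ... | yes refl = trans (V.lookup∘update (enc finName CERT) (proj₂ (scanned x)) (just γ))
        (trans (sym (bot-top γ c)) (cong (λ l → bot l (length c)) (sym (get-CERT i (γ ∷ c)))))
      ... | no ne = trans (V.lookup∘update′ (ne ∘ enc-injective finName) (proj₂ (scanned x)) (just γ))
        (trans (scanned-track a j) (cong (λ l → bot l (length c)) (same j ne)))
      kp : ∀ p j → p ≢ length c → bot (get j (s₀ i c)) p ≡ bot (get j (s₀ i (γ ∷ c))) p
      kp p j ne with j ≟ⁿ CERT
      ... | yes refl = trans (cong (λ l → bot l p) (get-CERT i c))
        (trans (sym (bot-off γ c p ne)) (cong (λ l → bot l p) (sym (get-CERT i (γ ∷ c)))))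
      ... | no ne' = cong (λ l → bot l p) (same j ne')

    at-weak : ∀ {B B' q p s c} → B ≤ B' → At B q p s c → At B' q p s c
    at-weak le (at a b s h t) = at a b (≤-trans s le) h t

    not-accepting : ∀ {B q p s c} → At B q p s c → Busy q → state c ≢ enc finCtl (done true)
    not-accepting a bs e = bs true (enc-injective finCtl (trans (sym (At.state≡ a)) e))

    -- An accepting run of the guessing phase fixes the certificate it has written.
    guess-inv : ∀ {n B i c x x'} → At B guess (length c) (s₀ i c) x → Reach ntm n x x' → state x' ≡ enc finCtl (done true) →
      Σ (List Γ) λ c' → Σ ℕ λ B' → Σ Conf λ y → Σ ℕ λ n' →
      At B' (back (inj₁ (entry cmd))) (length c') (s₀ i c') y × Reach ntm n' y x'
    guess-inv a here e = ⊥-elim (not-accepting a (λ b ()) e)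
    guess-inv {suc n} {B} {i} {c} {x} a r@(step _ _) e with step-from r
    ... | y , y∈ , r' with subst (λ q → y ∈ δᴺ q (scanned x)) (ctl≡ a) y∈
    -- A guessed certificate may be of any length, so there is no space bound fixed in advance; `B`
    -- is enlarged as far as `one` demands.
    ... | first refl = c , B + suc (suc (length c)) , apply x y , n ,
          one (back (inj₁ (entry cmd))) (scanned x) stay (at-weak (m≤m+n B _) a) (m≤n+m _ B) refl (scanned-track a) (λ _ _ _ → refl) , r'
    ... | later y∈' with ∈-map⁻ (λ i → guess , put CERT (just (dec finΓ i)) (scanned x) , right) y∈'
    ... | g , _ , refl = guess-inv (guessed (dec finΓ g) i c (at-weak (m≤m+n B _) a) (m≤n+m _ B)) r' e

    guess-reach : ∀ {B i x} → ∀ c → At B guess 0 (s₀ i []) x → suc (suc (length c)) ≤ B →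
      Σ Conf λ y → Reach ntm (length c) x y × At B guess (length c) (s₀ i c) y
    guess-reach {x = x} [] a lB = x , here , a
    guess-reach {i = i} {x₀} (γ ∷ c) a lB =
      let (y , r , a') = guess-reach c a (≤-trans (n≤1+n _) lB)
          x = guess , put CERT (just γ) (scanned y) , right
          x∈ : x ∈ δᴺ (ctl y) (scanned y)
          x∈ = subst (λ q → x ∈ δᴺ q (scanned y)) (sym (ctl≡ a'))
                 (later (subst (λ g → (guess , put CERT (just g) (scanned y) , right) ∈ guesses (scanned y)) (dec-enc finΓ γ)
                   (∈-map⁺ _ (∈-allFin (enc finΓ γ)))))
      in apply y x , subst (λ n → Reach ntm n x₀ (apply y x)) (+-comm (length c) 1) (reach-trans r (step-to x∈ here)) ,
         guessed γ i c a' (≤-trans (n≤1+n _) lB)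

    runs-from : ∀ w c B₀ {t s' b B x} → Exec storage (λ _ → ⊤) t cmd (s₀ (input w) c) s' → get res s' ≡ verdict b →
      At B (back (inj₁ (entry cmd))) (length c) (s₀ (input w) c) x → B ≤ 2 + B₀ → length w + length c + suc t ≤ B₀ →
      Σ ℕ λ n → Σ Conf λ c' → n ≤ runTime B₀ t (length c) × Trace (2 + B₀) n x c' × state c' ≡ enc finCtl (done b)
    runs-from w c B₀ {t} e r a le lB =
      let m = length w + length c
          (e' , _) = exec-bounded storage e (heights-init w c m (m≤m+n _ _) (m≤n+m _ _)) (≤-trans (+-monoʳ-≤ m (n≤1+n t)) lB)
      in runs B₀ e' r (≤-trans (≤-trans (s≤s z≤n) (m≤n+m (suc t) m)) lB)
           (≤-trans (≤-trans (m≤n+m (length c) (length w)) (m≤m+n _ _)) lB) (at-weak le a)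

  -- Soundness concerns every certificate, however long, and asks only that the program terminates
  -- with a truthful verdict. The polynomial bounds are required of one good certificate for each
  -- member of `L`.
  inNP : (L : Language k) (C T : ℕ → ℕ) → Poly C → Poly T →
    (∀ w c → Σ ℕ λ t → Σ Store λ s' → Σ Bool λ b →
      Exec storage (λ _ → ⊤) t cmd (s₀ (input w) c) s' × get res s' ≡ verdict b × (b ≡ true → L w)) →
    (∀ w → L w → Σ (List Γ) λ c → Σ Store λ s' → length c ≤ C (length w) ×
      Exec storage (λ _ → ⊤) (T (length w)) cmd (s₀ (input w) c) s' × get res s' ≡ verdict true) →
    InNP L
  inNP L C T pC pT sound complete = ntm , proj₁ pN , proj₁ (proj₂ pN) , λ w → mk⇔ (to w) (from w)
    where
    B₀ N : ℕ → ℕ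
    B₀ n = n + C n + suc (T n)
    -- One step to mark, `C n` to guess, one to end the guessing, and then `runTime` with the head
    -- at height `C n`. `B₀` is the initial height plus the time.
    N n = suc (C n + suc (suc (C n) + (suc (T n) * suc (suc (B₀ n + B₀ n)) + 1)))
    pB₀ : Poly B₀
    pB₀ = poly-+ (poly-+ poly-id pC) (poly-suc pT)
    pN : Poly N
    pN = poly-suc (poly-+ pC (poly-suc (poly-+ (poly-suc pC)
      (poly-+ (poly-* (poly-suc pT) (poly-suc (poly-suc (poly-+ pB₀ pB₀)))) (poly-const 1)))))
    Accepts : List (Fin k) → Set
    Accepts w = Σ ℕ λ m → Σ Conf λ c' → m ≤ poly (proj₁ pN) (proj₁ (proj₂ pN)) (length w) × Reach ntm m (ninit ntm w) c' ×
        state c' ≡ enc finCtl (done true)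
    accepts : ∀ w → (Σ (List Γ) λ c → Σ Store λ s' → length c ≤ C (length w) ×
      Exec storage (λ _ → ⊤) (T (length w)) cmd (s₀ (input w) c) s' × get res s' ≡ verdict true) → Accepts w
    accepts w (c , s' , cC , e , r) = final
      where
      n = length w
      lB : suc (suc (length w)) ≤ 2 + (length w + length c + suc (T n))
      lB = s≤s (s≤s (≤-trans (m≤m+n _ (length c)) (m≤m+n _ _)))
      lc : suc (suc (length c)) ≤ 2 + (length w + length c + suc (T n))
      lc = s≤s (s≤s (≤-trans (m≤n+m (length c) (length w)) (m≤m+n _ _)))
      x : Action
      x = guess , (true , proj₂ (scanned (init w))) , stay
      x∈ : x ∈ δᴺ (ctl (init w)) (scanned (init w))
      x∈ = subst (λ q → x ∈ δᴺ q (scanned (init w))) (sym (ctl-init w)) (first refl)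
      final : Accepts w
      final =
        let (y , r₁ , a₁) = guess-reach c (marked guess w lB) lc
            z = back (inj₁ (entry cmd)) , scanned y , stay
            z∈ : z ∈ δᴺ (ctl y) (scanned y)
            z∈ = subst (λ q → z ∈ δᴺ q (scanned y)) (sym (ctl≡ a₁)) (first refl)
            a₂ = one (back (inj₁ (entry cmd))) (scanned y) stay a₁ lc refl (scanned-track a₁) (λ _ _ _ → refl)
            (m , c' , le , tr , d) = runs-from w c (n + length c + suc (T n)) e r a₂ ≤-refl ≤-refl
        in suc (length c + suc m) , c' ,
           ≤-trans (s≤s (+-mono-≤ cC (s≤s (≤-trans le (mono (+-mono-≤ (+-monoʳ-≤ n cC) ≤-refl)))))) (proj₂ (proj₂ pN) n) ,
           step-to x∈ (reach-trans r₁ (step-to z∈ (reach-trace tr))) , d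
        where
        mono : ∀ {b} → b ≤ B₀ n → runTime b (T n) (length c) ≤ runTime (B₀ n) (T n) (C n)
        mono le = +-mono-≤ (s≤s cC) (+-monoˡ-≤ 1 (*-monoʳ-≤ (suc (T n)) (s≤s (s≤s (+-mono-≤ le le)))))
    to : ∀ w → L w → Accepts w
    to w l = accepts w (complete w l)
    sound' : ∀ w c {B y n x} → At B (back (inj₁ (entry cmd))) (length c) (s₀ (input w) c) y → Reach ntm n y x →
      state x ≡ enc finCtl (done true) → L w
    sound' w c {B} a r e =
      let (t , s' , b , ex , rs , Lw) = sound w c
          (_ , c'' , _ , tr , d) = runs-from w c (B + (length w + length c + suc t)) ex rs a (≤-trans (m≤m+n B _) (m≤n+m _ 2)) (m≤n+m _ B)
      in Lw (done-injective (enc-injective finCtl {done b} {done true} (trans (sym d) (trace-reach tr (b , d) r e))))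
    after-mark : ∀ w {m c'} → (Σ Action λ x → x ∈ δᴺ (ctl (init w)) (scanned (init w)) × Reach ntm m (apply (init w) x) c') →
      state c' ≡ enc finCtl (done true) → L w
    after-mark w {m} {c'} (x , x∈ , r) e = go (subst (λ q → x ∈ δᴺ q (scanned (init w))) (ctl-init w) x∈) r
      where
      go : ∀ {x} → x ∈ δᴺ mark (scanned (init w)) → Reach ntm m (apply (init w) x) c' → L w
      go (first refl) r =
        let (c , _ , _ , _ , a , r') = guess-inv {c = []} (marked guess w ≤-refl) r e in sound' w c a r' e
    from : ∀ w → Accepts w → L w
    from w (zero , c' , _ , here , e) =
      ⊥-elim (mark≢done (trans (sym (ctl-init w)) (trans (cong (dec finCtl) e) (dec-enc finCtl (done true)))))
      where
      mark≢done : mark ≢ done true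
      mark≢done ()
    from w (suc m , c' , _ , r@(step _ _) , e) = after-mark w (step-from r) e

-- Programs running in polynomial time

data Ord : Set where
  less equal greater : Ord

compareℕ : ℕ → ℕ → Ord
compareℕ zero    zero    = equal
compareℕ zero    (suc n) = less
compareℕ (suc m) zero    = greater
compareℕ (suc m) (suc n) = compareℕ m n

sumFin : ∀ n → (Fin n → ℕ) → ℕ
sumFin zero    f = 0
sumFin (suc n) f = f zero + sumFin n (f ∘ suc)

sumFin-≥ : ∀ n f i → f i ≤ sumFin n f
sumFin-≥ (suc n) f zero    = m≤m+n _ _
sumFin-≥ (suc n) f (suc i) = ≤-trans (sumFin-≥ n (f ∘ suc) i) (m≤n+m _ _)

poly-sumFin : ∀ n {f : Fin n → ℕ → ℕ} → (∀ i → Poly (f i)) → Poly (λ m → sumFin n (λ i → f i m))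
poly-sumFin zero    p = poly-const 0
poly-sumFin (suc n) p = poly-+ (p zero) (poly-sumFin n (p ∘ suc))

module _ {Γ : Set} (finΓ : Finite Γ) where
  sumΓ : (Γ → ℕ) → ℕ
  sumΓ f = sumFin (card finΓ) (f ∘ dec finΓ)

  sumΓ-≥ : ∀ f a → f a ≤ sumΓ f
  sumΓ-≥ f a = subst (λ b → f b ≤ sumΓ f) (dec-enc finΓ a) (sumFin-≥ _ (f ∘ dec finΓ) (enc finΓ a))

-- Loops range over the read-only input only, so the running time is bounded syntactically.
data Prog (Γ : Set) (C W : ℕ) : ℕ → Set where
  idle : ∀ {d} → Prog Γ C W d
  _»_  : ∀ {d} → Prog Γ C W d → Prog Γ C W d → Prog Γ C W d
  inc  : ∀ {d} → Fin C → Prog Γ C W d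
  clr  : ∀ {d} → Fin C → Prog Γ C W d
  copy : ∀ {d} (c c' : Fin C) {_ : False (c F.≟ c')} → Prog Γ C W d
  cmp  : ∀ {d} (c c' : Fin C) {_ : False (c F.≟ c')} → (Ord → Prog Γ C W d) → Prog Γ C W d
  emit : ∀ {d} → Fin W → Γ → Prog Γ C W d
  pull : ∀ {d} → Fin W → (Maybe Γ → Prog Γ C W d) → Prog Γ C W d
  for  : ∀ {d} → (Γ → Prog Γ C W d) → Prog Γ C W (suc d)
infixr 5 _»_

module _ {Γ : Set} {C W : ℕ} where

  State : Set
  State = Vec ℕ C × Vec (List Γ) W

  pulled : ∀ {A : Set} → List Γ → A → (Γ → List Γ → A) → A
  pulled []      n j = n
  pulled (a ∷ l) n j = j a l

  sem : ∀ {d} → Prog Γ C W d → List Γ → State → State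
  sem idle x s = s
  sem (p » q) x s = sem q x (sem p x s)
  sem (inc c) x (v , w) = v [ c ]≔ suc (lookup v c) , w
  sem (clr c) x (v , w) = v [ c ]≔ 0 , w
  sem (copy c c') x (v , w) = v [ c ]≔ lookup v c' , w
  sem (cmp c c' f) x (v , w) = sem (f (compareℕ (lookup v c) (lookup v c'))) x (v , w)
  sem (emit j a) x (v , w) = v , w [ j ]≔ (a ∷ lookup w j)
  sem (pull j f) x (v , w) = pulled (lookup w j) (sem (f nothing) x (v , w)) (λ a l → sem (f (just a)) x (v , w [ j ]≔ l))
  sem (for f) x s = foldl (λ s a → sem (f a) x s) s x

  module _ (finΓ : Finite Γ) where
    -- Counters are kept in unary, so the time to clear, copy or compare them depends on their
    -- values. Only `inc` exceeds the largest value so far, hence the number of increments bounds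
    -- all counters. Alternative branches are added up in place of a maximum.
    incs : ∀ {d} → Prog Γ C W d → ℕ → ℕ
    incs idle n = 0
    incs (p » q) n = incs p n + incs q n
    incs (inc c) n = 1
    incs (clr c) n = 0
    incs (copy c c') n = 0
    incs (cmp c c' f) n = incs (f less) n + (incs (f equal) n + incs (f greater) n)
    incs (emit j a) n = 0
    incs (pull j f) n = incs (f nothing) n + sumΓ finΓ (λ a → incs (f (just a)) n)
    incs (for f) n = n * sumΓ finΓ (λ a → incs (f a) n)

    -- One generous bound for clearing, copying and comparing counters with values up to `M`.
    primTime : ℕ → ℕ
    primTime M = 20 * suc M

    time : ∀ {d} → Prog Γ C W d → ℕ → ℕ → ℕ
    time idle n M = 1
    time (p » q) n M = time p n M + time q n M
    time (inc c) n M = 1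
    time (clr c) n M = primTime M
    time (copy c c') n M = primTime M
    time (cmp c c' f) n M = primTime M + (time (f less) n M + (time (f equal) n M + time (f greater) n M))
    time (emit j a) n M = 1
    time (pull j f) n M = suc (time (f nothing) n M + sumΓ finΓ (λ a → time (f (just a)) n M))
    -- The second summand is for rebuilding the copy of the input that the loop has consumed.
    time (for f) n M = suc (n * suc (suc (sumΓ finΓ (λ a → time (f a) n M)))) + suc (n * 2)

    poly-incs : ∀ {d} (p : Prog Γ C W d) → Poly (incs p)
    poly-incs idle = poly-const 0
    poly-incs (p » q) = poly-+ (poly-incs p) (poly-incs q)
    poly-incs (inc c) = poly-const 1
    poly-incs (clr c) = poly-const 0
    poly-incs (copy c c') = poly-const 0
    poly-incs (cmp c c' f) = poly-+ (poly-incs (f less)) (poly-+ (poly-incs (f equal)) (poly-incs (f greater)))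
    poly-incs (emit j a) = poly-const 0
    poly-incs (pull j f) = poly-+ (poly-incs (f nothing)) (poly-sumFin _ λ i → poly-incs (f (just (dec finΓ i))))
    poly-incs (for f) = poly-* poly-id (poly-sumFin _ λ i → poly-incs (f (dec finΓ i)))

    poly-time : ∀ {d} (p : Prog Γ C W d) {M} → Poly M → Poly (λ n → time p n (M n))
    poly-time idle m = poly-const 1
    poly-time (p » q) m = poly-+ (poly-time p m) (poly-time q m)
    poly-time (inc c) m = poly-const 1
    poly-time (clr c) m = poly-* (poly-const 20) (poly-suc m)
    poly-time (copy c c') m = poly-* (poly-const 20) (poly-suc m)
    poly-time (cmp c c' f) m = poly-+ (poly-* (poly-const 20) (poly-suc m))
      (poly-+ (poly-time (f less) m) (poly-+ (poly-time (f equal) m) (poly-time (f greater) m)))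
    poly-time (emit j a) m = poly-const 1
    poly-time (pull j f) m = poly-suc (poly-+ (poly-time (f nothing) m) (poly-sumFin _ λ i → poly-time (f (just (dec finΓ i))) m))
    poly-time (for f) m = poly-+ (poly-suc (poly-* poly-id (poly-suc (poly-suc (poly-sumFin _ λ i → poly-time (f (dec finΓ i)) m)))))
      (poly-suc (poly-* poly-id (poly-const 2)))

-- The stacks reg i hold the numbers of a vector in unary.
module Registers {Γ : Set} (St : Storage Γ) (one : Γ) {n : ℕ} (reg : Fin n → Storage.Name St) (st : Vec ℕ n → Storage.Store St)
  (get-reg : ∀ i v → Storage.get St (reg i) (st v) ≡ replicate (lookup v i) one)
  (set-reg : ∀ i v m → Storage.set St (reg i) (replicate m one) (st v) ≡ st (v [ i ]≔ m)) where
  open Storage St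

  E : ℕ → Cmd Name Γ → Store → Store → Set
  E = Exec St (λ _ → ⊤)

  rpush : ∀ i {v} → E 1 (push (reg i) one) (st v) (st (v [ i ]≔ suc (lookup v i)))
  rpush i {v} = subst (E 1 (push (reg i) one) (st v))
    (trans (cong (λ l → set (reg i) (one ∷ l) (st v)) (get-reg i v)) (set-reg i v (suc (lookup v i)))) (epush tt)

  rpop0 : ∀ i {v t f s'} → lookup v i ≡ 0 → E t (f nothing) (st v) s' → E (suc t) (pop (reg i) f) (st v) s'
  rpop0 i {v} e = epop[] (trans (get-reg i v) (cong (λ m → replicate m one) e))

  rpop : ∀ i {v t m f s'} → lookup v i ≡ suc m → E t (f (just one)) (st (v [ i ]≔ m)) s' → E (suc t) (pop (reg i) f) (st v) s'
  rpop i {v} {t} {m} {f} {s'} e d = epop∷ (trans (get-reg i v) (cong (λ m → replicate m one) e)) tt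
    (subst (λ s → E t (f (just one)) s s') (sym (set-reg i v m)) d)

  rloop0 : ∀ i {v f} → lookup v i ≡ 0 → E 1 (loop (reg i) f) (st v) (st v)
  rloop0 i {v} e = eloop[] (trans (get-reg i v) (cong (λ m → replicate m one) e))

  rloop : ∀ i {v t t' m f s' s''} → lookup v i ≡ suc m → E t (f one) (st (v [ i ]≔ m)) s' → E t' (loop (reg i) f) s' s'' →
    E (suc (t + t')) (loop (reg i) f) (st v) s''
  rloop i {v} {t} {m = m} {f} {s'} e d = eloop∷ (trans (get-reg i v) (cong (λ m → replicate m one) e)) tt
    (subst (λ s → E t (f one) s s') (sym (set-reg i v m)) d)

-- Registers 0 and 1 are the operands, the others are scratch space.
module RegisterOps {Γ : Set} (St : Storage Γ) (one : Γ) (reg : Fin 5 → Storage.Name St) (st : Vec ℕ 5 → Storage.Store St)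
  (get-reg : ∀ i v → Storage.get St (reg i) (st v) ≡ replicate (lookup v i) one)
  (set-reg : ∀ i v m → Storage.set St (reg i) (replicate m one) (st v) ≡ st (v [ i ]≔ m)) where
  open Storage St
  open Registers St one reg st get-reg set-reg

  r0 r1 r2 r3 r4 : Fin 5
  r0 = zero
  r1 = suc zero
  r2 = suc (suc zero)
  r3 = suc (suc (suc zero))
  r4 = suc (suc (suc (suc zero)))

  regs : ℕ → ℕ → ℕ → ℕ → ℕ → Store
  regs a b c d e = st (a ∷ b ∷ c ∷ d ∷ e ∷ [])

  clrCmd copyCmd refill : Cmd Name Γ
  clrCmd = loop (reg r0) (λ _ → skip)
  copyCmd = loop (reg r1) (λ _ → push (reg r2) one) ⨾ clrCmd ⨾ loop (reg r2) (λ _ → push (reg r0) one ⨾ push (reg r1) one)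
  refill = loop (reg r2) (λ _ → push (reg r0) one) ⨾ loop (reg r3) (λ _ → push (reg r1) one)

  -- Register 2 records all units of register 0, register 3 those matched by a unit of register 1
  -- and register 4 those left unmatched. What remains in registers 1 and 4 decides the comparison,
  -- and `refill` restores both operands before the branch is entered.
  cmpCmd : (Ord → Cmd Name Γ) → Cmd Name Γ
  cmpCmd f =
    loop (reg r0) (λ _ → push (reg r2) one ⨾ pop (reg r1) (maybe (λ _ → push (reg r3) one) (push (reg r4) one))) ⨾
    pop (reg r1) (maybe (λ _ → push (reg r1) one ⨾ refill ⨾ f less)
      (pop (reg r4) (maybe (λ _ → loop (reg r4) (λ _ → skip) ⨾ refill ⨾ f greater) (refill ⨾ f equal))))

  exec-clr : ∀ a b c d e → E (suc (a * 2)) clrCmd (regs a b c d e) (regs 0 b c d e)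
  exec-clr zero b c d e = rloop0 r0 refl
  exec-clr (suc a) b c d e = rloop r0 refl eskip (exec-clr a b c d e)

  exec-clr4 : ∀ e a b c d → E (suc (e * 2)) (loop (reg r4) (λ _ → skip)) (regs a b c d e) (regs a b c d 0)
  exec-clr4 zero a b c d = rloop0 r4 refl
  exec-clr4 (suc e) a b c d = rloop r4 refl eskip (exec-clr4 e a b c d)

  exec-copy : ∀ a b → E (suc (b * 2) + (suc (a * 2) + suc (b * 3))) copyCmd (regs a b 0 0 0) (regs b b 0 0 0)
  exec-copy a b = eseq (out b 0) (eseq (exec-clr a 0 (b + 0) 0 0)
    (subst₂ (λ p q → E (suc (b * 3)) backLoop (regs 0 0 p 0 0) (regs q q 0 0 0)) (sym (+-identityʳ b)) (+-identityʳ b) (back b 0 0)))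
    where
    outLoop backLoop : Cmd Name Γ
    outLoop = loop (reg r1) (λ _ → push (reg r2) one)
    backLoop = loop (reg r2) (λ _ → push (reg r0) one ⨾ push (reg r1) one)
    out : ∀ b c → E (suc (b * 2)) outLoop (regs a b c 0 0) (regs a 0 (b + c) 0 0)
    out zero c = rloop0 r1 refl
    out (suc b) c = rloop r1 refl (rpush r2) (subst (λ n → E (suc (b * 2)) outLoop (regs a b (suc c) 0 0) (regs a 0 n 0 0)) (+-suc b c) (out b (suc c)))
    back : ∀ n a b → E (suc (n * 3)) backLoop (regs a b n 0 0) (regs (n + a) (n + b) 0 0 0)
    back zero a b = rloop0 r2 refl
    back (suc n) a b = rloop r2 refl (eseq (rpush r0) (rpush r1))
      (subst₂ (λ p q → E (suc (n * 3)) backLoop (regs (suc a) (suc b) n 0 0) (regs p q 0 0 0)) (+-suc n a) (+-suc n b) (back n (suc a) (suc b)))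

  exec-refill : ∀ a b c d e → E (suc (c * 2) + suc (d * 2)) refill (regs a b c d e) (regs (c + a) (d + b) 0 0 e)
  exec-refill a b c d e = eseq (one' c a) (two d b)
    where
    loop₀ loop₁ : Cmd Name Γ
    loop₀ = loop (reg r2) (λ _ → push (reg r0) one)
    loop₁ = loop (reg r3) (λ _ → push (reg r1) one)
    one' : ∀ c a → E (suc (c * 2)) loop₀ (regs a b c d e) (regs (c + a) b 0 d e)
    one' zero a = rloop0 r2 refl
    one' (suc c) a = rloop r2 refl (rpush r0) (subst (λ n → E (suc (c * 2)) loop₀ (regs (suc a) b c d e) (regs n b 0 d e)) (+-suc c a) (one' c (suc a)))
    two : ∀ d b → E (suc (d * 2)) loop₁ (regs (c + a) b 0 d e) (regs (c + a) (d + b) 0 0 e)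
    two zero b = rloop0 r3 refl
    two (suc d) b = rloop r3 refl (rpush r1) (subst (λ n → E (suc (d * 2)) loop₁ (regs (c + a) (suc b) 0 d e) (regs (c + a) n 0 0 e)) (+-suc d b) (two d (suc b)))

  private
    mainLoop : Cmd Name Γ
    mainLoop = loop (reg r0) (λ _ → push (reg r2) one ⨾ pop (reg r1) (maybe (λ _ → push (reg r3) one) (push (reg r4) one)))

    both : ∀ n {a b c d e t s'} → E t mainLoop (regs a b (n + c) (n + d) e) s' → E (n * 4 + t) mainLoop (regs (n + a) (n + b) c d e) s'
    both zero x = x
    both (suc n) {a} {b} {c} {d} {e} {t} {s'} x = rloop r0 refl (eseq (rpush r2) (rpop r1 refl (rpush r3)))
      (both n (subst₂ (λ p q → E t mainLoop (regs a b p q e) s') (sym (+-suc n c)) (sym (+-suc n d)) x))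

    drain : ∀ k c d e → E (suc (k * 4)) mainLoop (regs k 0 c d e) (regs 0 0 (k + c) d (k + e))
    drain zero c d e = rloop0 r0 refl
    drain (suc k) c d e = rloop r0 refl (eseq (rpush r2) (rpop0 r1 refl (rpush r4)))
      (subst₂ (λ p q → E (suc (k * 4)) mainLoop (regs k 0 (suc c) d (suc e)) (regs 0 0 p d q)) (+-suc k c) (+-suc k e) (drain k (suc c) d (suc e)))

  -- Exposes the difference of the operands, which is the number of rounds of the comparison left
  -- after one operand is exhausted.
  data Compared : ℕ → ℕ → Ord → Set where
    is-less : ∀ a k → Compared a (a + suc k) less
    is-equal : ∀ a → Compared a a equal
    is-greater : ∀ b k → Compared (b + suc k) b greater

  compared : ∀ a b → Compared a b (compareℕ a b)
  compared zero zero = is-equal 0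
  compared zero (suc b) = is-less 0 b
  compared (suc a) zero = is-greater 0 a
  compared (suc a) (suc b) with compareℕ a b | compared a b
  ... | _ | is-less a k = is-less (suc a) k
  ... | _ | is-equal a = is-equal (suc a)
  ... | _ | is-greater b k = is-greater (suc b) k

  cmpTime : ℕ → ℕ
  cmpTime M = 20 * suc M

  exec-cmp : ∀ f a b M {t s'} → a ≤ M → b ≤ M → E t (f (compareℕ a b)) (regs a b 0 0 0) s' →
    E (cmpTime M + t) (cmpCmd f) (regs a b 0 0 0) s'
  exec-cmp f a b M {t} {s'} aM bM e with compareℕ a b | compared a b
  ... | _ | is-less a k = weak (bound a M t aM)
      (eseq (subst (λ p → E (a * 4 + 1) mainLoop (regs p (a + suc k) 0 0 0) (regs 0 (suc k) a a 0)) (+-identityʳ a)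
          (both a (subst (λ p → E 1 mainLoop (regs 0 (suc k) p p 0) (regs 0 (suc k) a a 0)) (sym (+-identityʳ a)) (rloop0 r0 refl))))
        (rpop r1 refl (eseq (rpush r1) (eseq (exec-refill 0 (suc k) a a 0)
          (subst (λ p → E t (f less) (regs p (a + suc k) 0 0 0) s') (sym (+-identityʳ a)) e)))))
    where
    bound : ∀ a M t → a ≤ M → (a * 4 + 1) + suc (1 + ((suc (a * 2) + suc (a * 2)) + t)) ≤ cmpTime M + t
    bound a M t le = ≤-trans (≤-reflexive (equal₁ a t)) (+-monoˡ-≤ t (≤-trans (m≤m+n _ (12 * a + 15)) (≤-trans (≤-reflexive (equal₂ a)) (*-monoʳ-≤ 20 (s≤s le)))))
      where
      equal₁ : ∀ a t → (a * 4 + 1) + suc (1 + ((suc (a * 2) + suc (a * 2)) + t)) ≡ (8 * a + 5) + t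
      equal₁ = solve-∀
      equal₂ : ∀ a → (8 * a + 5) + (12 * a + 15) ≡ 20 * suc a
      equal₂ = solve-∀
  ... | _ | is-equal a = weak (bound a M t aM)
      (eseq (subst (λ p → E (a * 4 + 1) mainLoop (regs p p 0 0 0) (regs 0 0 a a 0)) (+-identityʳ a)
          (both a (subst (λ p → E 1 mainLoop (regs 0 0 p p 0) (regs 0 0 a a 0)) (sym (+-identityʳ a)) (rloop0 r0 refl))))
        (rpop0 r1 refl (rpop0 r4 refl (eseq (exec-refill 0 0 a a 0)
          (subst (λ p → E t (f equal) (regs p p 0 0 0) s') (sym (+-identityʳ a)) e)))))
    where
    bound : ∀ a M t → a ≤ M → (a * 4 + 1) + suc (suc ((suc (a * 2) + suc (a * 2)) + t)) ≤ cmpTime M + t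
    bound a M t le = ≤-trans (≤-reflexive (equal₁ a t)) (+-monoˡ-≤ t (≤-trans (m≤m+n _ (12 * a + 15)) (≤-trans (≤-reflexive (equal₂ a)) (*-monoʳ-≤ 20 (s≤s le)))))
      where
      equal₁ : ∀ a t → (a * 4 + 1) + suc (suc ((suc (a * 2) + suc (a * 2)) + t)) ≡ (8 * a + 5) + t
      equal₁ = solve-∀
      equal₂ : ∀ a → (8 * a + 5) + (12 * a + 15) ≡ 20 * suc a
      equal₂ = solve-∀
  ... | _ | is-greater b k = weak (bound b k M t aM)
      (eseq (subst (λ p → E (b * 4 + suc (suc k * 4)) mainLoop (regs (b + suc k) p 0 0 0) (regs 0 0 (b + suc k) b (suc k))) (+-identityʳ b)
          (both b (subst₂ (λ p q → E (suc (suc k * 4)) mainLoop (regs (suc k) 0 p p 0) (regs 0 0 q b (suc k))) (sym (+-identityʳ b)) (+-comm (suc k) b)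
            (subst (λ p → E (suc (suc k * 4)) mainLoop (regs (suc k) 0 b b 0) (regs 0 0 (suc k + b) b p)) (+-identityʳ (suc k)) (drain (suc k) b b 0)))))
        (rpop0 r1 refl (rpop r4 refl (eseq (exec-clr4 k 0 0 (b + suc k) b) (eseq (exec-refill 0 0 (b + suc k) b 0)
          (subst₂ (λ p q → E t (f greater) (regs p q 0 0 0) s') (sym (+-identityʳ (b + suc k))) (sym (+-identityʳ b)) e))))))
    where
    bound : ∀ b k M t → b + suc k ≤ M → (b * 4 + suc (suc k * 4)) + suc (suc (suc (k * 2) + ((suc ((b + suc k) * 2) + suc (b * 2)) + t))) ≤ cmpTime M + t
    bound b k M t le = ≤-trans (≤-reflexive (equal₁ b k t)) (+-monoˡ-≤ t (≤-trans (m≤m+n _ (12 * b + 12 * k + 28)) (≤-trans (≤-reflexive (equal₂ b k)) (*-monoʳ-≤ 20 (s≤s le)))))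
      where
      equal₁ : ∀ b k t → (b * 4 + suc (suc k * 4)) + suc (suc (suc (k * 2) + ((suc ((b + suc k) * 2) + suc (b * 2)) + t))) ≡ (8 * b + 8 * k + 12) + t
      equal₁ = solve-∀
      equal₂ : ∀ b k → (8 * b + 8 * k + 12) + (12 * b + 12 * k + 28) ≡ 20 * suc (b + suc k)
      equal₂ = solve-∀

ord-≤ : (g : Ord → ℕ) → ∀ o → g o ≤ g less + (g equal + g greater)
ord-≤ g less = m≤m+n (g less) _
ord-≤ g equal = ≤-trans (m≤m+n (g equal) (g greater)) (m≤n+m _ (g less))
ord-≤ g greater = ≤-trans (m≤n+m (g greater) (g equal)) (m≤n+m _ (g less))

record Counters {C : ℕ} (m : ℕ) (v : Vec ℕ C) : Set where
  constructor counters
  field bounded : ∀ i → lookup v i ≤ m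
open Counters

module _ {Γ : Set} {C W : ℕ} (finΓ : Finite Γ) where

  counters-≤ : ∀ {m n} {v : Vec ℕ C} → m ≤ n → Counters m v → Counters n v
  counters-≤ le (counters h) = counters λ i → ≤-trans (h i) le

  counters-set : ∀ {m} {v : Vec ℕ C} c k → k ≤ m → Counters m v → Counters m (v [ c ]≔ k)
  counters-set {m} {v} c k le (counters h) = counters λ i → go i (i F.≟ c)
    where
    go : ∀ i → Dec (i ≡ c) → lookup (v [ c ]≔ k) i ≤ m
    go i (yes refl) = subst (_≤ m) (sym (V.lookup∘update i v k)) le
    go i (no ne) = subst (_≤ m) (sym (V.lookup∘update′ ne v k)) (h i)

  sem-counters : ∀ {d} (p : Prog Γ C W d) x s {m} → Counters m (proj₁ s) →
    Counters (m + incs finΓ p (length x)) (proj₁ (sem p x s))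
  sem-counters idle x s h = counters-≤ (m≤m+n _ 0) h
  sem-counters (p » q) x s {m} h =
    counters-≤ (≤-reflexive (+-assoc m _ _)) (sem-counters q x (sem p x s) (sem-counters p x s h))
  sem-counters (inc c) x s {m} h =
    counters-set c _ (≤-trans (s≤s (bounded h c)) (≤-reflexive (+-comm 1 m))) (counters-≤ (m≤m+n m 1) h)
  sem-counters (clr c) x s h = counters-set c 0 z≤n (counters-≤ (m≤m+n _ 0) h)
  sem-counters (copy c c') x s h = counters-≤ (m≤m+n _ 0) (counters-set c _ (bounded h c') h)
  sem-counters (cmp c c' f) x s@(v , _) {m} h = counters-≤
    (+-monoʳ-≤ m (ord-≤ (λ o → incs finΓ (f o) (length x)) (compareℕ (lookup v c) (lookup v c'))))
    (sem-counters (f (compareℕ (lookup v c) (lookup v c'))) x s h)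
  sem-counters (emit j a) x s h = counters-≤ (m≤m+n _ 0) h
  sem-counters (pull j f) x (v , w) {m} h with lookup w j
  ... | [] = counters-≤ (+-monoʳ-≤ m (m≤m+n _ _)) (sem-counters (f nothing) x (v , w) h)
  ... | a ∷ l = counters-≤ (+-monoʳ-≤ m (≤-trans (sumΓ-≥ finΓ (λ a → incs finΓ (f (just a)) (length x)) a) (m≤n+m _ _)))
    (sem-counters (f (just a)) x (v , w [ j ]≔ l) h)
  sem-counters (for {d} f) x s {m} h = go x s h
    where
    I : ℕ
    I = sumΓ finΓ (λ a → incs finΓ (f a) (length x))
    go : ∀ y s {m} → Counters m (proj₁ s) → Counters (m + length y * I) (proj₁ (foldl (λ s a → sem (f a) x s) s y))
    go [] s h = counters-≤ (m≤m+n _ 0) h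
    go (a ∷ y) s {m} h = counters-≤ (≤-reflexive (+-assoc m I _)) (go y (sem (f a) x s)
      (counters-≤ (+-monoʳ-≤ m (sumΓ-≥ finΓ (λ a → incs finΓ (f a) (length x)) a)) (sem-counters (f a) x s h)))

-- Each loop level l keeps a copy of the input on X l; during the loop the part already read is on Y l.
module Compile {Γ : Set} (finΓ : Finite Γ) (one : Γ) (D C W R : ℕ) where

  -- `ts` is scratch space for operations on counters. The stacks `ds` belong to the driver around a
  -- compiled program, which does not touch them.
  data Name : Set where
    xs ys : Fin D → Name
    cs    : Fin C → Name
    ws    : Fin W → Name
    ts    : Fin 3 → Name
    ds    : Fin R → Name

  record Store : Set where
    constructor store
    field
      X Y : Vec (List Γ) D
      c   : Vec (List Γ) C
      w   : Vec (List Γ) W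
      t   : Vec (List Γ) 3
      r   : Vec (List Γ) R

  get : Name → Store → List Γ
  get (xs i) s = lookup (Store.X s) i
  get (ys i) s = lookup (Store.Y s) i
  get (cs i) s = lookup (Store.c s) i
  get (ws i) s = lookup (Store.w s) i
  get (ts i) s = lookup (Store.t s) i
  get (ds i) s = lookup (Store.r s) i

  set : Name → List Γ → Store → Store
  set (xs i) l (store X Y c w t r) = store (X [ i ]≔ l) Y c w t r
  set (ys i) l (store X Y c w t r) = store X (Y [ i ]≔ l) c w t r
  set (cs i) l (store X Y c w t r) = store X Y (c [ i ]≔ l) w t r
  set (ws i) l (store X Y c w t r) = store X Y c (w [ i ]≔ l) t r
  set (ts i) l (store X Y c w t r) = store X Y c w (t [ i ]≔ l) r
  set (ds i) l (store X Y c w t r) = store X Y c w t (r [ i ]≔ l)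

  get-set : ∀ j l s → get j (set j l s) ≡ l
  get-set (xs i) l s = V.lookup∘update i (Store.X s) l
  get-set (ys i) l s = V.lookup∘update i (Store.Y s) l
  get-set (cs i) l s = V.lookup∘update i (Store.c s) l
  get-set (ws i) l s = V.lookup∘update i (Store.w s) l
  get-set (ts i) l s = V.lookup∘update i (Store.t s) l
  get-set (ds i) l s = V.lookup∘update i (Store.r s) l

  get-set-≢ : ∀ {i j} l s → i ≢ j → get i (set j l s) ≡ get i s
  get-set-≢ {xs i} {xs j} l s ne = V.lookup∘update′ (ne ∘ cong xs) (Store.X s) l
  get-set-≢ {ys i} {ys j} l s ne = V.lookup∘update′ (ne ∘ cong ys) (Store.Y s) l
  get-set-≢ {cs i} {cs j} l s ne = V.lookup∘update′ (ne ∘ cong cs) (Store.c s) l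
  get-set-≢ {ws i} {ws j} l s ne = V.lookup∘update′ (ne ∘ cong ws) (Store.w s) l
  get-set-≢ {ts i} {ts j} l s ne = V.lookup∘update′ (ne ∘ cong ts) (Store.t s) l
  get-set-≢ {ds i} {ds j} l s ne = V.lookup∘update′ (ne ∘ cong ds) (Store.r s) l
  get-set-≢ {xs i} {ys j} l s ne = refl
  get-set-≢ {xs i} {cs j} l s ne = refl
  get-set-≢ {xs i} {ws j} l s ne = refl
  get-set-≢ {xs i} {ts j} l s ne = refl
  get-set-≢ {xs i} {ds j} l s ne = refl
  get-set-≢ {ys i} {xs j} l s ne = refl
  get-set-≢ {ys i} {cs j} l s ne = refl
  get-set-≢ {ys i} {ws j} l s ne = refl
  get-set-≢ {ys i} {ts j} l s ne = refl
  get-set-≢ {ys i} {ds j} l s ne = refl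
  get-set-≢ {cs i} {xs j} l s ne = refl
  get-set-≢ {cs i} {ys j} l s ne = refl
  get-set-≢ {cs i} {ws j} l s ne = refl
  get-set-≢ {cs i} {ts j} l s ne = refl
  get-set-≢ {cs i} {ds j} l s ne = refl
  get-set-≢ {ws i} {xs j} l s ne = refl
  get-set-≢ {ws i} {ys j} l s ne = refl
  get-set-≢ {ws i} {cs j} l s ne = refl
  get-set-≢ {ws i} {ts j} l s ne = refl
  get-set-≢ {ws i} {ds j} l s ne = refl
  get-set-≢ {ts i} {xs j} l s ne = refl
  get-set-≢ {ts i} {ys j} l s ne = refl
  get-set-≢ {ts i} {cs j} l s ne = refl
  get-set-≢ {ts i} {ws j} l s ne = refl
  get-set-≢ {ts i} {ds j} l s ne = refl
  get-set-≢ {ds i} {xs j} l s ne = refl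
  get-set-≢ {ds i} {ys j} l s ne = refl
  get-set-≢ {ds i} {cs j} l s ne = refl
  get-set-≢ {ds i} {ws j} l s ne = refl
  get-set-≢ {ds i} {ts j} l s ne = refl

  abstract
    finName : Finite Name
    finName = finRetract
      (fin⊎ (fin⊎ (finFin D) (finFin D)) (fin⊎ (fin⊎ (finFin C) (finFin W)) (fin⊎ (finFin 3) (finFin R))))
      (λ { (xs i) → inj₁ (inj₁ i) ; (ys i) → inj₁ (inj₂ i) ; (cs i) → inj₂ (inj₁ (inj₁ i))
         ; (ws i) → inj₂ (inj₁ (inj₂ i)) ; (ts i) → inj₂ (inj₂ (inj₁ i)) ; (ds i) → inj₂ (inj₂ (inj₂ i)) })
      (λ { (inj₁ (inj₁ i)) → xs i ; (inj₁ (inj₂ i)) → ys i ; (inj₂ (inj₁ (inj₁ i))) → cs i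
         ; (inj₂ (inj₁ (inj₂ i))) → ws i ; (inj₂ (inj₂ (inj₁ i))) → ts i ; (inj₂ (inj₂ (inj₂ i))) → ds i })
      (λ { (xs i) → refl ; (ys i) → refl ; (cs i) → refl ; (ws i) → refl ; (ts i) → refl ; (ds i) → refl })

  stacks : Storage Γ
  stacks = record
    { Name = Name ; Store = Store ; finName = finName ; get = get ; set = set
    ; get-set = get-set ; get-set-≢ = λ {i} {j} → get-set-≢ {i} {j} }

  un : ℕ → List Γ
  un n = replicate n one

  E : ℕ → Cmd Name Γ → Store → Store → Set
  E = Exec stacks (λ _ → ⊤)

  module _ (X Y : Vec (List Γ) D) (r : Vec (List Γ) R) where

    counted : Vec ℕ C → Vec (List Γ) W → Vec ℕ 3 → Store
    counted v w t = store X Y (V.map un v) w (V.map un t) r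

    set-counter : ∀ v w t i m → set (cs i) (un m) (counted v w t) ≡ counted (v [ i ]≔ m) w t
    set-counter v w t i m = cong (λ c → store X Y c w (V.map un t) r) (sym (V.map-[]≔ un v i))

    get-counter : ∀ v w t i → get (cs i) (counted v w t) ≡ un (lookup v i)
    get-counter v w t i = V.lookup-map i un v

    -- Two counters and the three scratch stacks become the five registers of `RegisterOps`. That
    -- the counters are distinct makes the two updates commute.
    module Pair (v : Vec ℕ C) (w : Vec (List Γ) W) (c c' : Fin C) (ne : c ≢ c') where

      reg : Fin 5 → Name
      reg zero = cs c
      reg (suc zero) = cs c'
      reg (suc (suc i)) = ts i

      st : Vec ℕ 5 → Store
      st (a ∷ b ∷ t) = counted (v [ c ]≔ a [ c' ]≔ b) w t

      get-reg : ∀ i u → get (reg i) (st u) ≡ un (lookup u i)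
      get-reg zero (a ∷ b ∷ t) = trans (get-counter (v [ c ]≔ a [ c' ]≔ b) w t c)
        (cong un (trans (V.lookup∘update′ ne (v [ c ]≔ a) b) (V.lookup∘update c v a)))
      get-reg (suc zero) (a ∷ b ∷ t) = trans (get-counter (v [ c ]≔ a [ c' ]≔ b) w t c') (cong un (V.lookup∘update c' (v [ c ]≔ a) b))
      get-reg (suc (suc i)) (a ∷ b ∷ t) = V.lookup-map i un t

      set-reg : ∀ i u m → set (reg i) (un m) (st u) ≡ st (u [ i ]≔ m)
      set-reg zero (a ∷ b ∷ t) m = trans (set-counter (v [ c ]≔ a [ c' ]≔ b) w t c m) (cong (λ v → counted v w t)
        (trans (V.[]≔-commutes (v [ c ]≔ a) c' c (ne ∘ sym)) (cong (_[ c' ]≔ b) (V.[]≔-idempotent v c))))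
      set-reg (suc zero) (a ∷ b ∷ t) m = trans (set-counter (v [ c ]≔ a [ c' ]≔ b) w t c' m) (cong (λ v → counted v w t)
        (V.[]≔-idempotent (v [ c ]≔ a) c'))
      set-reg (suc (suc i)) (a ∷ b ∷ t) m = cong (λ t → store X Y (V.map un (v [ c ]≔ a [ c' ]≔ b)) w t r) (sym (V.map-[]≔ un t i))

      open RegisterOps stacks one reg st get-reg set-reg public

      st-lookup : counted v w (0 ∷ 0 ∷ 0 ∷ []) ≡ regs (lookup v c) (lookup v c') 0 0 0
      st-lookup = cong (λ v → counted v w (0 ∷ 0 ∷ 0 ∷ [])) (sym (trans (cong (_[ c' ]≔ lookup v c') (V.[]≔-lookup v c)) (V.[]≔-lookup v c')))

      st-copied : regs (lookup v c') (lookup v c') 0 0 0 ≡ counted (v [ c ]≔ lookup v c') w (0 ∷ 0 ∷ 0 ∷ [])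
      st-copied = cong (λ v → counted v w (0 ∷ 0 ∷ 0 ∷ []))
        (trans (cong (v [ c ]≔ lookup v c' [ c' ]≔_) (sym (V.lookup∘update′ (ne ∘ sym) v (lookup v c'))))
          (V.[]≔-lookup (v [ c ]≔ lookup v c') c'))

  -- These commands mention no store, as compilation requires; they unfold to the register commands
  -- obtained in `Pair` for any particular store.
  clrC : Fin C → Cmd Name Γ
  clrC c = loop (cs c) (λ _ → skip)

  copyC : Fin C → Fin C → Cmd Name Γ
  copyC c c' = loop (cs c') (λ _ → push (ts zero) one) ⨾ clrC c ⨾
    loop (ts zero) (λ _ → push (cs c) one ⨾ push (cs c') one)

  refillC : Fin C → Fin C → Cmd Name Γ
  refillC c c' = loop (ts zero) (λ _ → push (cs c) one) ⨾ loop (ts (suc zero)) (λ _ → push (cs c') one)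

  cmpC : Fin C → Fin C → (Ord → Cmd Name Γ) → Cmd Name Γ
  cmpC c c' f =
    loop (cs c) (λ _ → push (ts zero) one ⨾ pop (cs c') (maybe (λ _ → push (ts (suc zero)) one) (push (ts (suc (suc zero))) one))) ⨾
    pop (cs c') (maybe (λ _ → push (cs c') one ⨾ refillC c c' ⨾ f less)
      (pop (ts (suc (suc zero))) (maybe (λ _ → loop (ts (suc (suc zero))) (λ _ → skip) ⨾ refillC c c' ⨾ f greater) (refillC c c' ⨾ f equal))))

  -- `ι` names the copies of the input still available. A loop consumes `ι zero` and leaves the
  -- others to its body, so the nesting depth is the number of copies required.
  tr : ∀ {d} → Prog Γ C W d → (Fin d → Fin D) → Cmd Name Γ
  tr idle ι = skip
  tr (p » q) ι = tr p ι ⨾ tr q ι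
  tr (inc c) ι = push (cs c) one
  tr (clr c) ι = clrC c
  tr (copy c c') ι = copyC c c'
  tr (cmp c c' f) ι = cmpC c c' (λ o → tr (f o) ι)
  tr (emit j a) ι = push (ws j) a
  tr (pull j f) ι = pop (ws j) (λ m → tr (f m) ι)
  tr (for f) ι = loop (xs (ι zero)) (λ a → push (ys (ι zero)) a ⨾ tr (f a) (ι ∘ suc)) ⨾
    loop (ys (ι zero)) (λ a → push (xs (ι zero)) a)

  module _ (r : Vec (List Γ) R) (x : List Γ) (M : ℕ) where

    running : Vec (List Γ) D → Vec (List Γ) D → State → Store
    running X Y (v , w) = counted X Y r v w (0 ∷ 0 ∷ 0 ∷ [])

    private
      n : ℕ
      n = length x

      clearTime : ∀ {k} → k ≤ M → suc (k * 2) ≤ 20 * suc M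
      clearTime {k} le = ≤-trans (≤-trans (m≤m+n _ (18 * k + 19)) (≤-reflexive (equal₁ k))) (*-monoʳ-≤ 20 (s≤s le))
        where
        equal₁ : ∀ k → suc (k * 2) + (18 * k + 19) ≡ 20 * suc k
        equal₁ = solve-∀

      copyTime : ∀ {a b m} → a ≤ m → b ≤ m → m ≤ M → suc (b * 2) + (suc (a * 2) + suc (b * 3)) ≤ 20 * suc M
      copyTime {a} {b} {m} am bm mM = ≤-trans
        (+-mono-≤ (s≤s (*-monoˡ-≤ 2 bm)) (+-mono-≤ (s≤s (*-monoˡ-≤ 2 am)) (s≤s (*-monoˡ-≤ 3 bm))))
        (≤-trans (≤-trans (m≤m+n _ (13 * m + 17)) (≤-reflexive (equal₁ m))) (*-monoʳ-≤ 20 (s≤s mM)))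
        where
        equal₁ : ∀ m → (suc (m * 2) + (suc (m * 2) + suc (m * 3))) + (13 * m + 17) ≡ 20 * suc m
        equal₁ = solve-∀

    -- Only the copies in the range of `ι` are assumed intact, as enclosing loops are halfway
    -- through theirs; injectivity keeps a loop from disturbing the copies used in its body. `M`
    -- dominates the counters throughout: `m` at the start plus all increments.
    exec-tr : ∀ {d} (p : Prog Γ C W d) (ι : Fin d → Fin D) → (∀ {i j} → ι i ≡ ι j → i ≡ j) → ∀ X Y →
      (∀ i → lookup X (ι i) ≡ x) → (∀ i → lookup Y (ι i) ≡ []) → ∀ s {m} → Counters m (proj₁ s) →
      m + incs finΓ p n ≤ M →
      E (time finΓ p n M) (tr p ι) (running X Y s) (running X Y (sem p x s))
    exec-tr idle ι inj X Y hX hY s h b = eskip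
    exec-tr (p » q) ι inj X Y hX hY s {m} h b =
      let b' = subst (_≤ M) (sym (+-assoc m _ _)) b in
      eseq (exec-tr p ι inj X Y hX hY s h (m+n≤o⇒m≤o _ b'))
           (exec-tr q ι inj X Y hX hY (sem p x s) (sem-counters finΓ p x s h) b')
    exec-tr (inc c) ι inj X Y hX hY (v , w) h b = subst (E 1 (push (cs c) one) (running X Y (v , w)))
      (trans (cong (λ l → set (cs c) (one ∷ l) (running X Y (v , w))) (get-counter X Y r v w (0 ∷ 0 ∷ 0 ∷ []) c))
        (set-counter X Y r v w (0 ∷ 0 ∷ 0 ∷ []) c (suc (lookup v c)))) (epush tt)
    exec-tr (clr c) ι inj X Y hX hY (v , w) h b =
      weak (clearTime (≤-trans (bounded h c) (m+n≤o⇒m≤o _ b))) (clear (lookup v c) v refl)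
      where
      at0 : Vec ℕ C → Store
      at0 v = running X Y (v , w)
      clear : ∀ k v → lookup v c ≡ k → E (suc (k * 2)) (clrC c) (at0 v) (at0 (v [ c ]≔ 0))
      clear zero v e = subst (λ u → E 1 (clrC c) (at0 v) (at0 u)) (sym (trans (cong (v [ c ]≔_) (sym e)) (V.[]≔-lookup v c)))
        (eloop[] (trans (get-counter X Y r v w (0 ∷ 0 ∷ 0 ∷ []) c) (cong un e)))
      clear (suc k) v e = subst (λ u → E (suc (suc k * 2)) (clrC c) (at0 v) (at0 u)) (V.[]≔-idempotent v c)
        (eloop∷ (trans (get-counter X Y r v w (0 ∷ 0 ∷ 0 ∷ []) c) (cong un e)) tt eskip
          (subst (λ s → E (suc (k * 2)) (clrC c) s (at0 (v [ c ]≔ k [ c ]≔ 0))) (sym (set-counter X Y r v w (0 ∷ 0 ∷ 0 ∷ []) c k))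
            (clear k (v [ c ]≔ k) (V.lookup∘update c v k))))
    exec-tr (copy c c' {ne}) ι inj X Y hX hY (v , w) h b =
      subst₂ (E (20 * suc M) (copyC c c')) (sym st-lookup) st-copied (weak (copyTime (bounded h c) (bounded h c') (m+n≤o⇒m≤o _ b)) (exec-copy (lookup v c) (lookup v c')))
      where open Pair X Y r v w c c' (toWitnessFalse ne)
    exec-tr (cmp c c' {ne} f) ι inj X Y hX hY (v , w) {m} h b =
      subst (λ s → E (time finΓ (cmp c c' {ne} f) n M) (tr (cmp c c' {ne} f) ι) s s') (sym st-lookup)
        (exec-cmp (λ o → tr (f o) ι) (lookup v c) (lookup v c') M (≤-trans (bounded h c) mM) (≤-trans (bounded h c') mM)
          (subst (λ s → E (T less + (T equal + T greater)) (tr (f (compareℕ (lookup v c) (lookup v c'))) ι) s s') st-lookup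
            (branch (compareℕ (lookup v c) (lookup v c')))))
      where
      open Pair X Y r v w c c' (toWitnessFalse ne)
      s' : Store
      s' = running X Y (sem (cmp c c' {ne} f) x (v , w))
      mM : m ≤ M
      mM = m+n≤o⇒m≤o _ b
      I : Ord → ℕ
      I o = incs finΓ (f o) n
      T : Ord → ℕ
      T o = time finΓ (f o) n M
      branch : ∀ o → E (T less + (T equal + T greater)) (tr (f o) ι) (running X Y (v , w)) (running X Y (sem (f o) x (v , w)))
      branch o = weak (ord-≤ T o) (exec-tr (f o) ι inj X Y hX hY (v , w) h (≤-trans (+-monoʳ-≤ m (ord-≤ I o)) b))
    exec-tr (emit j a) ι inj X Y hX hY (v , w) h b = epush tt
    exec-tr (pull j f) ι inj X Y hX hY (v , w) {m} h b with lookup w j in e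
    ... | [] = epop[] e (weak (m≤m+n _ _) (exec-tr (f nothing) ι inj X Y hX hY (v , w) h (≤-trans (+-monoʳ-≤ m (m≤m+n _ _)) b)))
    ... | a ∷ l = epop∷ e tt (weak (≤-trans (sumΓ-≥ finΓ (λ a → time finΓ (f (just a)) n M) a) (m≤n+m _ _))
      (exec-tr (f (just a)) ι inj X Y hX hY (v , w [ j ]≔ l) h
        (≤-trans (+-monoʳ-≤ m (≤-trans (sumΓ-≥ finΓ (λ a → incs finΓ (f (just a)) n) a) (m≤n+m _ _))) b)))
    exec-tr (for {d} f) ι inj X Y hX hY s {m} h b =
      eseq (subst₂ (λ X₁ Y₁ → E (suc (n * suc (suc T))) body (running X₁ Y₁ s) (running (X [ l ]≔ []) (Y [ l ]≔ (x ʳ++ [])) (sem (for f) x s)))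
             (trans (cong (X [ l ]≔_) (sym (hX zero))) (V.[]≔-lookup X l))
             (trans (cong (Y [ l ]≔_) (sym (hY zero))) (V.[]≔-lookup Y l))
             (go x [] s h b))
           (subst₂ (λ t X₁ → E (suc (t * 2)) rest (running (X [ l ]≔ []) (Y [ l ]≔ (x ʳ++ [])) (sem (for f) x s)) (running X₁ Y (sem (for f) x s)))
             (trans (length-ʳ++ x) (+-identityʳ n))
             (trans (cong (X [ l ]≔_) (trans (trans (ʳ++-ʳ++ x) (++-identityʳ x)) (sym (hX zero)))) (V.[]≔-lookup X l))
             (subst (λ Y₁ → E (suc (length (x ʳ++ []) * 2)) rest (running (X [ l ]≔ []) (Y [ l ]≔ (x ʳ++ [])) (sem (for f) x s))
                      (running (X [ l ]≔ ((x ʳ++ []) ʳ++ [])) Y₁ (sem (for f) x s)))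
               (trans (cong (Y [ l ]≔_) (sym (hY zero))) (V.[]≔-lookup Y l))
               (back (x ʳ++ []) [] (sem (for f) x s))))
      where
      l : Fin D
      l = ι zero
      T I : ℕ
      T = sumΓ finΓ (λ a → time finΓ (f a) n M)
      I = sumΓ finΓ (λ a → incs finΓ (f a) n)
      body rest : Cmd Name Γ
      body = loop (xs l) (λ a → push (ys l) a ⨾ tr (f a) (ι ∘ suc))
      rest = loop (ys l) (λ a → push (xs l) a)
      off : ∀ {k} i (Z : Vec (List Γ) D) → lookup (Z [ l ]≔ k) (ι (suc i)) ≡ lookup Z (ι (suc i))
      off {k} i Z = V.lookup∘update′ (λ e → case inj e of λ ()) Z k
      go : ∀ y acc s {m} → Counters m (proj₁ s) → m + length y * I ≤ M →
        E (suc (length y * suc (suc T))) body (running (X [ l ]≔ y) (Y [ l ]≔ acc) s)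
          (running (X [ l ]≔ []) (Y [ l ]≔ (y ʳ++ acc)) (foldl (λ s a → sem (f a) x s) s y))
      go [] acc s h b = eloop[] (V.lookup∘update l X [])
      go (a ∷ y) acc s {m} h b = weak (≤-reflexive (cong suc (+-suc (suc T) _))) (eloop∷ (V.lookup∘update l X (a ∷ y)) tt
        (subst (λ X₁ → E (suc T) _ (running X₁ (Y [ l ]≔ acc) s) (running (X [ l ]≔ y) (Y [ l ]≔ (a ∷ acc)) (sem (f a) x s)))
          (sym (V.[]≔-idempotent X l))
          (eseq (epush tt)
            (subst (λ Y₁ → E T (tr (f a) (ι ∘ suc)) (running (X [ l ]≔ y) Y₁ s) (running (X [ l ]≔ y) (Y [ l ]≔ (a ∷ acc)) (sem (f a) x s)))
              (sym (trans (V.[]≔-idempotent Y l) (cong (λ k → Y [ l ]≔ (a ∷ k)) (V.lookup∘update l Y acc))))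
              (weak (sumΓ-≥ finΓ (λ a → time finΓ (f a) n M) a)
                (exec-tr (f a) (ι ∘ suc) (F.suc-injective ∘ inj) (X [ l ]≔ y) (Y [ l ]≔ (a ∷ acc))
                  (λ i → trans (off i X) (hX (suc i))) (λ i → trans (off i Y) (hY (suc i))) s h
                  (≤-trans (+-monoʳ-≤ m (≤-trans Ia (m≤m+n I _))) b))))))
        (go y (a ∷ acc) (sem (f a) x s) (counters-≤ {W = W} finΓ (+-monoʳ-≤ m Ia) (sem-counters finΓ (f a) x s h))
          (subst (_≤ M) (sym (+-assoc m I _)) b)))
        where
        Ia : incs finΓ (f a) n ≤ I
        Ia = sumΓ-≥ finΓ (λ a → incs finΓ (f a) n) a
      back : ∀ k j s → E (suc (length k * 2)) rest (running (X [ l ]≔ j) (Y [ l ]≔ k) s) (running (X [ l ]≔ (k ʳ++ j)) (Y [ l ]≔ []) s)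
      back [] j s = eloop[] (V.lookup∘update l Y [])
      back (a ∷ k) j s = eloop∷ (V.lookup∘update l Y (a ∷ k)) tt (epush tt)
        (subst₂ (λ X₁ Y₁ → E (suc (length k * 2)) rest (running X₁ Y₁ s) (running (X [ l ]≔ (k ʳ++ (a ∷ j))) (Y [ l ]≔ []) s))
          (sym (trans (V.[]≔-idempotent X l) (cong (λ i → X [ l ]≔ (a ∷ i)) (V.lookup∘update l X j))))
          (sym (V.[]≔-idempotent Y l)) (back k (a ∷ j) s))

-- Simulating a machine on a selected word

-- One stack alphabet serves unary counting, input and output words, certificates, the format check
-- and the simulated machine. Since `q` and `g` are the sizes of that machine, selectors have to be
-- uniform in them.
data Sym (k₁ k₂ q g : ℕ) : Set where
  tok  : Sym k₁ k₂ q g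
  inn  : Fin k₁ → Sym k₁ k₂ q g
  out  : Fin k₂ → Sym k₁ k₂ q g
  bit  : Bool → Sym k₁ k₂ q g
  flag : Fin 8 → Sym k₁ k₂ q g
  st   : Fin q → Sym k₁ k₂ q g
  tp   : Fin g → Sym k₁ k₂ q g
  rule : Fin q × Fin g × Move → Sym k₁ k₂ q g

finSym : ∀ {k₁ k₂ q g} → Finite (Sym k₁ k₂ q g)
finSym {k₁} {k₂} {q} {g} = finRetract
  (fin⊎ (fin⊎ (fin⊎ fin⊤ (finFin k₁)) (fin⊎ (finFin k₂) finBool))
        (fin⊎ (fin⊎ (finFin 8) (finFin q)) (fin⊎ (finFin g) (fin× (finFin q) (fin× (finFin g) finMove)))))
  (λ { tok → inj₁ (inj₁ (inj₁ tt)) ; (inn a) → inj₁ (inj₁ (inj₂ a)) ; (out a) → inj₁ (inj₂ (inj₁ a))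
     ; (bit b) → inj₁ (inj₂ (inj₂ b)) ; (flag a) → inj₂ (inj₁ (inj₁ a)) ; (st a) → inj₂ (inj₁ (inj₂ a))
     ; (tp a) → inj₂ (inj₂ (inj₁ a)) ; (rule a) → inj₂ (inj₂ (inj₂ a)) })
  (λ { (inj₁ (inj₁ (inj₁ _))) → tok ; (inj₁ (inj₁ (inj₂ a))) → inn a ; (inj₁ (inj₂ (inj₁ a))) → out a
     ; (inj₁ (inj₂ (inj₂ b))) → bit b ; (inj₂ (inj₁ (inj₁ a))) → flag a ; (inj₂ (inj₁ (inj₂ a))) → st a
     ; (inj₂ (inj₂ (inj₁ a))) → tp a ; (inj₂ (inj₂ (inj₂ a))) → rule a })
  (λ { tok → refl ; (inn a) → refl ; (out a) → refl ; (bit b) → refl ; (flag a) → refl ; (st a) → refl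
     ; (tp a) → refl ; (rule a) → refl })

-- A polynomial-time program that, given x and a certificate, yields some y with R x y or fails;
-- every such y is obtained from a certificate that starts with at most |x|² bits.
record Selector (k₁ k₂ : ℕ) (R : List (Fin k₁) → List (Fin k₂) → Set) : Set where
  field
    C W D : ℕ
    prog  : ∀ q g → Prog (Sym k₁ k₂ q g) C W (2 + D)
    certS outS okS : Fin W
    okS≢outS   : okS ≢ outS
    okS≢certS  : okS ≢ certS
    outS≢certS : outS ≢ certS

  start₀ : ∀ q g → List (Sym k₁ k₂ q g) → State {Sym k₁ k₂ q g} {C} {W}
  start₀ q g c = V.replicate C 0 , V.replicate W [] [ certS ]≔ c

  result : ∀ q g → List (Fin k₁) → List (Sym k₁ k₂ q g) → Vec (List (Sym k₁ k₂ q g)) W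
  result q g x c = proj₂ (sem (prog q g) (map inn x) (start₀ q g c))

  field
    sound : ∀ q g x c {a l} → lookup (result q g x c) okS ≡ a ∷ l →
      Σ (List (Fin k₂)) λ y → R x y × lookup (result q g x c) outS ≡ reverse (map out y)
    -- The program uses up exactly the bits and leaves `rest` behind. For NP, `rest` contains the
    -- guessed moves of the simulated machine; for PSPACE it is padding.
    complete : ∀ q g x y → R x y → Σ (List Bool) λ bs → length bs ≤ length x * length x ×
      (∀ rest → (∃ λ a → ∃ λ l → lookup (result q g x (map bit bs ++ rest)) okS ≡ a ∷ l) ×
        lookup (result q g x (map bit bs ++ rest)) outS ≡ reverse (map out y) ×
        lookup (result q g x (map bit bs ++ rest)) certS ≡ rest)

vec-ext : ∀ {A : Set} {n} {u v : Vec A n} → (∀ i → lookup u i ≡ lookup v i) → u ≡ v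
vec-ext {u = []} {[]} h = refl
vec-ext {u = x ∷ u} {y ∷ v} h = cong₂ _∷_ (h zero) (vec-ext (h ∘ suc))

module Driver {k₁ k₂ : ℕ} {R : List (Fin k₁) → List (Fin k₂) → Set} (Sel : Selector k₁ k₂ R) (q g : ℕ) where
  open Selector Sel

  Γ : Set
  Γ = Sym k₁ k₂ q g

  open Compile {Γ} finSym tok (2 + D) C W 10 public

  Stacks : Set
  Stacks = Vec (List Γ) 10

  IN ST HD LFT RGT RES ODO ODO' AGAIN CARRY : Name
  IN    = ds zero
  ST    = ds (suc zero)
  HD    = ds (suc (suc zero))
  LFT   = ds (suc (suc (suc zero)))
  RGT   = ds (suc (suc (suc (suc zero))))
  RES   = ds (suc (suc (suc (suc (suc zero)))))
  ODO   = ds (suc (suc (suc (suc (suc (suc zero))))))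
  ODO'  = ds (suc (suc (suc (suc (suc (suc (suc zero)))))))
  AGAIN = ds (suc (suc (suc (suc (suc (suc (suc (suc zero))))))))
  CARRY = ds (suc (suc (suc (suc (suc (suc (suc (suc (suc zero)))))))))

  empty : ∀ {n} → Vec (List Γ) n
  empty = V.replicate _ []

  zeros : Vec (List Γ) C
  zeros = V.map un (V.replicate C 0)

  initially : List Γ → List Γ → Store
  initially a c = store empty empty zeros (empty [ certS ]≔ c) empty (a ∷ empty)

  inputStorage : InputStorage Γ
  inputStorage = record
    { storage = stacks ; IN = IN ; CERT = ws certS ; s₀ = initially
    ; get-IN = λ a c → refl
    ; get-CERT = λ a c → V.lookup∘update certS empty c
    ; get-other = other }
    where
    other : ∀ j a c → j ≢ IN → j ≢ ws certS → get j (initially a c) ≡ []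
    other (xs i) a c _ _ = V.lookup-replicate i []
    other (ys i) a c _ _ = V.lookup-replicate i []
    other (cs i) a c _ _ = trans (V.lookup-map i un (V.replicate C 0)) (cong un (V.lookup-replicate i 0))
    other (ws i) a c _ ne = trans (V.lookup∘update′ (ne ∘ cong ws) empty c) (V.lookup-replicate i [])
    other (ts i) a c _ _ = V.lookup-replicate i []
    other (ds zero) a c ne _ = ⊥-elim (ne refl)
    other (ds (suc i)) a c _ _ = V.lookup-replicate i []

  pushAll : ∀ {n} → (Fin n → Fin (2 + D)) → Γ → Cmd Name Γ
  pushAll {zero}  ι a = skip
  pushAll {suc n} ι a = push (xs (ι zero)) a ⨾ pushAll (ι ∘ suc) a

  -- Emptying the reversed input onto the copies brings it back into its original order.
  loadInput : Cmd Name Γ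
  loadInput = loop IN (pushAll id)

  loadTime : ℕ → ℕ
  loadTime n = suc (n * (5 + D))

  module _ (Y : Vec (List Γ) (2 + D)) (c : Vec (List Γ) C) (w : Vec (List Γ) W) (t : Vec (List Γ) 3) where
    exec-pushAll : ∀ {n} (ι : Fin n → Fin (2 + D)) → (∀ {i j} → ι i ≡ ι j → i ≡ j) → ∀ a X r →
      Σ (Vec (List Γ) (2 + D)) λ X' → E (suc n) (pushAll ι a) (store X Y c w t r) (store X' Y c w t r) ×
        (∀ i → lookup X' (ι i) ≡ a ∷ lookup X (ι i)) × (∀ j → (∀ i → j ≢ ι i) → lookup X' j ≡ lookup X j)
    exec-pushAll {zero} ι inj a X r = X , eskip , (λ ()) , (λ _ _ → refl)
    exec-pushAll {suc n} ι inj a X r =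
      let (X' , e , hit , miss) = exec-pushAll (ι ∘ suc) (F.suc-injective ∘ inj) a (X [ ι zero ]≔ (a ∷ lookup X (ι zero))) r
      in X' , eseq (epush tt) e ,
         (λ { zero → trans (miss (ι zero) (λ i e → case inj e of λ ())) (V.lookup∘update (ι zero) X _)
            ; (suc i) → trans (hit i) (cong (a ∷_) (V.lookup∘update′ (λ e → case inj e of λ ()) X _)) }) ,
         (λ j ne → trans (miss j (ne ∘ suc)) (V.lookup∘update′ (ne zero) X _))

    exec-loadInput : ∀ l y X r → (∀ i → lookup X i ≡ l) →
      Σ (Vec (List Γ) (2 + D)) λ X' → E (loadTime (length y)) loadInput (store X Y c w t (y ∷ r)) (store X' Y c w t ([] ∷ r)) ×
        (∀ i → lookup X' i ≡ y ʳ++ l)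
    exec-loadInput l [] X r h = X , eloop[] refl , h
    exec-loadInput l (a ∷ y) X r h =
      let (X₁ , e₁ , h₁ , _) = exec-pushAll id id a X (y ∷ r)
          (X₂ , e₂ , h₂) = exec-loadInput (a ∷ l) y X₁ r (λ i → trans (h₁ i) (cong (a ∷_) (h i)))
      in X₂ , weak (≤-trans (≤-reflexive (cong suc (+-suc (suc (suc (suc D))) _))) (s≤s (+-monoˡ-≤ _ (n≤1+n (4 + D))))) (eloop∷ refl tt e₁ e₂) , h₂

  progTime : ℕ → ℕ
  progTime n = time finSym (prog q g) n (incs finSym (prog q g) n)

  poly-progTime : Poly progTime
  poly-progTime = poly-time finSym (prog q g) (poly-incs finSym (prog q g))

  exec-prog : ∀ x c X r → (∀ i → lookup X i ≡ map inn x) → let (v , w) = sem (prog q g) (map inn x) (start₀ q g c) in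
    E (progTime (length x)) (tr (prog q g) id) (store X empty zeros (empty [ certS ]≔ c) empty r)
      (store X empty (V.map un v) w empty r)
  exec-prog x c X r hX = subst (λ n → E (progTime n) (tr (prog q g) id)
      (store X empty zeros (empty [ certS ]≔ c) empty r) (running r (map inn x) M X empty (sem (prog q g) (map inn x) (start₀ q g c))))
    (length-map inn x)
    (exec-tr r (map inn x) M (prog q g) id id X empty hX (λ i → V.lookup-replicate i []) (start₀ q g c)
      (counters λ i → ≤-reflexive (V.lookup-replicate i 0)) ≤-refl)
    where
    M : ℕ
    M = incs finSym (prog q g) (length (map inn x))

  prepare : Cmd Name Γ
  prepare = loadInput ⨾ tr (prog q g) id

  prepareTime : ℕ → ℕ
  prepareTime n = loadTime n + progTime n

  poly-prepareTime : Poly prepareTime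
  poly-prepareTime = poly-+ (poly-suc (poly-* poly-id (poly-const (5 + D)))) poly-progTime

  exec-prepare : ∀ x c → Σ (Vec (List Γ) (2 + D)) λ X → let (v , w) = sem (prog q g) (map inn x) (start₀ q g c) in
    E (prepareTime (length x)) prepare (initially (reverse (map inn x)) c) (store X empty (V.map un v) w empty empty)
  exec-prepare x c =
    let i = reverse (map inn x)
        (X , e , h) = exec-loadInput empty zeros (empty [ certS ]≔ c) empty [] i empty empty (λ j → V.lookup-replicate j [])
    in X , eseq (subst (λ n → E (loadTime n) loadInput (initially i c) (store X empty zeros (empty [ certS ]≔ c) empty empty))
                   (trans (length-reverse (map inn x)) (length-map inn x)) e)
      (exec-prog x c X empty (λ j → trans (h j) (trans (ʳ++-defn i) (trans (++-identityʳ _) (reverse-involutive (map inn x))))))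

  -- The scanned cell of the simulated tape is kept on HD.
  shift : Fin g → Fin q → Fin g → Move → Cmd Name Γ
  shift b q' a left  = pop LFT (maybe (λ x → push RGT (tp a) ⨾ push HD x) (push HD (tp a))) ⨾ push ST (st q')
  shift b q' a right = push LFT (tp a) ⨾ pop RGT (maybe (λ x → push HD x) (push HD (tp b))) ⨾ push ST (st q')
  shift b q' a stay  = push HD (tp a) ⨾ push ST (st q')

  copyOut : (Fin k₂ → Fin g) → Γ → Cmd Name Γ
  copyOut inp (out a) = push RGT (tp (inp a))
  copyOut inp _       = skip

  loadTape : (Fin k₂ → Fin g) → Fin g → Fin q → Cmd Name Γ
  loadTape inp b s = loop (ws outS) (copyOut inp) ⨾ pop RGT (maybe (λ h → push HD h) (push HD (tp b))) ⨾ push ST (st s)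

  module _ (X Y : Vec (List Γ) (2 + D)) (c : Vec (List Γ) C) (t : Vec (List Γ) 3) where

    -- `ST` holds the current state as its single symbol. The loop over `ST` removes it for each
    -- simulated step, and the simulation goes on precisely if the step pushes a new one.
    simulating : Vec (List Γ) W → List Γ → Config q g → Vec (List Γ) 5 → Store
    simulating w i (conf s l h r) ρ = store X Y c w t (i ∷ (st s ∷ []) ∷ (tp h ∷ []) ∷ map tp l ∷ map tp r ∷ ρ)

    -- No accessed stack is higher than the space of the configuration. `Ok` is general because one
    -- driver needs the trivial condition and the other a space bound.
    exec-shift : ∀ {Ok : ℕ → Set} w i b s l h r ρ q' a m → (∀ {n} → n ≤ length l + suc (length r) → Ok n) →
      Exec stacks Ok 4 (shift b q' a m) (store X Y c w t (i ∷ [] ∷ [] ∷ map tp l ∷ map tp r ∷ ρ))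
        (simulating w i (act b (conf s l h r) q' a m) ρ)
    exec-shift w i b s [] h r ρ q' a left ok = weak (s≤s (s≤s (s≤s z≤n))) (eseq (epop[] refl (epush (ok z≤n))) (epush (ok z≤n)))
    exec-shift w i b s (x ∷ l) h r ρ q' a left ok = eseq
      (epop∷ refl (ok (s≤s (≤-trans (≤-reflexive (length-map tp l)) (m≤m+n _ _))))
        (eseq (epush (ok (≤-trans (≤-reflexive (length-map tp r)) (≤-trans (n≤1+n _) (m≤n+m _ (suc (length l))))))) (epush (ok z≤n)))) (epush (ok z≤n))
    exec-shift w i b s l h [] ρ q' a right ok = eseq (epush (ok (≤-trans (≤-reflexive (length-map tp l)) (m≤m+n _ _))))
      (eseq (epop[] refl (epush (ok z≤n))) (epush (ok z≤n)))
    exec-shift w i b s l h (x ∷ r) ρ q' a right ok = eseq (epush (ok (≤-trans (≤-reflexive (length-map tp l)) (m≤m+n _ _))))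
      (eseq (epop∷ refl (ok (≤-trans (s≤s (≤-trans (≤-reflexive (length-map tp r)) (n≤1+n _))) (m≤n+m _ (length l)))) (epush (ok z≤n))) (epush (ok z≤n)))
    exec-shift w i b s l h r ρ q' a stay ok = weak (s≤s (s≤s z≤n)) (eseq (epush (ok z≤n)) (epush (ok z≤n)))

    exec-loadTape : ∀ inp b s w i ρ y → lookup w outS ≡ reverse (map out y) →
      E (4 + length y * 2) (loadTape inp b s) (store X Y c w t (i ∷ [] ∷ [] ∷ [] ∷ [] ∷ ρ))
        (simulating (w [ outS ]≔ []) i (initial b inp s y) ρ)
    exec-loadTape inp b s w i ρ y e = weak (≤-trans (+-monoʳ-≤ (suc (length (reverse y) * 2)) (s≤s (s≤s (s≤s z≤n))))
        (≤-reflexive (trans (cong (λ n → suc (n * 2) + 3) (length-reverse y)) (eq₁ (length y)))) ) (eseq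
      (subst (λ w₁ → E (suc (length (reverse y) * 2)) (loop (ws outS) (copyOut inp)) (store X Y c w₁ t (i ∷ [] ∷ [] ∷ [] ∷ [] ∷ ρ)) (filled (map tp (map inp y))))
        (trans (cong (w [ outS ]≔_) (trans (reverse-map out y) (sym e))) (V.[]≔-lookup w outS))
        (subst (λ l → E (suc (length (reverse y) * 2)) (loop (ws outS) (copyOut inp)) (store X Y c (w [ outS ]≔ map out (reverse y)) t (i ∷ [] ∷ [] ∷ [] ∷ [] ∷ ρ)) (filled l))
          (cong (map tp ∘ map inp) (reverse-involutive y)) (go (reverse y) [])))
      (finish y))
      where
      eq₁ : ∀ n → suc (n * 2) + 3 ≡ 4 + n * 2
      eq₁ = solve-∀
      filled : List Γ → Store
      filled l = store X Y c (w [ outS ]≔ []) t (i ∷ [] ∷ [] ∷ [] ∷ l ∷ ρ)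
      go : ∀ z l → E (suc (length z * 2)) (loop (ws outS) (copyOut inp)) (store X Y c (w [ outS ]≔ map out z) t (i ∷ [] ∷ [] ∷ [] ∷ map tp (map inp l) ∷ ρ))
        (filled (map tp (map inp (z ʳ++ l))))
      go [] l = eloop[] (V.lookup∘update outS w [])
      go (a ∷ z) l = eloop∷ (V.lookup∘update outS w _) tt (epush tt)
        (subst (λ w₁ → E (suc (length z * 2)) (loop (ws outS) (copyOut inp)) (store X Y c w₁ t (i ∷ [] ∷ [] ∷ [] ∷ map tp (map inp (a ∷ l)) ∷ ρ)) (filled (map tp (map inp (z ʳ++ (a ∷ l))))))
          (sym (V.[]≔-idempotent w outS)) (go z (a ∷ l)))
      finish : ∀ y → E 3 (pop RGT (maybe (λ h → push HD h) (push HD (tp b))) ⨾ push ST (st s)) (filled (map tp (map inp y)))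
        (simulating (w [ outS ]≔ []) i (initial b inp s y) ρ)
      finish [] = eseq (epop[] refl (epush tt)) (epush tt)
      finish (a ∷ y) = eseq (epop∷ refl tt (epush tt)) (epush tt)

decEq : ∀ {A : Set} → Finite A → (a b : A) → Dec (a ≡ b)
decEq F a b with enc F a F.≟ enc F b
... | yes e = yes (enc-injective F e)
... | no ne = no (ne ∘ cong (enc F))

-- Nondeterministic polynomial time: the moves of the simulated machine come from the certificate.

module NPDriver {k₁ k₂ : ℕ} {R : List (Fin k₁) → List (Fin k₂) → Set} (Sel : Selector k₁ k₂ R) (M : NTM k₂) (c₀ d₀ : ℕ) where
  open Selector Sel
  open NTM M
  open Driver Sel Q G renaming (Γ to Γₘ)
  open import Data.List.Membership.DecPropositional (decEq (fin× (finFin Q) (fin× (finFin G) finMove))) using (_∈?_)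

  CLOCK : Name
  CLOCK = ODO

  accepting : Fin Q → Bool
  accepting s = does (s F.≟ accept)

  allowed : Fin Q → Fin G → Fin Q × Fin G × Move → Bool
  allowed s h x = does (x ∈? δ s h)

  -- A guessed symbol that is no applicable move leaves `ST` empty, which ends the simulation
  -- without acceptance.
  simRule : Fin Q → Fin G → Maybe Γₘ → Cmd Name Γₘ
  simRule s h (just (rule (q' , a , m))) = if allowed s h (q' , a , m) then shift blank q' a m else skip
  simRule s h _ = skip

  simHead : Fin Q → Maybe Γₘ → Cmd Name Γₘ
  simHead s (just (tp h)) = pop (ws certS) (simRule s h)
  simHead s _ = skip

  simTick : Fin Q → Maybe Γₘ → Cmd Name Γₘ
  simTick s (just _) = pop HD (simHead s)
  simTick s nothing  = skip

  -- Acceptance is tested before the clock is popped, so a clock of n ticks admits accepting runs of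
  -- n steps inclusive.
  sim : Γₘ → Cmd Name Γₘ
  sim (st s) = if accepting s then push RES tok else pop CLOCK (simTick s)
  sim _      = skip

  -- The final `tok` turns the length n of the selected word into `suc n`, the base of `poly`. The
  -- word itself is moved away and back.
  measure : Cmd Name Γₘ
  measure = loop (ws outS) (λ a → push ODO' tok ⨾ push LFT a) ⨾ loop LFT (λ a → push (ws outS) a) ⨾ push ODO' tok

  -- Multiplies `CLOCK` by `ODO'`, which is saved on `AGAIN`. Starting from `c₀`, `d₀`
  -- multiplications by `suc n` set the clock to `poly c₀ d₀ n`.
  multiply : Cmd Name Γₘ
  multiply = loop CLOCK (λ _ → loop ODO' (λ _ → push AGAIN tok ⨾ push CARRY tok) ⨾ loop AGAIN (λ _ → push ODO' tok)) ⨾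
    loop CARRY (λ _ → push CLOCK tok)

  pushes power : ℕ → Cmd Name Γₘ
  pushes zero = skip
  pushes (suc c) = push CLOCK tok ⨾ pushes c
  power zero = skip
  power (suc d) = multiply ⨾ power d

  -- Only runs of at most poly c₀ d₀ steps count, so the simulation is clocked.
  main : Cmd Name Γₘ
  main = prepare ⨾ pop (ws okS)
    (maybe (λ _ → measure ⨾ (pushes c₀ ⨾ power d₀) ⨾ loadTape inp blank start ⨾ loop ST sim) skip)

  mutual
    accepts : ℕ → Config Q G → List Γₘ → Bool
    accepts n c γs = if accepting (state c) then true else ticks n c γs

    ticks : ℕ → Config Q G → List Γₘ → Bool
    ticks zero    c γs = false
    ticks (suc n) c γs = follows n c γs

    follows : ℕ → Config Q G → List Γₘ → Bool
    follows n c (rule (q' , a , m) ∷ γs) = if allowed (state c) (hd c) (q' , a , m) then accepts n (act blank c q' a m) γs else false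
    follows n c _ = false

  AcceptsIn : ℕ → Config Q G → Set
  AcceptsIn k c = Σ ℕ λ n → Σ (Config Q G) λ c' → n ≤ k × Reach M n c c' × state c' ≡ accept

  accepts-sound : ∀ k c γs → accepts k c γs ≡ true → AcceptsIn k c
  follows-sound : ∀ k c γs → follows k c γs ≡ true → AcceptsIn (suc k) c
  accepts-sound k c γs e with state c F.≟ accept
  ... | yes a = 0 , c , z≤n , here , a
  accepts-sound (suc k) c γs e | no _ = follows-sound k c γs e
  follows-sound k c (rule x@(q' , a , m) ∷ γs) e with x ∈? δ (state c) (hd c)
  ... | yes x∈ = let (n , c' , le , r , ac) = accepts-sound k (act blank c q' a m) γs e in suc n , c' , s≤s le , step x∈ r , ac
  follows-sound k c [] ()
  follows-sound k c (tok ∷ γs) ()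
  follows-sound k c (inn _ ∷ γs) ()
  follows-sound k c (out _ ∷ γs) ()
  follows-sound k c (bit _ ∷ γs) ()
  follows-sound k c (flag _ ∷ γs) ()
  follows-sound k c (st _ ∷ γs) ()
  follows-sound k c (tp _ ∷ γs) ()

  accepts-complete : ∀ {n k c c'} → n ≤ k → Reach M n c c' → state c' ≡ accept →
    Σ (List Γₘ) λ γs → length γs ≤ n × accepts k c γs ≡ true
  accepts-complete {k = k} {c} le here e = [] , z≤n , cong (λ b → if b then true else ticks k c []) (dec-true (state c F.≟ accept) e)
  accepts-complete {k = suc k} {c} (s≤s le) (step {q' = q'} {a} {m} x∈ r) e =
    let (γs , le' , ac) = accepts-complete le r e in
    rule (q' , a , m) ∷ γs , s≤s le' , first-step γs ac (accepting (state c))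
    where
    first-step : ∀ γs → accepts k (act blank c q' a m) γs ≡ true → ∀ b →
      (if b then true else follows k c (rule (q' , a , m) ∷ γs)) ≡ true
    first-step γs ac true = refl
    first-step γs ac false = trans (cong (λ b → if b then accepts k (act blank c q' a m) γs else false)
      (dec-true ((q' , a , m) ∈? δ (state c) (hd c)) x∈)) ac

  open Program finSym inputStorage main RES tok inn using (verdict; input; inNP; heights-init; length-input)

  mulTime : ℕ → ℕ → ℕ
  mulTime a N = suc (a * suc (suc (N * 3) + suc (N * 2))) + suc (a * N * 2)

  powTime : ℕ → ℕ → ℕ → ℕ
  powTime zero a N = 1
  powTime (suc d) a N = mulTime a N + powTime d (a * N) N

  module _ (X Y : Vec (List Γₘ) (2 + D)) (cv : Vec (List Γₘ) C) (t : Vec (List Γₘ) 3) where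
    -- Each iteration that is followed by another one consumes a guessed symbol, so the number of
    -- these symbols bounds the time; eight instructions cover an iteration.
    exec-sim : ∀ n γs w i c ρ → Σ Store λ s' →
      E (8 * suc (length γs)) (loop ST sim) (simulating X Y cv t (w [ certS ]≔ γs) i c ([] ∷ un n ∷ ρ)) s' ×
      get RES s' ≡ verdict (accepts n c γs)
    exec-sim n γs w i (conf s l h r) ρ with accepting s in eq₁
    ... | true = mid (tok ∷ []) , weak (≤-trans (s≤s (s≤s (s≤s z≤n))) (*-monoʳ-≤ 8 (s≤s (z≤n {length γs}))))
          (eloop∷ refl tt (subst (λ b → E 1 (if b then push RES tok else pop CLOCK (simTick s)) (mid []) (mid (tok ∷ []))) (sym eq₁) (epush tt)) (eloop[] refl)) , refl
      where
      mid : List Γₘ → Store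
      mid v = store X Y cv (w [ certS ]≔ γs) t (i ∷ [] ∷ (tp h ∷ []) ∷ map tp l ∷ map tp r ∷ v ∷ un n ∷ ρ)
    ... | false = tick n
      where
      entered : List Γₘ → ℕ → Store
      entered γs n = store X Y cv (w [ certS ]≔ γs) t (i ∷ [] ∷ (tp h ∷ []) ∷ map tp l ∷ map tp r ∷ [] ∷ un n ∷ ρ)
      headed : ℕ → List Γₘ → Store
      headed n γs = store X Y cv (w [ certS ]≔ γs) t (i ∷ [] ∷ [] ∷ map tp l ∷ map tp r ∷ [] ∷ un n ∷ ρ)
      enter : ∀ γs n {t₁ s₁} → E t₁ (pop CLOCK (simTick s)) (entered γs n) s₁ → E t₁ (sim (st s)) (entered γs n) s₁
      enter γs n {t₁} {s₁} e = subst (λ b → E t₁ (if b then push RES tok else pop CLOCK (simTick s)) (entered γs n) s₁) (sym eq₁) e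
      Done : ℕ → List Γₘ → Bool → Set
      Done n γs b = Σ Store λ s' → E (8 * suc (length γs)) (loop ST sim) (simulating X Y cv t (w [ certS ]≔ γs) i (conf s l h r) ([] ∷ un n ∷ ρ)) s' ×
        get RES s' ≡ verdict b
      ends : ∀ n γ γs → simRule s h (just γ) ≡ skip → Done (suc n) (γ ∷ γs) false
      ends n γ γs e = headed n γs , weak (≤-trans (s≤s (s≤s (s≤s (s≤s (s≤s (s≤s z≤n)))))) (*-monoʳ-≤ 8 (s≤s (z≤n {suc (length γs)}))))
        (eloop∷ refl tt (enter (γ ∷ γs) (suc n) (epop∷ refl tt (epop∷ refl tt (epop∷ (V.lookup∘update certS w (γ ∷ γs)) tt
          (subst₂ (λ c w₁ → E 1 c (store X Y cv w₁ t (i ∷ [] ∷ [] ∷ map tp l ∷ map tp r ∷ [] ∷ un n ∷ ρ)) (headed n γs)) (sym e)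
            (sym (V.[]≔-idempotent w certS)) eskip))))) (eloop[] refl)) , refl
      go : ∀ n γs → Done (suc n) γs (follows n (conf s l h r) γs)
      go n [] = headed n [] , weak (s≤s (s≤s (s≤s (s≤s (s≤s (s≤s z≤n))))))
        (eloop∷ refl tt (enter [] (suc n) (epop∷ refl tt (epop∷ refl tt (epop[] (V.lookup∘update certS w []) eskip)))) (eloop[] refl)) , refl
      go n (rule (q' , a , m) ∷ γs) with allowed s h (q' , a , m) in eq₂
      ... | false = ends n _ γs (cong (λ b → if b then shift blank q' a m else skip) eq₂)
      ... | true =
        let (s' , e , v) = exec-sim n γs w i (act blank (conf s l h r) q' a m) ρ in
        s' , weak (≤-reflexive (sym (*-suc 8 (suc (length γs)))))
          (eloop∷ refl tt (enter _ (suc n) (epop∷ refl tt (epop∷ refl tt (epop∷ (V.lookup∘update certS w _) tt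
            (subst₂ (λ b w₁ → E 4 (if b then shift blank q' a m else skip) (store X Y cv w₁ t (i ∷ [] ∷ [] ∷ map tp l ∷ map tp r ∷ [] ∷ un n ∷ ρ))
                (simulating X Y cv t (w [ certS ]≔ γs) i (act blank (conf s l h r) q' a m) ([] ∷ un n ∷ ρ)))
              (sym eq₂) (sym (V.[]≔-idempotent w certS))
              (exec-shift X Y cv t (w [ certS ]≔ γs) i blank s l h r ([] ∷ un n ∷ ρ) q' a m (λ _ → tt))))))) e) , v
      go n (tok ∷ γs) = ends n _ γs refl
      go n (inn _ ∷ γs) = ends n _ γs refl
      go n (out _ ∷ γs) = ends n _ γs refl
      go n (bit _ ∷ γs) = ends n _ γs refl
      go n (flag _ ∷ γs) = ends n _ γs refl
      go n (st _ ∷ γs) = ends n _ γs refl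
      go n (tp _ ∷ γs) = ends n _ γs refl
      tick : ∀ n → Done n γs (ticks n (conf s l h r) γs)
      tick (suc n) = go n γs
      tick zero = entered γs 0 , weak (≤-trans (s≤s (s≤s (s≤s (s≤s z≤n)))) (*-monoʳ-≤ 8 (s≤s (z≤n {length γs}))))
        (eloop∷ refl tt (enter γs 0 (epop[] refl eskip)) (eloop[] refl)) , refl

    module _ (w : Vec (List Γₘ) W) (i : List Γₘ) where
      private
        clocked : Vec ℕ 4 → Store
        clocked v = store X Y cv w t (i ∷ [] ∷ [] ∷ [] ∷ [] ∷ [] ∷ V.map un v)

      open Registers stacks tok (λ j → ds (suc (suc (suc (suc (suc (suc j))))))) clocked
        (λ j v → V.lookup-map j un v)
        (λ j v m → cong (λ r → store X Y cv w t (i ∷ [] ∷ [] ∷ [] ∷ [] ∷ [] ∷ r)) (sym (V.map-[]≔ un v j)))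
        using (rpush; rloop; rloop0)

      private
        r0 r1 r2 r3 : Fin 4
        r0 = zero
        r1 = suc zero
        r2 = suc (suc zero)
        r3 = suc (suc (suc zero))

        regs : ℕ → ℕ → ℕ → ℕ → Store
        regs a b c d = clocked (a ∷ b ∷ c ∷ d ∷ [])

        spread gather copies restore : Cmd Name Γₘ
        spread = loop ODO' (λ _ → push AGAIN tok ⨾ push CARRY tok)
        gather = loop AGAIN (λ _ → push ODO' tok)
        copies = loop CLOCK (λ _ → spread ⨾ gather)
        restore = loop CARRY (λ _ → push CLOCK tok)

        exec-spread : ∀ n a b o → E (suc (n * 3)) spread (regs a n b o) (regs a 0 (n + b) (n + o))
        exec-spread zero a b o = rloop0 r1 refl
        exec-spread (suc n) a b o = rloop r1 refl (eseq (rpush r2) (rpush r3))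
          (subst₂ (λ p q → E (suc (n * 3)) spread (regs a n (suc b) (suc o)) (regs a 0 p q)) (+-suc n b) (+-suc n o) (exec-spread n a (suc b) (suc o)))

        exec-gather : ∀ b a n o → E (suc (b * 2)) gather (regs a n b o) (regs a (b + n) 0 o)
        exec-gather zero a n o = rloop0 r2 refl
        exec-gather (suc b) a n o = rloop r2 refl (rpush r1)
          (subst (λ p → E (suc (b * 2)) gather (regs a (suc n) b o) (regs a p 0 o)) (+-suc b n) (exec-gather b a (suc n) o))

        exec-copies : ∀ N a o → E (suc (a * suc (suc (N * 3) + suc (N * 2)))) copies (regs a N 0 o) (regs 0 N 0 (a * N + o))
        exec-copies N zero o = rloop0 r0 refl
        exec-copies N (suc a) o = weak (≤-reflexive (cong suc (+-suc (suc (N * 3) + suc (N * 2)) (a * suc (suc (N * 3) + suc (N * 2))))))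
          (rloop r0 refl
            (eseq (exec-spread N a 0 o) (subst₂ (λ p q → E (suc (N * 2)) gather (regs a 0 p (N + o)) (regs a q 0 (N + o)))
              (sym (+-identityʳ N)) (+-identityʳ N) (exec-gather N a 0 (N + o))))
            (subst (λ p → E (suc (a * suc (suc (N * 3) + suc (N * 2)))) copies (regs a N 0 (N + o)) (regs 0 N 0 p)) (eq₁ a N o) (exec-copies N a (N + o))))
          where
          eq₁ : ∀ a N o → a * N + (N + o) ≡ (N + a * N) + o
          eq₁ = solve-∀

        exec-restore : ∀ o a N → E (suc (o * 2)) restore (regs a N 0 o) (regs (o + a) N 0 0)
        exec-restore zero a N = rloop0 r3 refl
        exec-restore (suc o) a N = rloop r3 refl (rpush r0)
          (subst (λ p → E (suc (o * 2)) restore (regs (suc a) N 0 o) (regs p N 0 0)) (+-suc o a) (exec-restore o (suc a) N))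

      private
        exec-multiply : ∀ a N → E (mulTime a N) multiply (regs a N 0 0) (regs (a * N) N 0 0)
        exec-multiply a N = eseq (subst (λ p → E (suc (a * suc (suc (N * 3) + suc (N * 2)))) copies (regs a N 0 0) (regs 0 N 0 p)) (+-identityʳ (a * N)) (exec-copies N a 0))
          (subst (λ p → E (suc (a * N * 2)) restore (regs 0 N 0 (a * N)) (regs p N 0 0)) (+-identityʳ (a * N)) (exec-restore (a * N) 0 N))

        exec-power : ∀ d a N → E (powTime d a N) (power d) (regs a N 0 0) (regs (a * N ^ d) N 0 0)
        exec-power zero a N = subst (λ p → E 1 skip (regs a N 0 0) (regs p N 0 0)) (sym (*-identityʳ a)) eskip
        exec-power (suc d) a N = eseq (exec-multiply a N)
          (subst (λ p → E (powTime d (a * N) N) (power d) (regs (a * N) N 0 0) (regs p N 0 0)) (*-assoc a N (N ^ d)) (exec-power d (a * N) N))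

        exec-pushes : ∀ c a N → E (suc c) (pushes c) (regs a N 0 0) (regs (c + a) N 0 0)
        exec-pushes zero a N = eskip
        exec-pushes (suc c) a N = eseq (rpush r0)
          (subst (λ p → E (suc c) (pushes c) (regs (suc a) N 0 0) (regs p N 0 0)) (+-suc c a) (exec-pushes c (suc a) N))

      exec-clock : ∀ n → E (suc c₀ + powTime d₀ c₀ (suc n)) (pushes c₀ ⨾ power d₀) (regs 0 (suc n) 0 0) (regs (poly c₀ d₀ n) (suc n) 0 0)
      exec-clock n = eseq (subst (λ p → E (suc c₀) (pushes c₀) (regs 0 (suc n) 0 0) (regs p (suc n) 0 0)) (+-identityʳ c₀) (exec-pushes c₀ 0 (suc n)))
        (exec-power d₀ c₀ (suc n))

      measured : Vec (List Γₘ) W → List Γₘ → List Γₘ → Store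
      measured w l k = store X Y cv w t (i ∷ [] ∷ [] ∷ l ∷ [] ∷ [] ∷ [] ∷ k ∷ [] ∷ [] ∷ [])

      measureTime : ℕ → ℕ
      measureTime n = suc (n * 3) + (suc (n * 2) + 1)

      exec-measure : ∀ z → lookup w outS ≡ z → E (measureTime (length z)) measure (regs 0 0 0 0) (regs 0 (suc (length z)) 0 0)
      exec-measure z e = eseq
        (subst₂ (λ w₁ k → E (suc (length z * 3)) loop₁ (measured w₁ [] []) (measured (w [ outS ]≔ []) (z ʳ++ []) k))
          (trans (cong (w [ outS ]≔_) (sym e)) (V.[]≔-lookup w outS)) (cong un (+-identityʳ (length z))) (out₁ z [] 0))
        (eseq (subst₂ (λ n w₁ → E (suc (n * 2)) loop₂ (measured (w [ outS ]≔ []) (z ʳ++ []) (un (length z))) (measured w₁ [] (un (length z))))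
            (trans (length-ʳ++ z) (+-identityʳ (length z)))
            (trans (cong (w [ outS ]≔_) (trans (trans (ʳ++-ʳ++ z) (++-identityʳ z)) (sym e))) (V.[]≔-lookup w outS))
            (back₁ (z ʳ++ []) [] (un (length z))))
          (epush tt))
        where
        loop₁ loop₂ : Cmd Name Γₘ
        loop₁ = loop (ws outS) (λ a → push ODO' tok ⨾ push LFT a)
        loop₂ = loop LFT (λ a → push (ws outS) a)
        out₁ : ∀ z l k → E (suc (length z * 3)) loop₁ (measured (w [ outS ]≔ z) l (un k)) (measured (w [ outS ]≔ []) (z ʳ++ l) (un (length z + k)))
        out₁ [] l k = eloop[] (V.lookup∘update outS w [])
        out₁ (a ∷ z) l k = eloop∷ (V.lookup∘update outS w _) tt (eseq (epush tt) (epush tt))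
          (subst₂ (λ w₁ n → E (suc (length z * 3)) loop₁ (measured w₁ (a ∷ l) (un (suc k))) (measured (w [ outS ]≔ []) (z ʳ++ (a ∷ l)) (un n)))
            (sym (V.[]≔-idempotent w outS)) (+-suc (length z) k) (out₁ z (a ∷ l) (suc k)))
        back₁ : ∀ l z k → E (suc (length l * 2)) loop₂ (measured (w [ outS ]≔ z) l k) (measured (w [ outS ]≔ (l ʳ++ z)) [] k)
        back₁ [] z k = eloop[] refl
        back₁ (a ∷ l) z k = eloop∷ refl tt (epush tt)
          (subst (λ w₁ → E (suc (length l * 2)) loop₂ (measured w₁ l k) (measured (w [ outS ]≔ (l ʳ++ (a ∷ z))) [] k))
            (sym (trans (V.[]≔-idempotent w outS) (cong (λ z → w [ outS ]≔ (a ∷ z)) (V.lookup∘update outS w z)))) (back₁ l (a ∷ z) k))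

  simTime : ℕ → ℕ → ℕ
  simTime n m = suc (n * 3) + (suc (n * 2) + 1) + ((suc c₀ + powTime d₀ c₀ (suc n)) + ((4 + n * 2) + 8 * suc m))

  private
    Outcome : List (Fin k₁) → List Γₘ → Set
    Outcome x c = Σ ℕ λ t → Σ Store λ s' → Σ Bool λ b → E t main (initially (input x) c) s' × get RES s' ≡ verdict b × (b ≡ true →
      Σ (List (Fin k₂)) λ y → R x y × AcceptsIn (poly c₀ d₀ (length y)) (ninit M y))

    exec-reject : ∀ x c → lookup (result Q G x c) okS ≡ [] →
      Σ Store λ s' → E (prepareTime (length x) + 2) main (initially (input x) c) s' × get RES s' ≡ []
    exec-reject x c e = let (X , ex) = exec-prepare x c in _ , eseq ex (epop[] e eskip) , refl

    exec-main : ∀ x c y {a l} → lookup (result Q G x c) okS ≡ a ∷ l → lookup (result Q G x c) outS ≡ reverse (map out y) →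
      let γs = lookup (result Q G x c) certS in
      Σ Store λ s' → E (prepareTime (length x) + suc (simTime (length y) (length γs))) main (initially (input x) c) s' ×
        get RES s' ≡ verdict (accepts (poly c₀ d₀ (length y)) (ninit M y) γs)
    exec-main x c y {a} {l} e o =
      let (X , ex) = exec-prepare x c
          w₀ = result Q G x c
          v = V.map un (proj₁ (sem (prog Q G) (map inn x) (start₀ Q G c)))
          w₁ = w₀ [ okS ]≔ l
          o₁ = trans (V.lookup∘update′ (okS≢outS ∘ sym) w₀ l) o
          n = length y
          len = trans (length-reverse (map out y)) (length-map out y)
          em = exec-measure X empty v empty w₁ [] (reverse (map out y)) o₁
          ec = exec-clock X empty v empty w₁ [] n
          el = exec-loadTape X empty v empty inp blank start w₁ [] ([] ∷ un (poly c₀ d₀ n) ∷ un (suc n) ∷ [] ∷ [] ∷ []) y o₁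
          γs = lookup w₀ certS
          cert₁ = trans (V.lookup∘update′ (outS≢certS ∘ sym) w₁ []) (V.lookup∘update′ (okS≢certS ∘ sym) w₀ l)
          (s' , es , r) = exec-sim X empty v empty (poly c₀ d₀ n) γs (w₁ [ outS ]≔ []) [] (ninit M y) (un (suc n) ∷ [] ∷ [] ∷ [])
          es' = subst (λ w → E (8 * suc (length γs)) (loop ST sim) (simulating X empty v empty w [] (ninit M y) ([] ∷ un (poly c₀ d₀ n) ∷ un (suc n) ∷ [] ∷ [] ∷ [])) s')
                  (trans (cong (w₁ [ outS ]≔ [] [ certS ]≔_) (sym cert₁)) (V.[]≔-lookup (w₁ [ outS ]≔ []) certS)) es
          start₁ = store X empty v w₁ empty ([] ∷ [] ∷ [] ∷ [] ∷ [] ∷ [] ∷ [] ∷ [] ∷ [] ∷ [] ∷ [])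
          em' = subst (λ n → E (suc (n * 3) + (suc (n * 2) + 1)) measure start₁ (store X empty v w₁ empty ([] ∷ [] ∷ [] ∷ [] ∷ [] ∷ [] ∷ [] ∷ un (suc n) ∷ [] ∷ [] ∷ []))) len em
      in s' , eseq ex (epop∷ e tt (eseq em' (eseq ec (eseq el es')))) , r

    view : (l : List Γₘ) → l ≡ [] ⊎ (Σ Γₘ λ a → Σ (List Γₘ) λ l' → l ≡ a ∷ l')
    view [] = inj₁ refl
    view (a ∷ l) = inj₂ (a , l , refl)

    outcome : ∀ x c → Outcome x c
    outcome x c = go (view (lookup (result Q G x c) okS))
      where
      go : _ → Outcome x c
      go (inj₁ e) = let (s' , ex , r) = exec-reject x c e in _ , s' , false , ex , r , λ ()
      go (inj₂ (a , l , e)) =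
        let (y , Rxy , o) = sound Q G x c e
            (s' , ex , r) = exec-main x c y e o
        in _ , s' , _ , ex , r , λ ac → y , Rxy , accepts-sound _ _ (lookup (result Q G x c) certS) ac

    outBound : ℕ → ℕ
    outBound n = n + n * n + prepareTime n

    -- A selector promises no bound on the length of `y`. But `y` is found on a stack after a
    -- polynomial number of instructions, and stacks grow no faster than time.
    bounded-out : ∀ x y → R x y → length y ≤ outBound (length x)
    bounded-out x y Rxy =
      let (bs , le , f) = complete Q G x y Rxy
          c = map bit bs ++ []
          n = length x
          (X , ex) = exec-prepare x c
          lc = ≤-reflexive (trans (cong length (++-identityʳ (map bit bs))) (length-map bit bs))
          h = heights-init x c (n + n * n) (m≤m+n n _) (≤-trans lc (≤-trans le (m≤n+m _ n)))
          (_ , h') = exec-bounded stacks ex h ≤-refl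
          (_ , o , _) = f []
      in subst (_≤ outBound n) (trans (cong length o) (trans (length-reverse (map out y)) (length-map out y))) (h' (ws outS))

    certBound totalTime : ℕ → ℕ
    certBound n = n * n + poly c₀ d₀ (outBound n)
    totalTime n = prepareTime n + suc (simTime (outBound n) (poly c₀ d₀ (outBound n)))

    poly-outBound : Poly outBound
    poly-outBound = poly-+ (poly-+ poly-id (poly-* poly-id poly-id)) poly-prepareTime

    poly-mulTime : ∀ {a N} → Poly a → Poly N → Poly (λ n → mulTime (a n) (N n))
    poly-mulTime a N = poly-+
      (poly-suc (poly-* a (poly-suc (poly-+ (poly-suc (poly-* N (poly-const 3))) (poly-suc (poly-* N (poly-const 2)))))))
      (poly-suc (poly-* (poly-* a N) (poly-const 2)))

    poly-powTime : ∀ d {a N} → Poly a → Poly N → Poly (λ n → powTime d (a n) (N n))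
    poly-powTime zero a N = poly-const 1
    poly-powTime (suc d) a N = poly-+ (poly-mulTime a N) (poly-powTime d (poly-* a N) N)

    poly-simTime : ∀ {f m} → Poly f → Poly m → Poly (λ n → simTime (f n) (m n))
    poly-simTime f m = poly-+ (poly-+ (poly-suc (poly-* f (poly-const 3))) (poly-+ (poly-suc (poly-* f (poly-const 2))) (poly-const 1)))
      (poly-+ (poly-+ (poly-const (suc c₀)) (poly-powTime d₀ (poly-const c₀) (poly-suc f)))
        (poly-+ (poly-+ (poly-const 4) (poly-* f (poly-const 2))) (poly-* (poly-const 8) (poly-suc m))))

    mulTime-mono : ∀ {a a' N N'} → a ≤ a' → N ≤ N' → mulTime a N ≤ mulTime a' N'
    mulTime-mono a N = +-mono-≤
      (s≤s (*-mono-≤ a (s≤s (+-mono-≤ (s≤s (*-monoˡ-≤ 3 N)) (s≤s (*-monoˡ-≤ 2 N))))))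
      (s≤s (*-monoˡ-≤ 2 (*-mono-≤ a N)))

    powTime-mono : ∀ d {a a' N N'} → a ≤ a' → N ≤ N' → powTime d a N ≤ powTime d a' N'
    powTime-mono zero a N = ≤-refl
    powTime-mono (suc d) a N = +-mono-≤ (mulTime-mono a N) (powTime-mono d (*-mono-≤ a N) N)

    simTime-mono : ∀ {n n' m m'} → n ≤ n' → m ≤ m' → simTime n m ≤ simTime n' m'
    simTime-mono n m = +-mono-≤ (+-mono-≤ (s≤s (*-monoˡ-≤ 3 n)) (+-monoˡ-≤ 1 (s≤s (*-monoˡ-≤ 2 n))))
      (+-mono-≤ (+-monoʳ-≤ (suc c₀) (powTime-mono d₀ {c₀} ≤-refl (s≤s n)))
        (+-mono-≤ (+-monoʳ-≤ 4 (*-monoˡ-≤ 2 n)) (*-monoʳ-≤ 8 (s≤s m))))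

    -- The certificate consists of the bits that select `y` followed by the moves of an accepting
    -- run on `y`.
    witness : ∀ x y → R x y → AcceptsIn (poly c₀ d₀ (length y)) (ninit M y) →
      Σ (List Γₘ) λ c → Σ Store λ s' → length c ≤ certBound (length x) ×
        E (totalTime (length x)) main (initially (input x) c) s' × get RES s' ≡ verdict true
    witness x y Rxy (m , c' , mP , r , ac) =
      let (bs , le , f) = complete Q G x y Rxy
          n = length x
          yB = bounded-out x y Rxy
          PB = poly-mono c₀ d₀ yB
          (γs , γm , acc) = accepts-complete mP r ac
          c = map bit bs ++ γs
          ((a , l , e) , o , ce) = f γs
          (s' , ex , v) = exec-main x c y e o
          γB = ≤-trans (≤-trans γm mP) PB
      in c , s' ,
         ≤-trans (≤-reflexive (trans (length-++ (map bit bs)) (cong (_+ length γs) (length-map bit bs)))) (+-mono-≤ le γB) ,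
         weak (+-monoʳ-≤ (prepareTime n) (s≤s (simTime-mono yB (subst (λ l → length l ≤ poly c₀ d₀ (outBound n)) (sym ce) γB)))) ex ,
         trans v (cong verdict (trans (cong (accepts (poly c₀ d₀ (length y)) (ninit M y)) ce) acc))

  closed : (L : Language k₁) (L' : Language k₂) → (∀ y → L' y ⇔ AcceptsIn (poly c₀ d₀ (length y)) (ninit M y)) →
    (∀ x → L x ⇔ (Σ (List (Fin k₂)) λ y → R x y × L' y)) → InNP L
  closed L L' M≈L' L⇔ = inNP L certBound totalTime
    (poly-+ (poly-* poly-id poly-id) (poly-poly c₀ d₀ poly-outBound))
    (poly-+ poly-prepareTime (poly-suc (poly-simTime poly-outBound (poly-poly c₀ d₀ poly-outBound))))
    (λ x c → let (t , s' , b , ex , r , acc) = outcome x c in t , s' , b , ex , r ,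
      λ e → let (y , Rxy , ac) = acc e in Equivalence.from (L⇔ x) (y , Rxy , Equivalence.from (M≈L' y) ac))
    (λ x l → let (y , Rxy , l') = Equivalence.to (L⇔ x) l in witness x y Rxy (Equivalence.to (M≈L' y) l'))

InNP-closed : ∀ {k₁ k₂ R} → Selector k₁ k₂ R → (L : Language k₁) (L' : Language k₂) →
  (∀ x → L x ⇔ (Σ (List (Fin k₂)) λ y → R x y × L' y)) → InNP L' → InNP L
InNP-closed Sel L L' L⇔ (M , c , d , M≈L') = NPDriver.closed Sel M c d L L' M≈L' L⇔

-- Enumerating the bit strings of a given length

next-bits : List Bool → Maybe (List Bool)
next-bits [] = nothing
next-bits (false ∷ bs) = just (true ∷ bs)
next-bits (true ∷ bs) = maybe (λ bs' → just (false ∷ bs')) nothing (next-bits bs)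

data Chain : List Bool → List (List Bool) → Set where
  last : ∀ {bs} → next-bits bs ≡ nothing → Chain bs (bs ∷ [])
  more : ∀ {bs bs' l} → next-bits bs ≡ just bs' → Chain bs' l → Chain bs (bs ∷ l)

-- With the least significant bit first, counting through strings of length n + 1 visits each string
-- of length n twice in a row, preceded by `false` and then by `true`.
doubled : List (List Bool) → List (List Bool)
doubled [] = []
doubled (bs ∷ l) = (false ∷ bs) ∷ (true ∷ bs) ∷ doubled l

chain-doubled : ∀ {bs l} → Chain bs l → Chain (false ∷ bs) (doubled l)
chain-doubled (last e) = more refl (last (cong (maybe (λ bs' → just (false ∷ bs')) nothing) e))
chain-doubled (more e c) = more refl (more (cong (maybe (λ bs' → just (false ∷ bs')) nothing) e) (chain-doubled c))

∈-doubled : ∀ {bs l} b → bs ∈ l → (b ∷ bs) ∈ doubled l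
∈-doubled false (first refl) = first refl
∈-doubled true  (first refl) = later (first refl)
∈-doubled b (later m) = later (later (∈-doubled b m))

bit-strings : ℕ → List (List Bool)
bit-strings zero = [] ∷ []
bit-strings (suc n) = doubled (bit-strings n)

chain-bit-strings : ∀ n → Chain (replicate n false) (bit-strings n)
chain-bit-strings zero = last refl
chain-bit-strings (suc n) = chain-doubled (chain-bit-strings n)

∈-bit-strings : ∀ bs → bs ∈ bit-strings (length bs)
∈-bit-strings [] = first refl
∈-bit-strings (b ∷ bs) = ∈-doubled b (∈-bit-strings bs)

-- Polynomial space: an odometer runs through all certificates.

module PSPACEDriver {k₁ k₂ : ℕ} {R : List (Fin k₁) → List (Fin k₂) → Set} (Sel : Selector k₁ k₂ R) (M : DTM k₂) (c₀ d₀ : ℕ) where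
  open Selector Sel
  open DTM M
  open Driver Sel Q G renaming (Γ to Γₘ)

  simHead : Fin Q → Maybe Γₘ → Cmd Name Γₘ
  simHead s (just (tp h)) = shift blank (proj₁ (δ s h)) (proj₁ (proj₂ (δ s h))) (proj₂ (proj₂ (δ s h)))
  simHead s _ = skip

  -- `RES` collects the disjunction of the verdicts of all attempts. Popping before pushing keeps
  -- its height at most one through exponentially many of them.
  sim : Γₘ → Cmd Name Γₘ
  sim (st s) = if halted M s then (if does (s F.≟ accept) then pop RES (λ _ → push RES tok) else skip) else pop HD (simHead s)
  sim _      = skip

  -- Sets the width of the odometer to |x|². The two nested loops use the two levels that `2 + D`
  -- guarantees.
  squares : ∀ {d} → Prog Γₘ C W (2 + d)
  squares = for λ _ → for λ _ → emit certS (bit false)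

  copyBits : Cmd Name Γₘ
  copyBits = loop ODO (λ a → push ODO' a) ⨾ loop ODO' (λ a → push ODO a ⨾ push (ws certS) a)

  -- `CARRY` is refilled as long as a carry propagates. On overflow nothing is pushed onto `AGAIN`,
  -- and thereby the outer search ends.
  carry : Maybe Γₘ → Cmd Name Γₘ
  carry (just (bit true))  = push ODO' (bit false) ⨾ push CARRY tok
  carry (just (bit false)) = push ODO (bit true) ⨾ push AGAIN tok
  carry _                  = skip

  increment : Cmd Name Γₘ
  increment = push CARRY tok ⨾ loop CARRY (λ _ → pop ODO carry) ⨾ loop ODO' (λ a → push ODO a)

  clears : ∀ {n} → (Fin n → Name) → Cmd Name Γₘ
  clears {zero}  ν = skip
  clears {suc n} ν = loop (ν zero) (λ _ → skip) ⨾ clears (ν ∘ suc)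

  -- All attempts work on the same stacks, so each has to remove what it leaves behind. The copies
  -- of the input are rebuilt by the loops themselves.
  cleanup : Cmd Name Γₘ
  cleanup = clears ws ⨾ clears cs ⨾ loop HD (λ _ → skip) ⨾ loop LFT (λ _ → skip) ⨾ loop RGT (λ _ → skip)

  attempt : Cmd Name Γₘ
  attempt = (copyBits ⨾ tr (prog Q G) id) ⨾ pop (ws okS) (maybe (λ _ → loadTape inp blank start ⨾ loop ST sim) skip) ⨾ cleanup

  setup : Cmd Name Γₘ
  setup = loadInput ⨾ tr squares id ⨾ loop (ws certS) (λ a → push ODO a) ⨾ push AGAIN tok

  main : Cmd Name Γₘ
  main = setup ⨾ loop AGAIN (λ _ → attempt ⨾ increment)

  open Program finSym inputStorage main RES tok inn using (verdict; input; inPSPACE; heights-init; length-input)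

  Low : ∀ {n} → ℕ → Vec (List Γₘ) n → Set
  Low m v = ∀ i → length (lookup v i) ≤ m

  low-∷ : ∀ {n m l} {v : Vec (List Γₘ) n} → length l ≤ m → Low m v → Low m (l ∷ v)
  low-∷ le h zero = le
  low-∷ le h (suc i) = h i

  low-empty : ∀ {n m} → Low m (empty {n})
  low-empty {m = m} i = subst (λ l → length l ≤ m) (sym (V.lookup-replicate i [])) z≤n

  low-zeros : ∀ {m} → Low m zeros
  low-zeros {m} i = subst (λ l → length l ≤ m) (sym (trans (V.lookup-map i un (V.replicate C 0)) (cong un (V.lookup-replicate i 0)))) z≤n

  heights : ∀ {m X Y c w t r} → Low m X → Low m Y → Low m c → Low m w → Low m t → Low m r → Heights stacks m (store X Y c w t r)
  heights X Y c w t r (xs i) = X i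
  heights X Y c w t r (ys i) = Y i
  heights X Y c w t r (cs i) = c i
  heights X Y c w t r (ws i) = w i
  heights X Y c w t r (ts i) = t i
  heights X Y c w t r (ds i) = r i

  -- The time is hidden: over all attempts it may be exponential, and only the heights count.
  ExecIn : ℕ → Cmd Name Γₘ → Store → Store → Set
  ExecIn B c s s' = Σ ℕ λ t → Exec stacks (_≤ B) t c s s'

  _⨾ᵉ_ : ∀ {B c d s s' s''} → ExecIn B c s s' → ExecIn B d s' s'' → ExecIn B (c ⨾ d) s s''
  (t , e) ⨾ᵉ (t' , e') = t + t' , eseq e e'
  infixr 5 _⨾ᵉ_

  module Clear (B m : ℕ) (mB : m ≤ B) {N : ℕ} (emb : Vec (List Γₘ) N → Store) (ν : Fin N → Name)
    (get-ν : ∀ i v → get (ν i) (emb v) ≡ lookup v i) (set-ν : ∀ i l v → set (ν i) l (emb v) ≡ emb (v [ i ]≔ l)) where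

    low-set : ∀ (v : Vec (List Γₘ) N) i l → length l ≤ m → Low m v → Low m (v [ i ]≔ l)
    low-set v i l le h j with j F.≟ i
    ... | yes refl = subst (λ l → length l ≤ m) (sym (V.lookup∘update j v l)) le
    ... | no ne = subst (λ l → length l ≤ m) (sym (V.lookup∘update′ ne v l)) (h j)

    clear-one : ∀ i l v → lookup v i ≡ l → Low m v → ExecIn B (loop (ν i) (λ _ → skip)) (emb v) (emb (v [ i ]≔ []))
    clear-one i [] v e h = 1 , subst (λ u → Exec stacks (_≤ B) 1 (loop (ν i) (λ _ → skip)) (emb v) (emb u))
      (sym (trans (cong (v [ i ]≔_) (sym e)) (V.[]≔-lookup v i))) (eloop[] (trans (get-ν i v) e))
    clear-one i (a ∷ l) v e h =
      let lm = subst (λ l → length l ≤ m) e (h i)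
          (t , ex) = clear-one i l (v [ i ]≔ l) (V.lookup∘update i v l) (low-set v i l (≤-trans (n≤1+n _) lm) h)
      in suc (1 + t) , subst (λ u → Exec stacks (_≤ B) (suc (1 + t)) (loop (ν i) (λ _ → skip)) (emb v) (emb u)) (V.[]≔-idempotent v i)
        (eloop∷ (trans (get-ν i v) e) (≤-trans lm mB) eskip
          (subst (λ s → Exec stacks (_≤ B) t (loop (ν i) (λ _ → skip)) s (emb (v [ i ]≔ l [ i ]≔ []))) (sym (set-ν i l v)) ex))

    clear-some : ∀ {n} (ι : Fin n → Fin N) v → Low m v → Σ (Vec (List Γₘ) N) λ v' →
      ExecIn B (clears (ν ∘ ι)) (emb v) (emb v') × (∀ i → lookup v' (ι i) ≡ []) × (∀ j → lookup v j ≡ [] → lookup v' j ≡ [])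
    clear-some {zero} ι v h = v , (1 , eskip) , (λ ()) , λ j e → e
    clear-some {suc n} ι v h =
      let (v' , e , hit , keep) = clear-some (ι ∘ suc) (v [ ι zero ]≔ []) (low-set v (ι zero) [] z≤n h)
      in v' , clear-one (ι zero) (lookup v (ι zero)) v refl h ⨾ᵉ e ,
         (λ { zero → keep (ι zero) (V.lookup∘update (ι zero) v []) ; (suc i) → hit i }) ,
         λ j e → keep j (kept j e (j F.≟ ι zero))
      where
      kept : ∀ j → lookup v j ≡ [] → Dec (j ≡ ι zero) → lookup (v [ ι zero ]≔ []) j ≡ []
      kept j e (yes refl) = V.lookup∘update j v []
      kept j e (no ne) = trans (V.lookup∘update′ ne v []) e

    clear-all : ∀ v → Low m v → ExecIn B (clears ν) (emb v) (emb empty)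
    clear-all v h =
      let (v' , e , hit , _) = clear-some id v h
      in subst (λ u → ExecIn B (clears ν) (emb v) (emb u)) (vec-ext λ i → trans (hit i) (sym (V.lookup-replicate i []))) e

  zeros≡empty : zeros ≡ empty
  zeros≡empty = vec-ext λ i → trans (trans (V.lookup-map i un (V.replicate C 0)) (cong un (V.lookup-replicate i 0))) (sym (V.lookup-replicate i []))

  module _ (B m : ℕ) (mB : m ≤ B) (X Y : Vec (List Γₘ) (2 + D)) (t : Vec (List Γₘ) 3) where

    exec-cleanup : ∀ c w i s h l r ρ → Low m c → Low m w → length h ≤ m → length l ≤ m → length r ≤ m →
      ExecIn B cleanup (store X Y c w t (i ∷ s ∷ h ∷ l ∷ r ∷ ρ)) (store X Y zeros empty t (i ∷ s ∷ [] ∷ [] ∷ [] ∷ ρ))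
    exec-cleanup c w i s h l r ρ lc lw lh ll lr =
      Clear.clear-all B m mB (λ w → store X Y c w t (i ∷ s ∷ h ∷ l ∷ r ∷ ρ)) ws (λ _ _ → refl) (λ _ _ _ → refl) w lw ⨾ᵉ
      subst (λ z → ExecIn B (clears cs) (store X Y c empty t (i ∷ s ∷ h ∷ l ∷ r ∷ ρ)) (store X Y z empty t (i ∷ s ∷ h ∷ l ∷ r ∷ ρ))) (sym zeros≡empty)
        (Clear.clear-all B m mB (λ c → store X Y c empty t (i ∷ s ∷ h ∷ l ∷ r ∷ ρ)) cs (λ _ _ → refl) (λ _ _ _ → refl) c lc) ⨾ᵉ
      clearH h (≤-trans lh mB) ⨾ᵉ clearL l (≤-trans ll mB) ⨾ᵉ clearR r (≤-trans lr mB)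
      where
      clearH : ∀ h → length h ≤ B → ExecIn B (loop HD (λ _ → skip)) (store X Y zeros empty t (i ∷ s ∷ h ∷ l ∷ r ∷ ρ)) (store X Y zeros empty t (i ∷ s ∷ [] ∷ l ∷ r ∷ ρ))
      clearH [] le = 1 , eloop[] refl
      clearH (a ∷ h) le = _ , eloop∷ refl le eskip (proj₂ (clearH h (≤-trans (n≤1+n _) le)))
      clearL : ∀ l → length l ≤ B → ExecIn B (loop LFT (λ _ → skip)) (store X Y zeros empty t (i ∷ s ∷ [] ∷ l ∷ r ∷ ρ)) (store X Y zeros empty t (i ∷ s ∷ [] ∷ [] ∷ r ∷ ρ))
      clearL [] le = 1 , eloop[] refl
      clearL (a ∷ h) le = _ , eloop∷ refl le eskip (proj₂ (clearL h (≤-trans (n≤1+n _) le)))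
      clearR : ∀ r → length r ≤ B → ExecIn B (loop RGT (λ _ → skip)) (store X Y zeros empty t (i ∷ s ∷ [] ∷ [] ∷ r ∷ ρ)) (store X Y zeros empty t (i ∷ s ∷ [] ∷ [] ∷ [] ∷ ρ))
      clearR [] le = 1 , eloop[] refl
      clearR (a ∷ h) le = _ , eloop∷ refl le eskip (proj₂ (clearR h (≤-trans (n≤1+n _) le)))

  isAccept : Fin Q → Bool
  isAccept s = does (s F.≟ accept)

  module _ (B S : ℕ) (SB : S ≤ B) (1B : 1 ≤ B) (X Y : Vec (List Γₘ) (2 + D)) (c : Vec (List Γₘ) C) (w : Vec (List Γₘ) W) (t : Vec (List Γₘ) 3) where

    Stopped : Config Q G → Bool → Bool → List Γₘ → Vec (List Γₘ) 4 → Set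
    Stopped cf r r' i ρ = Σ (Fin G) λ h → Σ (List (Fin G)) λ l → Σ (List (Fin G)) λ r₁ → length l ≤ S × length r₁ ≤ S ×
      ExecIn B (loop ST sim) (simulating X Y c t w i cf (verdict r ∷ ρ)) (store X Y c w t (i ∷ [] ∷ (tp h ∷ []) ∷ map tp l ∷ map tp r₁ ∷ verdict r' ∷ ρ))

    exec-sim : ∀ n cf r i ρ → (∀ j → j ≤ n → space (drun M j cf) ≤ S) → halted M (state (drun M n cf)) ≡ true →
      Stopped cf r (isAccept (state (drun M n cf)) ∨ r) i ρ
    stop-sim : ∀ cf r i ρ → space cf ≤ S → halted M (state cf) ≡ true → Stopped cf r (isAccept (state cf) ∨ r) i ρ

    exec-sim zero cf r i ρ sp hl = stop-sim cf r i ρ (sp 0 z≤n) hl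
    exec-sim (suc n) cf@(conf s l h rt) r i ρ sp hl = by (halted M s) refl
     where
     by : ∀ b → halted M s ≡ b → Stopped cf r (isAccept (state (drun M (suc n) cf)) ∨ r) i ρ
     -- A halted configuration is a fixed point of `dstep`, so stopping here gives the state that
     -- the run has at step `suc n`.
     by true hs = subst (λ cf' → Stopped cf r (isAccept (state cf') ∨ r) i ρ) (sym (fixed (suc n))) (stop-sim cf r i ρ (sp 0 z≤n) hs)
      where
      fixed : ∀ n → drun M n cf ≡ cf
      fixed zero = refl
      fixed (suc n) = trans (cong (drun M n) (cong (λ b → if b then cf else act blank cf (proj₁ (δ s h)) (proj₁ (proj₂ (δ s h))) (proj₂ (proj₂ (δ s h)))) hs)) (fixed n)
     by false hs = let (h' , l' , r' , ll , lr , e) = later-on in h' , l' , r' , ll , lr ,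
        (_ , eloop∷ refl 1B (subst (λ b → Exec stacks (_≤ B) 5 (if b then (if isAccept s then pop RES (λ _ → push RES tok) else skip) else pop HD (simHead s))
            (store X Y c w t (i ∷ [] ∷ (tp h ∷ []) ∷ map tp l ∷ map tp rt ∷ verdict r ∷ ρ)) (simulating X Y c t w i cf₁ (verdict r ∷ ρ))) (sym hs)
          (epop∷ refl 1B (exec-shift X Y c t w i blank s l h rt (verdict r ∷ ρ) _ _ _ λ le → ≤-trans le (≤-trans (sp 0 z≤n) SB))))
        (proj₂ e))
      where
      cf₁ : Config Q G
      cf₁ = act blank cf (proj₁ (δ s h)) (proj₁ (proj₂ (δ s h))) (proj₂ (proj₂ (δ s h)))
      moves : dstep M cf ≡ cf₁
      moves = cong (λ b → if b then cf else cf₁) hs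
      later-on : Stopped cf₁ r (isAccept (state (drun M n (dstep M cf))) ∨ r) i ρ
      later-on = subst (λ cf' → Stopped cf₁ r (isAccept (state (drun M n cf')) ∨ r) i ρ) (sym moves)
        (exec-sim n cf₁ r i ρ (λ j le → subst (λ cf' → space (drun M j cf') ≤ S) moves (sp (suc j) (s≤s le)))
          (subst (λ cf' → halted M (state (drun M n cf')) ≡ true) moves hl))

    stop-sim cf@(conf s l h rt) r i ρ sp hl = h , l , rt , ≤-trans (m≤m+n _ _) sp , ≤-trans (≤-trans (n≤1+n _) (m≤n+m _ (length l))) sp ,
      (_ , eloop∷ refl 1B (subst (λ b → Exec stacks (_≤ B) 2 (if b then (if isAccept s then pop RES (λ _ → push RES tok) else skip) else pop HD (simHead s))
        (at r) (at (isAccept s ∨ r))) (sym hl) (note (isAccept s) r)) (eloop[] refl))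
      where
      at : Bool → Store
      at b = store X Y c w t (i ∷ [] ∷ (tp h ∷ []) ∷ map tp l ∷ map tp rt ∷ verdict b ∷ ρ)
      note : ∀ a r → Exec stacks (_≤ B) 2 (if a then pop RES (λ _ → push RES tok) else skip) (at r) (at (a ∨ r))
      note true true = epop∷ refl 1B (epush z≤n)
      note true false = epop[] refl (epush z≤n)
      note false r = weak (s≤s z≤n) eskip

  -- Height bounds: `m₀` between attempts, `m₁` after the selection, `m₂` after loading the tape,
  -- each later one adding the time of its phase. The simulation has no useful time bound and
  -- contributes the space of the simulated machine on a word of length at most `m₁` in its place.
  progressTime incTime sqTime setupTime m₀ m₁ m₂ simSpace spaceBound : ℕ → ℕ
  m₀ n = n + n * n + 1
  progressTime n = (suc (n * n * 2) + suc (n * n * 3)) + progTime n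
  m₁ n = m₀ n + progressTime n
  m₂ n = m₁ n + (4 + m₁ n * 2)
  simSpace n = poly c₀ d₀ (m₁ n)
  incTime n = 1 + ((4 * (n * n) + 5) + suc (n * n * 2))
  sqTime n = time finSym (squares {D}) n (incs finSym (squares {D}) n)
  setupTime n = loadTime n + (sqTime n + (suc (n * n * 2) + 1))
  spaceBound n = (m₂ n + simSpace n + 1) + ((m₀ n + incTime n) + (m₀ n + setupTime n))

  poly-spaceBound : Poly spaceBound
  poly-spaceBound = poly-+ (poly-+ (poly-+ p₂ (poly-poly c₀ d₀ p₁)) (poly-const 1)) (poly-+ (poly-+ p₀ pI) (poly-+ p₀ pS))
    where
    pN : Poly (λ n → n * n)
    pN = poly-* poly-id poly-id
    p₀ : Poly m₀
    p₀ = poly-+ (poly-+ poly-id pN) (poly-const 1)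
    p₁ : Poly m₁
    p₁ = poly-+ p₀ (poly-+ (poly-+ (poly-suc (poly-* pN (poly-const 2))) (poly-suc (poly-* pN (poly-const 3)))) poly-progTime)
    p₂ : Poly m₂
    p₂ = poly-+ p₁ (poly-+ (poly-const 4) (poly-* p₁ (poly-const 2)))
    pI : Poly incTime
    pI = poly-suc (poly-+ (poly-+ (poly-* (poly-const 4) pN) (poly-const 5)) (poly-suc (poly-* pN (poly-const 2))))
    pS : Poly setupTime
    pS = poly-+ (poly-suc (poly-* poly-id (poly-const (5 + D))))
      (poly-+ (poly-time finSym (squares {D}) (poly-incs finSym (squares {D})))
        (poly-+ (poly-suc (poly-* pN (poly-const 2))) (poly-const 1)))

  -- `k` holds the low bits already processed, in reverse. After an overflow the search is over, so
  -- the final contents of the odometer are left unspecified.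
  Incremented : Maybe (List Bool) → List Γₘ → List Bool → List Bool → Set
  Incremented nothing    a z k = a ≡ []
  Incremented (just bs') a z k = a ≡ tok ∷ [] × z ≡ k ʳ++ bs'

  module _ (X : Vec (List Γₘ) (2 + D)) where

    full : Vec (List Γₘ) W → Bool → List Γₘ → List Γₘ → List Γₘ → List Γₘ → Store
    full w r o o' a c = store X empty zeros w empty ([] ∷ [] ∷ [] ∷ [] ∷ [] ∷ verdict r ∷ o ∷ o' ∷ a ∷ c ∷ [])

    inv : List Bool → Bool → List Γₘ → Store
    inv bs r a = full empty r (map bit bs) [] a []

    exec-carry : ∀ r bs k → Σ (List Bool) λ k' → Σ (List Bool) λ o' → Σ (List Γₘ) λ a → length k' ≤ length k + length bs ×
      E (4 * length bs + 5) (loop CARRY (λ _ → pop ODO carry)) (full empty r (map bit bs) (map bit k) [] (tok ∷ [])) (full empty r (map bit o') (map bit k') a []) ×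
      Incremented (next-bits bs) a (k' ʳ++ o') k
    exec-carry r [] k = k , [] , [] , ≤-reflexive (sym (+-identityʳ _)) ,
      weak (s≤s (s≤s (s≤s (s≤s z≤n)))) (eloop∷ refl tt (epop[] refl eskip) (eloop[] refl)) , refl
    exec-carry r (false ∷ bs) k = k , true ∷ bs , tok ∷ [] , m≤m+n _ _ ,
      weak (m≤n+m 5 (4 * suc (length bs))) (eloop∷ refl tt (epop∷ refl tt (eseq (epush tt) (epush tt))) (eloop[] refl)) , refl , refl
    exec-carry r (true ∷ bs) k =
      let (k' , o' , a , le , e , i) = exec-carry r bs (false ∷ k)
      in k' , o' , a , ≤-trans le (≤-reflexive (sym (+-suc (length k) (length bs)))) ,
         weak (≤-reflexive (sym (cong (_+ 5) (*-suc 4 (length bs))))) (eloop∷ refl tt (epop∷ refl tt (eseq (epush tt) (epush tt))) e) ,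
         lift (next-bits bs) i
      where
      lift : ∀ {a z} m → Incremented m a z (false ∷ k) → Incremented (maybe (λ bs' → just (false ∷ bs')) nothing m) a z k
      lift nothing i = i
      lift (just _) i = i

    exec-increment : ∀ r bs → Σ (List Bool) λ bs' → Σ (List Γₘ) λ a →
      E (1 + ((4 * length bs + 5) + suc (length bs * 2))) increment (inv bs r []) (inv bs' r a) × Incremented (next-bits bs) a bs' []
    exec-increment r bs =
      let (k' , o' , a , le , e , i) = exec-carry r bs []
      in k' ʳ++ o' , a , eseq (epush tt) (eseq e (weak (s≤s (*-monoˡ-≤ 2 le)) (back k' o' a))) , i
      where
      back : ∀ k o a → E (suc (length k * 2)) (loop ODO' (λ a → push ODO a)) (full empty r (map bit o) (map bit k) a []) (inv (k ʳ++ o) r a)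
      back [] o a = eloop[] refl
      back (b ∷ k) o a = eloop∷ refl tt (epush tt) (back k (b ∷ o) a)

    exec-copyBits : ∀ r bs → E (suc (length bs * 2) + suc (length bs * 3)) copyBits (inv bs r []) (full (empty [ certS ]≔ map bit bs) r (map bit bs) [] [] [])
    exec-copyBits r bs = eseq (there₁ bs [])
      (subst₂ (λ n z → E (suc (n * 3)) loop₂ (full empty r [] (map bit (bs ʳ++ [])) [] []) (full (empty [ certS ]≔ map bit z) r (map bit z) [] [] []))
        (trans (length-ʳ++ bs) (+-identityʳ _)) (trans (ʳ++-ʳ++ bs) (++-identityʳ bs))
        (subst (λ w → E (suc (length (bs ʳ++ []) * 3)) loop₂ (full w r [] (map bit (bs ʳ++ [])) [] [])
            (full (empty [ certS ]≔ map bit ((bs ʳ++ []) ʳ++ [])) r (map bit ((bs ʳ++ []) ʳ++ [])) [] [] []))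
          (trans (cong (empty [ certS ]≔_) (sym (V.lookup-replicate certS []))) (V.[]≔-lookup empty certS))
          (back (bs ʳ++ []) [])))
      where
      loop₁ loop₂ : Cmd Name Γₘ
      loop₁ = loop ODO (λ a → push ODO' a)
      loop₂ = loop ODO' (λ a → push ODO a ⨾ push (ws certS) a)
      there₁ : ∀ bs k → E (suc (length bs * 2)) loop₁ (full empty r (map bit bs) (map bit k) [] []) (full empty r [] (map bit (bs ʳ++ k)) [] [])
      there₁ [] k = eloop[] refl
      there₁ (b ∷ bs) k = eloop∷ refl tt (epush tt) (there₁ bs (b ∷ k))
      back : ∀ k o → E (suc (length k * 3)) loop₂ (full (empty [ certS ]≔ map bit o) r (map bit o) (map bit k) [] [])
        (full (empty [ certS ]≔ map bit (k ʳ++ o)) r (map bit (k ʳ++ o)) [] [] [])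
      back [] o = eloop[] refl
      back (b ∷ k) o = eloop∷ refl tt (eseq (epush tt) (epush tt))
        (subst (λ w → E (suc (length k * 3)) loop₂ (full w r (bit b ∷ map bit o) (map bit k) [] []) (full (empty [ certS ]≔ map bit (k ʳ++ (b ∷ o))) r (map bit (k ʳ++ (b ∷ o))) [] [] []))
          (sym (trans (V.[]≔-idempotent empty certS) (cong (λ l → empty [ certS ]≔ (bit b ∷ l)) (V.lookup∘update certS empty (map bit o)))))
          (back k (b ∷ o)))

  private
    SpaceBounded : List (Fin k₂) → Bool → ℕ → Set
    SpaceBounded y b n = (∀ i → i ≤ n → space (drun M i (dinit M y)) ≤ poly c₀ d₀ (length y)) ×
      halted M (state (drun M n (dinit M y))) ≡ true × isAccept (state (drun M n (dinit M y))) ≡ b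

    view : (l : List Γₘ) → l ≡ [] ⊎ (Σ Γₘ λ a → Σ (List Γₘ) λ l' → l ≡ a ∷ l')
    view [] = inj₁ refl
    view (a ∷ l) = inj₂ (a , l , refl)

  module _ (x : List (Fin k₁)) (X : Vec (List Γₘ) (2 + D)) (hX : ∀ i → lookup X i ≡ map inn x) where
    private
      n B : ℕ
      n = length x
      B = spaceBound n

      m₂B : m₂ n + simSpace n + 1 ≤ B
      m₂B = m≤m+n _ _

      m₁m₂ : m₁ n ≤ m₂ n
      m₁m₂ = m≤m+n (m₁ n) _

      m₁B : m₁ n ≤ B
      m₁B = ≤-trans (≤-trans (≤-trans m₁m₂ (m≤m+n _ (simSpace n))) (m≤m+n _ 1)) m₂B

      1B : 1 ≤ B
      1B = ≤-trans (m≤n+m 1 (m₂ n + simSpace n)) m₂B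

    low-X : ∀ {m} → n ≤ m → Low m X
    low-X {m} le i = subst (λ l → length l ≤ m) (sym (hX i)) (subst (_≤ m) (sym (length-map inn x)) le)

    heights-inv : ∀ bs r a → length bs ≡ n * n → length a ≤ 1 → Heights stacks (m₀ n) (inv X bs r a)
    heights-inv bs r a lb la = heights (low-X (≤-trans (m≤m+n n (n * n)) (m≤m+n _ 1))) low-empty low-zeros low-empty low-empty
      (low-∷ z≤n (low-∷ z≤n (low-∷ z≤n (low-∷ z≤n (low-∷ z≤n (low-∷ (≤-trans (one r) (m≤n+m 1 _))
        (low-∷ (≤-trans (≤-reflexive (trans (length-map bit bs) lb)) (≤-trans (m≤n+m _ n) (m≤m+n _ 1)))
          (low-∷ z≤n (low-∷ (≤-trans la (m≤n+m 1 _)) (low-∷ z≤n λ ()))))))))))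
      where
      one : ∀ r → length (verdict r) ≤ 1
      one true = s≤s z≤n
      one false = z≤n

    final : List Bool → Vec (List Γₘ) W
    final bs = result Q G x (map bit bs)

    private
      counts : List Bool → Vec (List Γₘ) C
      counts bs = V.map un (proj₁ (sem (prog Q G) (map inn x) (start₀ Q G (map bit bs))))

      odo : List Bool → Bool → Vec (List Γₘ) 5
      odo bs r = verdict r ∷ map bit bs ∷ [] ∷ [] ∷ [] ∷ []

      selected : ∀ bs r → length bs ≡ n * n →
        let s = store X empty (counts bs) (final bs) empty ([] ∷ [] ∷ [] ∷ [] ∷ [] ∷ odo bs r) in
        ExecIn B (copyBits ⨾ tr (prog Q G) id) (inv X bs r []) s × Heights stacks (m₁ n) s
      selected bs r lb =
        let (e , h) = exec-bounded stacks (eseq (subst (λ n → E (suc (n * 2) + suc (n * 3)) copyBits (inv X bs r []) (full X (empty [ certS ]≔ map bit bs) r (map bit bs) [] [] [])) lb (exec-copyBits X r bs))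
              (exec-prog x (map bit bs) X _ hX)) (heights-inv bs r [] lb z≤n) m₁B
        in (_ , e) , h

    attempt-reject : ∀ bs r → length bs ≡ n * n → lookup (final bs) okS ≡ [] → ExecIn B attempt (inv X bs r []) (inv X bs r [])
    attempt-reject bs r lb e =
      let (ex , h) = selected bs r lb
      in ex ⨾ᵉ (_ , epop[] e eskip) ⨾ᵉ
         exec-cleanup B (m₁ n) m₁B X empty empty (counts bs) (final bs) [] [] [] [] [] (odo bs r) (h ∘ cs) (h ∘ ws) z≤n z≤n z≤n

    attempt-run : ∀ bs r → length bs ≡ n * n → ∀ y {a l} → lookup (final bs) okS ≡ a ∷ l → lookup (final bs) outS ≡ reverse (map out y) →
      ∀ {b k} → SpaceBounded y b k → ExecIn B attempt (inv X bs r []) (inv X bs (b ∨ r) [])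
    attempt-run bs r lb y {a} {l} e o {b} {k} (sp , hl , acc) =
      let (ex , h) = selected bs r lb
          w₁ = final bs [ okS ]≔ l
          -- The selected word lies on `outS`, so the height bound after the selection also bounds
          -- its length.
          ly = subst (_≤ m₁ n) (trans (cong length o) (trans (length-reverse (map out y)) (length-map out y))) (h (ws outS))
          ll = subst (λ l → length l ≤ m₁ n) e (h (ws okS))
          o₁ = trans (V.lookup∘update′ (okS≢outS ∘ sym) (final bs) l) o
          (el , h₂) = exec-bounded stacks (weak (+-monoʳ-≤ 4 (*-monoˡ-≤ 2 ly)) (exec-loadTape X empty (counts bs) empty inp blank start w₁ [] (odo bs r) y o₁))
                  (heights-set stacks (ws okS) l (≤-trans (n≤1+n _) ll) h) (≤-trans (≤-trans (m≤m+n (m₂ n) (simSpace n)) (m≤m+n _ 1)) m₂B)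
          (hd' , l' , r' , l'S , r'S , es) = exec-sim B (simSpace n) (≤-trans (≤-trans (m≤n+m _ (m₂ n)) (m≤m+n _ 1)) m₂B) 1B X empty (counts bs) (w₁ [ outS ]≔ []) empty
                  k (dinit M y) r [] (map bit bs ∷ [] ∷ [] ∷ [] ∷ []) (λ i le → ≤-trans (sp i le) (poly-mono c₀ d₀ ly)) hl
          mc = m₂ n + simSpace n + 1
          m₂mc = ≤-trans (m≤m+n (m₂ n) (simSpace n)) (m≤m+n _ 1)
          Smc = ≤-trans (m≤n+m (simSpace n) (m₂ n)) (m≤m+n _ 1)
          ec = exec-cleanup B mc m₂B X empty empty (counts bs) (w₁ [ outS ]≔ []) [] [] (tp hd' ∷ []) (map tp l') (map tp r')
                 (odo bs (isAccept (state (drun M k (dinit M y))) ∨ r))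
                 (λ i → ≤-trans (h₂ (cs i)) m₂mc) (λ i → ≤-trans (h₂ (ws i)) m₂mc) (m≤n+m 1 _)
                 (≤-trans (≤-reflexive (length-map tp l')) (≤-trans l'S Smc)) (≤-trans (≤-reflexive (length-map tp r')) (≤-trans r'S Smc))
      in subst (λ b → ExecIn B attempt (inv X bs r []) (inv X bs (b ∨ r) [])) acc
        (ex ⨾ᵉ (_ , epop∷ e (≤-trans ll m₁B) (eseq el (proj₂ es))) ⨾ᵉ ec)

    module _ (decide : ∀ y → Σ Bool λ b → ∃ λ k → SpaceBounded y b k) where

      hit : List Bool → Bool
      hit bs with view (lookup (final bs) okS)
      ... | inj₁ _ = false
      ... | inj₂ (a , l , e) = proj₁ (decide (proj₁ (sound Q G x (map bit bs) e)))

      exec-attempt : ∀ bs r → length bs ≡ n * n → ExecIn B attempt (inv X bs r []) (inv X bs (hit bs ∨ r) [])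
      exec-attempt bs r lb with view (lookup (final bs) okS)
      ... | inj₁ e = attempt-reject bs r lb e
      ... | inj₂ (a , l , e) with sound Q G x (map bit bs) e
      ... | y , _ , o = attempt-run bs r lb y e o (proj₂ (proj₂ (decide y)))

      hit-sound : ∀ bs → hit bs ≡ true → Σ (List (Fin k₂)) λ y → R x y × proj₁ (decide y) ≡ true
      hit-sound bs h with view (lookup (final bs) okS)
      ... | inj₂ (a , l , e) with sound Q G x (map bit bs) e
      ... | y , Rxy , _ = y , Rxy , h

      hit-complete : ∀ bs y {a l} → lookup (final bs) okS ≡ a ∷ l → lookup (final bs) outS ≡ reverse (map out y) →
        proj₁ (decide y) ≡ true → hit bs ≡ true
      hit-complete bs y e o d with view (lookup (final bs) okS)
      ... | inj₁ e' = case trans (sym e) e' of λ ()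
      ... | inj₂ (a , l , e') with sound Q G x (map bit bs) e'
      -- The word that `sound` provides may be obtained differently, but it equals `y` because both
      -- are read off the same stack.
      ... | y' , _ , o' = subst (λ y → proj₁ (decide y) ≡ true) (map-injective (λ { refl → refl }) (reverse-injective (trans (sym o) o'))) d

      hits : Bool → List (List Bool) → Bool
      hits r [] = r
      hits r (bs ∷ l) = hits (hit bs ∨ r) l

      hits-sound : ∀ r l → hits r l ≡ true → r ≡ true ⊎ ∃ λ bs → hit bs ≡ true
      hits-sound r [] e = inj₁ e
      hits-sound r (bs ∷ l) e with hits-sound (hit bs ∨ r) l e
      ... | inj₂ h = inj₂ h
      ... | inj₁ h with hit bs in eb
      ... | true = inj₂ (bs , eb)
      ... | false = inj₁ h

      hits-kept : ∀ l → hits true l ≡ true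
      hits-kept [] = refl
      hits-kept (bs ∷ l) = trans (cong (λ r → hits r l) (∨-zeroʳ (hit bs))) (hits-kept l)

      hits-complete : ∀ r l {bs} → bs ∈ l → hit bs ≡ true → hits r l ≡ true
      hits-complete r (bs ∷ l) (first refl) h = trans (cong (λ b → hits (b ∨ r) l) h) (hits-kept l)
      hits-complete r (bs ∷ l) (later m) h = hits-complete (hit bs ∨ r) l m h

      next-length : ∀ bs {bs'} → next-bits bs ≡ just bs' → length bs' ≡ length bs
      next-length (false ∷ bs) refl = refl
      next-length (true ∷ bs) e with next-bits bs in en
      next-length (true ∷ bs) refl | just bs' = cong suc (next-length bs en)

      increment-in : ∀ bs r → length bs ≡ n * n → Σ (List Bool) λ bs' → Σ (List Γₘ) λ a →
        ExecIn B increment (inv X bs r []) (inv X bs' r a) × Incremented (next-bits bs) a bs' []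
      increment-in bs r lb =
        let (bs' , a , e , i) = exec-increment X r bs
            e' = subst (λ N → E (1 + ((4 * N + 5) + suc (N * 2))) increment (inv X bs r []) (inv X bs' r a)) lb e
        in bs' , a , (_ , proj₁ (exec-bounded stacks e' (heights-inv bs r [] lb z≤n)
             (≤-trans (m≤m+n (m₀ n + incTime n) _) (m≤n+m _ (m₂ n + simSpace n + 1))))) , i

      -- Induction on the chain: after each attempt `AGAIN` is filled exactly when the chain has a
      -- next bit string.
      exec-search : ∀ {bs l} → Chain bs l → length bs ≡ n * n → ∀ r → Σ (List Bool) λ bs' →
        ExecIn B (loop AGAIN (λ _ → attempt ⨾ increment)) (inv X bs r (tok ∷ [])) (inv X bs' (hits r l) [])
      exec-search {bs} (last e) lb r with increment-in bs (hit bs ∨ r) lb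
      ... | bs' , a , ei , i with subst (λ m → Incremented m a bs' []) e i
      ... | refl = bs' , _ , eloop∷ refl 1B (proj₂ (exec-attempt bs r lb ⨾ᵉ ei)) (eloop[] refl)
      exec-search {bs} (more e c) lb r with increment-in bs (hit bs ∨ r) lb
      ... | bs' , a , ei , i with subst (λ m → Incremented m a bs' []) e i
      ... | refl , refl =
        let (bs'' , _ , es) = exec-search c (trans (next-length bs e) lb) (hit bs ∨ r)
        in bs'' , _ , eloop∷ refl 1B (proj₂ (exec-attempt bs r lb ⨾ᵉ ei)) es

  sem-squares : ∀ {d} y (v : Vec ℕ C) (w : Vec (List Γₘ) W) k →
    sem (squares {d}) y (v , w [ certS ]≔ replicate k (bit false)) ≡ (v , w [ certS ]≔ replicate (length y * length y + k) (bit false))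
  sem-squares {d} y v w k = outer y k
    where
    at : ℕ → State {Γₘ} {C} {W}
    at k = v , w [ certS ]≔ replicate k (bit false)
    one : Prog Γₘ C W d
    one = emit certS (bit false)
    inner : ∀ z k → foldl (λ s _ → sem one y s) (at k) z ≡ at (length z + k)
    inner [] k = refl
    inner (_ ∷ z) k = trans (cong (λ w → foldl (λ s _ → sem one y s) (v , w) z)
        (trans (V.[]≔-idempotent w certS) (cong (λ l → w [ certS ]≔ (bit false ∷ l)) (V.lookup∘update certS w _))))
      (trans (inner z (suc k)) (cong at (+-suc (length z) k)))
    outer : ∀ z k → foldl (λ s _ → foldl (λ s _ → sem one y s) s y) (at k) z ≡ at (length z * length y + k)
    outer [] k = refl
    outer (_ ∷ z) k = trans (cong (λ s → foldl (λ s _ → foldl (λ s _ → sem one y s) s y) s z) (inner y k))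
      (trans (outer z (length y + k)) (cong at (eq₁ (length z * length y) (length y) k)))
      where
      eq₁ : ∀ a b c → a + (b + c) ≡ b + a + c
      eq₁ = solve-∀

  exec-setup : ∀ x → Σ (Vec (List Γₘ) (2 + D)) λ X → (∀ i → lookup X i ≡ map inn x) ×
    E (setupTime (length x)) setup (initially (input x) []) (inv X (replicate (length x * length x) false) false (tok ∷ []))
  exec-setup x =
    let i = input x
        n = length x
        (X , e , h) = exec-loadInput empty zeros (empty [ certS ]≔ []) empty [] i empty empty (λ j → V.lookup-replicate j [])
        hX = λ j → trans (h j) (trans (ʳ++-defn i) (trans (++-identityʳ _) (reverse-involutive (map inn x))))
        n' = length (map (inn {k₁} {k₂} {Q} {G}) x)
        n'≡ = length-map inn x
        e₂ = exec-tr empty (map inn x) (incs finSym (squares {D}) n') squares id id X empty hX (λ i → V.lookup-replicate i [])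
               (V.replicate C 0 , empty [ certS ]≔ []) (counters λ i → ≤-reflexive (V.lookup-replicate i 0)) ≤-refl
        e₂' = subst₂ (λ n s → E (sqTime n) (tr squares id) (store X empty zeros (empty [ certS ]≔ []) empty empty) s) n'≡
                (trans (cong (running empty (map inn x) (incs finSym (squares {D}) n') X empty) (sem-squares {D} (map inn x) (V.replicate C 0) empty 0))
                       (cong (λ m → full X (empty [ certS ]≔ replicate m (bit false)) false [] [] [] []) (trans (+-identityʳ (n' * n')) (cong₂ _*_ n'≡ n'≡))))
                e₂
        e₃ = move X (n * n) 0
    in X , hX , eseq (subst (λ n → E (loadTime n) loadInput (initially i []) (store X empty zeros (empty [ certS ]≔ []) empty empty)) (length-input x) e)
         (eseq e₂' (eseq (subst₂ (λ w m → E (suc (n * n * 2)) (loop (ws certS) (λ a → push ODO a))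
                (full X (empty [ certS ]≔ replicate (n * n) (bit false)) false [] [] [] [])
                (full X w false (map bit (replicate m false)) [] [] []))
              (trans (cong (empty [ certS ]≔_) (sym (V.lookup-replicate certS []))) (V.[]≔-lookup empty certS)) (+-identityʳ (n * n)) e₃)
           (epush tt)))
    where
    move : ∀ X m k → E (suc (m * 2)) (loop (ws certS) (λ a → push ODO a))
      (full X (empty [ certS ]≔ replicate m (bit false)) false (map bit (replicate k false)) [] [] [])
      (full X (empty [ certS ]≔ []) false (map bit (replicate (m + k) false)) [] [] [])
    move X zero k = eloop[] (V.lookup∘update certS empty [])
    move X (suc m) k = eloop∷ (V.lookup∘update certS empty _) tt (epush tt)
      (subst₂ (λ w j → E (suc (m * 2)) (loop (ws certS) (λ a → push ODO a)) (full X w false (map bit (replicate (suc k) false)) [] [] [])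
          (full X (empty [ certS ]≔ []) false (map bit (replicate j false)) [] [] []))
        (sym (V.[]≔-idempotent empty certS)) (+-suc m k) (move X m (suc k)))

  closed : (L : Language k₁) (L' : Language k₂) →
    (∀ y → Σ ℕ λ k → (∀ i → i ≤ k → space (drun M i (dinit M y)) ≤ poly c₀ d₀ (length y)) ×
      (halted M (state (drun M k (dinit M y))) ≡ true) × (L' y ⇔ (state (drun M k (dinit M y)) ≡ accept))) →
    (∀ x → L x ⇔ (Σ (List (Fin k₂)) λ y → R x y × L' y)) → InPSPACE L
  closed L L' M≈L' L⇔ = inPSPACE L spaceBound poly-spaceBound λ x →
    let n = length x
        (X , hX , es) = exec-setup x
        setup≤ = ≤-trans (m≤n+m (m₀ n + setupTime n) (m₀ n + incTime n)) (m≤n+m _ (m₂ n + simSpace n + 1))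
        (es' , _) = exec-bounded stacks es (heights-init x [] (m₀ n) (≤-trans (m≤m+n n (n * n)) (m≤m+n _ 1)) z≤n) setup≤
        (_ , _ , el) = exec-search x X hX decide (chain-bit-strings (n * n)) (length-replicate (n * n)) false
    in ≤-trans (≤-trans (m≤m+n n (n * n)) (m≤m+n _ 1)) (≤-trans (m≤m+n (m₀ n) _) setup≤) ,
       ≤-trans (m≤n+m 1 (n + n * n)) (≤-trans (m≤m+n (m₀ n) _) setup≤) ,
       _ , _ , hits x X hX decide false (bit-strings (n * n)) , eseq es' el , refl ,
       mk⇔ (to x X hX) (from x X hX)
    where
    decide : ∀ y → Σ Bool λ b → ∃ λ k → SpaceBounded y b k
    decide y = let (k , sp , hl , _) = M≈L' y in isAccept (state (drun M k (dinit M y))) , k , sp , hl , refl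

    decided : ∀ y → L' y → proj₁ (decide y) ≡ true
    decided y l = dec-true (state (drun M (proj₁ (M≈L' y)) (dinit M y)) F.≟ accept) (Equivalence.to (proj₂ (proj₂ (proj₂ (M≈L' y)))) l)

    undecided : ∀ y → proj₁ (decide y) ≡ true → L' y
    undecided y e with state (drun M (proj₁ (M≈L' y)) (dinit M y)) F.≟ accept
    ... | yes a = Equivalence.from (proj₂ (proj₂ (proj₂ (M≈L' y)))) a

    to : ∀ x X hX → L x → hits x X hX decide false (bit-strings (length x * length x)) ≡ true
    to x X hX l =
      let (y , Rxy , l') = Equivalence.to (L⇔ x) l
          (bs , le , f) = complete Q G x y Rxy
          -- The odometer shows strings of length |x|² only, whereas the selecting bits may be
          -- fewer. `complete` admits any continuation, so they may be padded.
          pad = replicate (length x * length x ∸ length bs) false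
          ((_ , _ , e) , o , _) = f (map bit pad)
          full≡ = sym (map-++ bit bs pad)
          lb = trans (length-++ bs) (trans (cong (length bs +_) (length-replicate _)) (m+[n∸m]≡n le))
      in hits-complete x X hX decide false _ (subst (λ m → (bs ++ pad) ∈ bit-strings m) lb (∈-bit-strings (bs ++ pad)))
           (hit-complete x X hX decide (bs ++ pad) y
             (trans (cong (λ c → lookup (result Q G x c) okS) (sym full≡)) e)
             (trans (cong (λ c → lookup (result Q G x c) outS) (sym full≡)) o) (decided y l'))

    from : ∀ x X hX → hits x X hX decide false (bit-strings (length x * length x)) ≡ true → L x
    from x X hX e with hits-sound x X hX decide false (bit-strings (length x * length x)) e
    ... | inj₂ (bs , h) = let (y , Rxy , d) = hit-sound x X hX decide bs h in Equivalence.from (L⇔ x) (y , Rxy , undecided y d)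

InPSPACE-closed : ∀ {k₁ k₂ R} → Selector k₁ k₂ R → (L : Language k₁) (L' : Language k₂) →
  (∀ x → L x ⇔ (Σ (List (Fin k₂)) λ y → R x y × L' y)) → InPSPACE L' → InPSPACE L
InPSPACE-closed Sel L L' L⇔ (M , c , d , M≈L') = PSPACEDriver.closed Sel M c d L L' M≈L' L⇔

-- Graphs with natural numbers as vertices

-- What can be read off an encoding before the vertices are checked against n. It also allows graphs
-- with different vertex types to be compared.
RawEdge : ℕ → Set
RawEdge k = ℕ × Fin k × ℕ

module _ {k : ℕ} where

  src tgt : RawEdge k → ℕ
  src (u , _ , _) = u
  tgt (_ , _ , v) = v

  raw : ∀ {n} → Fin n × Fin k × Fin n → RawEdge k
  raw (u , a , v) = toℕ u , a , toℕ v

  data Walk (E : List (RawEdge k)) : ℕ → ℕ → List (Fin k) → Set where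
    nil  : ∀ {v} → Walk E v v []
    cons : ∀ {u v w a y} → (u , a , v) ∈ E → Walk E v w y → Walk E u w (a ∷ y)

  walk-snoc : ∀ {E u v w a y} → Walk E u v y → (v , a , w) ∈ E → Walk E u w (y ++ [ a ])
  walk-snoc nil e = cons e nil
  walk-snoc (cons e' p) e = cons e' (walk-snoc p e)

  path-walk : ∀ {n} {E : List (Fin n × Fin k × Fin n)} {u w y} → Path E u w y → Walk (map raw E) (toℕ u) (toℕ w) y
  path-walk nil = nil
  path-walk (cons e p) = cons (∈-map⁺ raw e) (path-walk p)

  walk-path : ∀ {n} {E : List (Fin n × Fin k × Fin n)} {u' w' y} → Walk (map raw E) u' w' y →
    ∀ {u} → toℕ u ≡ u' → Σ (Fin n) λ w → toℕ w ≡ w' × Path E u w y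
  walk-path nil {u} e = u , e , nil
  walk-path {E = E} (cons e p) {u} eu with ∈-map⁻ raw e
  ... | (u₁ , a , v) , e∈ , refl with walk-path p {v} refl
  ... | w , ew , q = w , ew , cons (subst (λ u → (u , a , v) ∈ E) (sym (F.toℕ-injective eu)) e∈) q

  walk-path′ : ∀ {n} {E : List (Fin n × Fin k × Fin n)} {u w y} → Walk (map raw E) (toℕ u) (toℕ w) y → Path E u w y
  walk-path′ {E = E} {u} {y = y} p with walk-path p {u} refl
  ... | w , ew , q = subst (λ w → Path E u w y) (F.toℕ-injective ew) q

  AcyclicRaw : List (RawEdge k) → Set
  AcyclicRaw E = ∀ v a y → ¬ Walk E v v (a ∷ y)

  raw-acyclic : ∀ {n} {E : List (Fin n × Fin k × Fin n)} → AcyclicRaw (map raw E) → Acyclic E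
  raw-acyclic ac v a y p = ac (toℕ v) a y (path-walk p)

  module _ {n : ℕ} {E : List (Fin n × Fin k × Fin n)} where
    private
      visits : ∀ {u w y} → Path E u w y → Fin (suc (length y)) → Fin n
      visits {u} p zero = u
      visits (cons _ p) (suc i) = visits p i

      prefix : ∀ {u w y} (p : Path E u w y) i → Σ (List (Fin k)) λ y' → Path E u (visits p i) y'
      prefix p zero = [] , nil
      prefix (cons {a = a} e p) (suc i) = let (y' , q) = prefix p i in a ∷ y' , cons e q

      between : ∀ {u w y} (p : Path E u w y) i j → i F.< j → Σ (Fin k) λ a → Σ (List (Fin k)) λ y' → Path E (visits p i) (visits p j) (a ∷ y')
      between (cons {a = a} e p) zero (suc j) _ = let (y' , q) = prefix p j in a , y' , cons e q
      between (cons e p) (suc i) (suc j) (s≤s lt) = between p i j lt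

    -- A path with n or more edges has more than n vertex visits, so two of them coincide by the
    -- pigeonhole principle and enclose a cycle.
    acyclic-short : Acyclic E → ∀ {u w y} → Path E u w y → length y < n
    acyclic-short ac {y = y} p with n ≤? length y
    ... | no nle = ≰⇒> nle
    ... | yes le =
      let (i , j , lt , e) = F.pigeonhole (s≤s le) (visits p)
          (a , y' , q) = between p i j lt
      in ⊥-elim (ac (visits p i) a y' (subst (λ v → Path E (visits p i) v (a ∷ y')) (sym e) q))

  private
    Str : Set
    Str = List (Fin (suc (suc k)))

  encRaw : RawEdge k → Str
  encRaw (u , a , v) = unary u ++ sep# ∷ suc (suc a) ∷ unary v ++ [ sep# ]

  encodeRaw : ℕ → ℕ → ℕ → List (RawEdge k) → Str
  encodeRaw n s t E = unary n ++ sep# ∷ unary s ++ sep# ∷ unary t ++ sep# ∷ concatMap encRaw E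

  encode-raw : ∀ (I : Instance k) → encode I ≡ encodeRaw (Instance.n I) (toℕ (Instance.s I)) (toℕ (Instance.t I)) (map raw (Instance.edges I))
  encode-raw (inst n s t E) = cong (λ z → unary n ++ sep# ∷ unary (toℕ s) ++ sep# ∷ unary (toℕ t) ++ sep# ∷ z) (sym (concatMap-map encRaw raw E))

  encRaw-++ : ∀ u a v z → encRaw (u , a , v) ++ z ≡ unary u ++ sep# ∷ suc (suc a) ∷ unary v ++ sep# ∷ z
  encRaw-++ u a v z = trans (++-assoc (unary u) _ z) (cong (λ y → unary u ++ sep# ∷ suc (suc a) ∷ y) (++-assoc (unary v) [ sep# ] z))

  private
    unary-inj : ∀ m n {y z : Str} → unary m ++ sep# ∷ y ≡ unary n ++ sep# ∷ z → m ≡ n × y ≡ z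
    unary-inj zero zero refl = refl , refl
    unary-inj zero (suc n) ()
    unary-inj (suc m) zero ()
    unary-inj (suc m) (suc n) e = let (p , q) = unary-inj m n (∷-injectiveʳ e) in cong suc p , q

    nonempty : ∀ u (y : Str) → [] ≢ unary u ++ sep# ∷ y
    nonempty zero y ()
    nonempty (suc u) y ()

    suc²-injective : {a b : Fin k} → _≡_ {A = Fin (suc (suc k))} (suc (suc a)) (suc (suc b)) → a ≡ b
    suc²-injective refl = refl

    edges-inj : ∀ E E' → concatMap encRaw E ≡ concatMap encRaw E' → E ≡ E'
    edges-inj [] [] e = refl
    edges-inj [] ((u , a , v) ∷ E') e = ⊥-elim (nonempty u _ (trans e (encRaw-++ u a v _)))
    edges-inj ((u , a , v) ∷ E) [] e = ⊥-elim (nonempty u _ (trans (sym e) (encRaw-++ u a v _)))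
    edges-inj ((u , a , v) ∷ E) ((u' , a' , v') ∷ E') e =
      let (pu , e₁) = unary-inj u u' (trans (sym (encRaw-++ u a v _)) (trans e (encRaw-++ u' a' v' _)))
          (pv , e₂) = unary-inj v v' (∷-injectiveʳ e₁)
      in cong₂ _∷_ (cong₂ _,_ pu (cong₂ _,_ (suc²-injective (∷-injectiveˡ e₁)) pv)) (edges-inj E E' e₂)

  -- `DAGREACH` admits every instance with the given code. To reason about a reduction's output, the
  -- code has to determine the graph.
  encodeRaw-injective : ∀ {n s t E n' s' t' E'} → encodeRaw n s t E ≡ encodeRaw n' s' t' E' →
    n ≡ n' × s ≡ s' × t ≡ t' × E ≡ E'
  encodeRaw-injective {n} {s} {t} {E} {n'} {s'} {t'} {E'} e =
    let (p , e₁) = unary-inj n n' e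
        (q , e₂) = unary-inj s s' e₁
        (r , e₃) = unary-inj t t' e₂
    in p , q , r , edges-inj E E' e₃

  length-unary : ∀ n → length (unary {k} n) ≡ n
  length-unary zero = refl
  length-unary (suc n) = cong suc (length-unary n)

  edges-≤ : ∀ E → length E ≤ length (concatMap encRaw E)
  edges-≤ [] = z≤n
  edges-≤ ((u , a , v) ∷ E) = ≤-trans (s≤s (edges-≤ E)) (≤-trans (+-monoˡ-≤ _ (positive u)) (≤-reflexive (sym (length-++ (encRaw (u , a , v))))))
    where
    positive : ∀ u → 1 ≤ length (encRaw (u , a , v))
    positive zero = s≤s z≤n
    positive (suc u) = s≤s z≤n

  -- Here the unary encoding matters: a loop over the input has enough iterations to visit every
  -- vertex.
  vertices-≤ : ∀ n s t E → n ≤ length (encodeRaw n s t E)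
  vertices-≤ n s t E = ≤-trans (≤-trans (≤-reflexive (sym (length-unary n))) (m≤m+n _ _)) (≤-reflexive (sym (length-++ (unary n))))

  edges-≤-encode : ∀ n s t E → length E ≤ length (encodeRaw n s t E)
  edges-≤-encode n s t E = ≤-trans (edges-≤ E) (≤-trans (tail-≤ t (concatMap encRaw E)) (≤-trans (tail-≤ s _) (tail-≤ n _)))
    where
    tail-≤ : ∀ m (z : Str) → length z ≤ length (unary m ++ sep# ∷ z)
    tail-≤ zero z = n≤1+n _
    tail-≤ (suc m) z = ≤-trans (tail-≤ m z) (n≤1+n _)

  shiftEdge : ∀ {n} → Fin n × Fin k × Fin n → Fin (suc n) × Fin k × Fin (suc n)
  shiftEdge (u , a , v) = suc u , a , suc v

  lineEdges : (w : List (Fin k)) → List (Fin (suc (length w)) × Fin k × Fin (suc (length w)))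
  lineEdges [] = []
  lineEdges (a ∷ w) = (zero , a , suc zero) ∷ map shiftEdge (lineEdges w)

  line : List (Fin k) → Instance k
  line w = inst (suc (length w)) zero (fromℕ (length w)) (lineEdges w)

  lineRaw : ℕ → List (Fin k) → List (RawEdge k)
  lineRaw i [] = []
  lineRaw i (a ∷ w) = (i , a , suc i) ∷ lineRaw (suc i) w

  private
    raise : ℕ → RawEdge k → RawEdge k
    raise i (u , a , v) = i + u , a , i + v

    raised : ∀ i w → map (raise i ∘ raw) (lineEdges w) ≡ lineRaw i w
    raised i [] = refl
    raised i (a ∷ w) = cong₂ _∷_ (cong₂ _,_ (+-identityʳ i) (cong (a ,_) (+-comm i 1)))
      (trans (sym (map-∘ (lineEdges w))) (trans (map-cong (λ (u , a , v) → cong₂ _,_ (+-suc i (toℕ u)) (cong (a ,_) (+-suc i (toℕ v)))) (lineEdges w))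
        (raised (suc i) w)))

  raw-line : ∀ w → map raw (lineEdges w) ≡ lineRaw 0 w
  raw-line w = raised 0 w

  encode-line : ∀ w → encode (line w) ≡ encodeRaw (suc (length w)) 0 (length w) (lineRaw 0 w)
  encode-line w = trans (encode-raw (line w)) (cong₂ (encodeRaw (suc (length w)) 0) (F.toℕ-fromℕ (length w)) (raw-line w))

  private
    line-edge : ∀ {u a v} i w → (u , a , v) ∈ lineRaw i w → i ≤ u × v ≡ suc u
    line-edge i (a ∷ w) (first refl) = ≤-refl , refl
    line-edge i (a ∷ w) (later e) = let (le , p) = line-edge (suc i) w e in ≤-trans (n≤1+n i) le , p

    walk-length : ∀ {u v y} i w → Walk (lineRaw i w) u v y → v ≡ u + length y
    walk-length i w nil = sym (+-identityʳ _)
    walk-length i w (cons {u} {y = y'} e p) with line-edge i w e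
    ... | _ , refl = trans (walk-length i w p) (sym (+-suc u (length y')))

    -- Every edge leads to a larger vertex, so a walk that has left `i` never returns to use the
    -- edge out of `i`.
    walk-later : ∀ {u v y} i a w → i < u → Walk (lineRaw i (a ∷ w)) u v y → Walk (lineRaw (suc i) w) u v y
    walk-later i a w lt nil = nil
    walk-later i a w lt (cons (first refl) p) = ⊥-elim (<-irrefl refl lt)
    walk-later i a w lt (cons (later e) p) with line-edge (suc i) w e
    ... | _ , refl = cons e (walk-later i a w (m<n⇒m<1+n lt) p)

    walk-line : ∀ i w {v y} → v ≡ i + length w → Walk (lineRaw i w) i v y → y ≡ w
    walk-line i [] ev nil = refl
    walk-line i (a ∷ w) ev nil = ⊥-elim (m≢1+m+n i (trans ev (+-suc i (length w))))
    walk-line i (a ∷ w) ev (cons (first refl) p) = cong (a ∷_) (walk-line (suc i) w (trans ev (+-suc i (length w))) (walk-later i a w ≤-refl p))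
    walk-line i (a ∷ w) ev (cons (later e) p) = ⊥-elim (<-irrefl refl (proj₁ (line-edge (suc i) w e)))

    path-shift : ∀ {n} {E : List (Fin n × Fin k × Fin n)} {e u v y} → Path E u v y → Path (e ∷ map shiftEdge E) (suc u) (suc v) y
    path-shift nil = nil
    path-shift (cons e p) = cons (later (∈-map⁺ shiftEdge e)) (path-shift p)

  line-path : ∀ w → Path (lineEdges w) zero (fromℕ (length w)) w
  line-path [] = nil
  line-path (a ∷ w) = cons (first refl) (path-shift (line-path w))

  line-acyclic : ∀ w → Acyclic (lineEdges w)
  line-acyclic w v a y p with walk-length 0 w (subst (λ E → Walk E (toℕ v) (toℕ v) (a ∷ y)) (raw-line w) (path-walk p))
  ... | e = m≢1+m+n (toℕ v) (trans e (+-suc (toℕ v) (length y)))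

  line-yield : ∀ w (I : Instance k) → encode I ≡ encode (line w) → ∀ {y} → Path (Instance.edges I) (Instance.s I) (Instance.t I) y → y ≡ w
  line-yield w (inst n s t E) e {y} p
    with encodeRaw-injective {n} {toℕ s} {toℕ t} {map raw E} {suc (length w)} {0} {length w} {lineRaw 0 w}
      (trans (sym (encode-raw (inst n s t E))) (trans e (encode-line w)))
  ... | _ , es , et , eE = walk-line 0 w et (subst₂ (λ E s → Walk E s (toℕ t) y) eE es (path-walk p))

-- Testing acyclicity: an alive edge dies when no alive edge enters its source.  A cycle never dies,
-- and in an acyclic graph some edge dies in every round.

isEqual : Ord → Bool
isEqual equal = true
isEqual _     = false

compareℕ-equal : ∀ n → compareℕ n n ≡ equal
compareℕ-equal zero = refl
compareℕ-equal (suc n) = compareℕ-equal n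

isEqual⇒≡ : ∀ m n → isEqual (compareℕ m n) ≡ true → m ≡ n
isEqual⇒≡ zero zero e = refl
isEqual⇒≡ (suc m) (suc n) e = cong suc (isEqual⇒≡ m n e)

module _ {k : ℕ} where

  Marked : Set
  Marked = List (RawEdge k × Bool)

  entering : ℕ → Marked → ℕ
  entering p [] = 0
  entering p ((e , b) ∷ Z) = if b ∧ isEqual (compareℕ (tgt e) p) then suc (entering p Z) else entering p Z

  killEdge : ℕ → ℕ → RawEdge k × Bool → RawEdge k × Bool
  killEdge n p (e , b) = e , b ∧ not (isEqual (compareℕ n 0) ∧ isEqual (compareℕ (src e) p))

  kill : ℕ → Marked → Marked
  kill p Z = map (killEdge (entering p Z) p) Z

  kills : ℕ → ℕ → Marked → Marked
  kills zero p Z = Z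
  kills (suc m) p Z = kills m (suc p) (kill p Z)

  rounds : ℕ → ℕ → Marked → Marked
  rounds zero N Z = Z
  rounds (suc r) N Z = rounds r N (kills N 0 Z)

  alive : Marked → ℕ
  alive [] = 0
  alive ((e , b) ∷ Z) = if b then suc (alive Z) else alive Z

  kill-edges : ∀ p Z → map proj₁ (kill p Z) ≡ map proj₁ Z
  kill-edges p Z = sym (map-∘ Z)

  kills-edges : ∀ m p Z → map proj₁ (kills m p Z) ≡ map proj₁ Z
  kills-edges zero p Z = refl
  kills-edges (suc m) p Z = trans (kills-edges m (suc p) (kill p Z)) (kill-edges p Z)

  rounds-edges : ∀ r N Z → map proj₁ (rounds r N Z) ≡ map proj₁ Z
  rounds-edges zero N Z = refl
  rounds-edges (suc r) N Z = trans (rounds-edges r N (kills N 0 Z)) (kills-edges N 0 Z)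

  private
    entering-pos : ∀ {e Z} → (e , true) ∈ Z → entering (tgt e) Z ≢ 0
    entering-pos {e} (first refl) rewrite compareℕ-equal (tgt e) = λ ()
    entering-pos {e} {(e' , b) ∷ Z} (later m) with b ∧ isEqual (compareℕ (tgt e') (tgt e))
    ... | true = λ ()
    ... | false = entering-pos m

    entering-alive : ∀ p Z → entering p Z ≢ 0 → Σ (RawEdge k) λ e → (e , true) ∈ Z × tgt e ≡ p
    entering-alive p [] ne = ⊥-elim (ne refl)
    entering-alive p ((e , false) ∷ Z) ne = let (e' , m , q) = entering-alive p Z ne in e' , later m , q
    entering-alive p ((e , true) ∷ Z) ne with isEqual (compareℕ (tgt e) p) in i
    ... | true = e , first refl , isEqual⇒≡ (tgt e) p i
    ... | false = let (e' , m , q) = entering-alive p Z ne in e' , later m , q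

    unblocked : ∀ n → n ≢ 0 → isEqual (compareℕ n 0) ≡ false
    unblocked zero ne = ⊥-elim (ne refl)
    unblocked (suc n) ne = refl

    killEdge-or : ∀ n p Z → map (killEdge n p) Z ≡ Z ⊎ alive (map (killEdge n p) Z) < alive Z
    killEdge-or n p [] = inj₁ refl
    killEdge-or n p ((e , false) ∷ Z) with killEdge-or n p Z
    ... | inj₁ q = inj₁ (cong ((e , false) ∷_) q)
    ... | inj₂ q = inj₂ q
    killEdge-or n p ((e , true) ∷ Z) with isEqual (compareℕ n 0) ∧ isEqual (compareℕ (src e) p) | killEdge-or n p Z
    ... | false | inj₁ q = inj₁ (cong ((e , true) ∷_) q)
    ... | false | inj₂ q = inj₂ (s≤s q)
    ... | true  | inj₁ q = inj₂ (s≤s (≤-reflexive (cong alive q)))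
    ... | true  | inj₂ q = inj₂ (≤-trans q (n≤1+n _))

    kill-fixed : ∀ p Z {e} → kill p Z ≡ Z → (e , true) ∈ Z → src e ≡ p → entering p Z ≢ 0
    kill-fixed p Z {e} fx m refl en with fixed Z fx m
      where
      fixed : ∀ Y → map (killEdge (entering p Z) p) Y ≡ Y → (e , true) ∈ Y → killEdge (entering p Z) p (e , true) ≡ (e , true)
      fixed (_ ∷ Y) q (first refl) = ∷-injectiveˡ q
      fixed (_ ∷ Y) q (later m) = fixed Y (∷-injectiveʳ q) m
    ... | q rewrite en | compareℕ-equal (src e) = case q of λ ()

    -- If no stage of a round kills an edge, all its stages have worked on the same `Z`, and `Z` is
    -- fixed by the test at every vertex visited. Otherwise the number of alive edges drops.
    kills-or : ∀ m p Z → (∀ j → j < m → kill (p + j) Z ≡ Z) × kills m p Z ≡ Z ⊎ alive (kills m p Z) < alive Z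
    kills-or zero p Z = inj₁ ((λ j ()) , refl)
    kills-or (suc m) p Z with killEdge-or (entering p Z) p Z | kills-or m (suc p) (kill p Z)
    ... | inj₂ q | inj₂ q' = inj₂ (<-trans q' q)
    ... | inj₂ q | inj₁ (_ , f) = inj₂ (≤-trans (s≤s (≤-reflexive (cong alive f))) q)
    ... | inj₁ q | inj₂ q' = inj₂ (≤-trans q' (≤-reflexive (cong alive q)))
    ... | inj₁ q | inj₁ (g , f) = inj₁ (all , trans f q)
      where
      all : ∀ j → j < suc m → kill (p + j) Z ≡ Z
      all zero _ = trans (cong (λ p → kill p Z) (+-identityʳ p)) q
      all (suc j) (s≤s lt) = trans (cong (λ p → kill p Z) (+-suc p j)) (subst (λ Z' → kill (suc p + j) Z' ≡ Z') q (g j lt))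

    alive-pos : ∀ Z → alive Z ≢ 0 → Σ (RawEdge k) λ e → (e , true) ∈ Z
    alive-pos [] ne = ⊥-elim (ne refl)
    alive-pos ((e , true) ∷ Z) ne = e , first refl
    alive-pos ((e , false) ∷ Z) ne = let (e' , m) = alive-pos Z ne in e' , later m

    alive-∈ : ∀ {e} Z → (e , true) ∈ Z → alive Z ≢ 0
    alive-∈ (_ ∷ Z) (first refl) = λ ()
    alive-∈ ((_ , true) ∷ Z) (later m) = λ ()
    alive-∈ ((_ , false) ∷ Z) (later m) = alive-∈ Z m

  alive-≤ : ∀ Z → alive Z ≤ length Z
  alive-≤ [] = z≤n
  alive-≤ ((e , true) ∷ Z) = s≤s (alive-≤ Z)
  alive-≤ ((e , false) ∷ Z) = ≤-trans (alive-≤ Z) (n≤1+n _)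

  module _ {n : ℕ} {E : List (Fin n × Fin k × Fin n)} (ac : Acyclic E) (N : ℕ) (nN : n ≤ N) where
    private
      -- If a round had no effect, every alive edge would be entered by an alive edge. Following
      -- these edges backwards n times yields a walk of n + 1 edges, too long for an acyclic graph.
      progress : ∀ Z → map proj₁ Z ≡ map raw E → alive Z ≢ 0 → alive (kills N 0 Z) < alive Z
      progress Z eE ne with kills-or N 0 Z
      ... | inj₂ q = q
      ... | inj₁ (fx , _) = ⊥-elim (too-long (back n))
        where
        ∈E : ∀ {e b} → (e , b) ∈ Z → e ∈ map raw E
        ∈E {e} m = subst (e ∈_) eE (∈-map⁺ proj₁ m)
        vertex : ∀ {e} → e ∈ map raw E → Σ (Fin n) λ u → toℕ u ≡ src e
        vertex m with ∈-map⁻ raw m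
        ... | (u , _ , _) , _ , refl = u , refl
        Back : ℕ → Set
        Back m = Σ (RawEdge k) λ e → (e , true) ∈ Z × (Σ ℕ λ w → Σ (List (Fin k)) λ y → Walk (map raw E) (src e) w y × length y ≡ suc m)
        back : ∀ m → Back m
        back zero = let (e , m) = alive-pos Z ne in e , m , tgt e , _ , cons (∈E m) nil , refl
        back (suc m) =
          let (e , e∈ , w , y , p , l) = back m
              (u , eu) = vertex (∈E e∈)
              (e' , e'∈ , t) = entering-alive (src e) Z
                (kill-fixed (src e) Z (fx (src e) (≤-trans (subst (_< n) eu (F.toℕ<n u)) nN)) e∈ refl)
          in e' , e'∈ , w , _ , cons (∈E e'∈) (subst (λ v → Walk (map raw E) v w y) (sym t) p) , cong suc l
        too-long : Back n → ⊥
        too-long (e , e∈ , w , y , p , l) =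
          let (u , eu) = vertex (∈E e∈)
              (_ , _ , q) = walk-path p eu
          in <-irrefl refl (≤-trans (subst (_< n) l (acyclic-short ac q)) (n≤1+n n))

      die : ∀ r Z → map proj₁ Z ≡ map raw E → alive Z ≤ r → alive (rounds r N Z) ≡ 0
      die zero Z eE le = n≤0⇒n≡0 le
      die (suc r) Z eE le = die r (kills N 0 Z) (trans (kills-edges N 0 Z) eE) (shrink (alive Z ℕ.≟ 0))
        where
        shrink : Dec (alive Z ≡ 0) → alive (kills N 0 Z) ≤ r
        shrink (no ne) = ≤-pred (≤-trans (progress Z eE ne) le)
        shrink (yes e) with kills-or N 0 Z
        ... | inj₁ (_ , f) = ≤-trans (≤-reflexive (trans (cong alive f) e)) z≤n
        ... | inj₂ q = ⊥-elim (n≮0 (subst (alive (kills N 0 Z) <_) e q))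

    acyclic-dies : length E ≤ N → alive (rounds N N (map (_, true) (map raw E))) ≡ 0
    acyclic-dies le = die N (map (_, true) (map raw E)) (sym (map-∘id (map raw E)))
      (≤-trans (alive-≤ (map (_, true) (map raw E))) (≤-trans (≤-reflexive (trans (length-map (_, true) (map raw E)) (length-map raw E))) le))
      where
      map-∘id : ∀ (l : List (RawEdge k)) → l ≡ map proj₁ (map (_, true) l)
      map-∘id [] = refl
      map-∘id (x ∷ l) = cong (x ∷_) (map-∘id l)

  private
    -- A set of edges each of which is entered by an edge of the set. Once alive, such a set stays
    -- alive, since no source in it ever loses all its incoming edges.
    Backed : List (RawEdge k) → Set
    Backed C = ∀ {e} → e ∈ C → Σ (RawEdge k) λ e' → e' ∈ C × tgt e' ≡ src e

    Kept : List (RawEdge k) → Marked → Set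
    Kept C Z = ∀ {e} → e ∈ C → (e , true) ∈ Z

    kept-kill : ∀ {C} → Backed C → ∀ p {Z} → Kept C Z → Kept C (kill p Z)
    kept-kill bk p {Z} kp {e} m = subst (_∈ kill p Z) (cong (e ,_) survives) (∈-map⁺ (killEdge (entering p Z) p) (kp m))
      where
      survives : not (isEqual (compareℕ (entering p Z) 0) ∧ isEqual (compareℕ (src e) p)) ≡ true
      survives with isEqual (compareℕ (src e) p) in i
      ... | false = cong not (∧-zeroʳ _)
      ... | true with bk m
      ... | e' , m' , t = cong (λ b → not (b ∧ true)) (unblocked _ λ z → entering-pos (kp m') (trans (cong (λ p → entering p Z) (trans t (isEqual⇒≡ (src e) p i))) z))

    kept-kills : ∀ {C} → Backed C → ∀ m p {Z} → Kept C Z → Kept C (kills m p Z)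
    kept-kills bk zero p kp = kp
    kept-kills bk (suc m) p kp = kept-kills bk m (suc p) (kept-kill bk p kp)

    kept-rounds : ∀ {C} → Backed C → ∀ r N {Z} → Kept C Z → Kept C (rounds r N Z)
    kept-rounds bk zero N kp = kp
    kept-rounds bk (suc r) N kp = kept-rounds bk r N (kept-kills bk N 0 kp)

    trail : ∀ {E u w y} → Walk {k} E u w y → List (RawEdge k)
    trail nil = []
    trail (cons {u} {v} {a = a} _ p) = (u , a , v) ∷ trail p

    trail-∈ : ∀ {E u w y} (p : Walk E u w y) {e} → e ∈ trail p → e ∈ E
    trail-∈ (cons e p) (first refl) = e
    trail-∈ (cons _ p) (later m) = trail-∈ p m

    trail-back : ∀ {E u w y} (p : Walk E u w y) {e} → e ∈ trail p → src e ≡ u ⊎ (Σ (RawEdge k) λ e' → e' ∈ trail p × tgt e' ≡ src e)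
    trail-back (cons _ p) (first refl) = inj₁ refl
    trail-back (cons _ p) (later m) with trail-back p m
    ... | inj₁ q = inj₂ (_ , first refl , sym q)
    ... | inj₂ (e' , m' , t) = inj₂ (e' , later m' , t)

    trail-end : ∀ {E u w a y} (p : Walk E u w (a ∷ y)) → Σ (RawEdge k) λ e' → e' ∈ trail p × tgt e' ≡ w
    trail-end (cons _ nil) = _ , first refl , refl
    trail-end (cons _ p@(cons _ _)) = let (e' , m , t) = trail-end p in e' , later m , t

  -- The edges of a closed walk form a `Backed` set, the first being entered by the last. They
  -- survive any number of rounds, so the count of alive edges could not be 0.
  dies-acyclic : ∀ E N r → alive (rounds r N (map (_, true) E)) ≡ 0 → AcyclicRaw {k} E
  dies-acyclic E N r z v a y p@(cons _ _) = alive-∈ _ (kept-rounds backed r N (λ m → ∈-map⁺ (_, true) (trail-∈ p m)) (first refl)) z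
    where
    backed : Backed (trail p)
    backed m with trail-back p m
    ... | inj₂ b = b
    ... | inj₁ q = let (e' , m' , t) = trail-end p in e' , m' , trans t (sym q)

-- Selecting the encoded line graph of the input

module LineProgram (k q g : ℕ) where

  Γ : Set
  Γ = Sym k (suc (suc k)) q g

  private
    P : ℕ → Set
    P = Prog Γ 2 3

  outSym : ∀ {d} → Fin (suc (suc k)) → P d
  outSym a = emit (suc zero) (out a)

  tick : ∀ {d} → Ord → P d
  tick less = outSym one# » inc (suc zero)
  tick _    = idle

  -- Counter 0 holds the current vertex, counter 1 counts the symbols written for it.
  outVertex : ∀ {d} → P (suc d)
  outVertex = clr (suc zero) » for λ _ → cmp (suc zero) zero tick

  outEdge : ∀ {d} → Γ → P (suc d)
  outEdge (inn a) = outVertex » outSym sep# » outSym (suc (suc a)) » inc zero » outVertex » outSym sep#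
  outEdge _       = idle

  -- The header consists of |w| + 1 ones for the number of vertices, an empty block for the source 0
  -- and |w| ones for the target.
  lineProg : P 2
  lineProg = for (λ _ → outSym one#) » outSym one# » outSym sep# » outSym sep# » for (λ _ → outSym one#) » outSym sep# »
    for outEdge » emit (suc (suc zero)) tok

  private
    at : ℕ → ℕ → List Γ → List (Fin (suc (suc k))) → List Γ → State {Γ} {2} {3}
    at i j c o r = i ∷ j ∷ [] , c ∷ map out o ∷ r ∷ []

    compare-less : ∀ j d → compareℕ j (suc d + j) ≡ less
    compare-less j d = trans (cong (compareℕ j) (sym (+-suc d j))) (go j d)
      where
      go : ∀ j d → compareℕ j (d + suc j) ≡ less
      go zero zero = refl
      go zero (suc d) = refl
      go (suc j) d = trans (cong (compareℕ (suc j)) (+-suc d (suc j))) (go j d)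

    sem-ones : ∀ {d} (x y : List Γ) i j c o r → foldl (λ s _ → sem {d = d} (outSym one#) x s) (at i j c o r) y ≡ at i j c (unary (length y) ʳ++ o) r
    sem-ones x [] i j c o r = refl
    sem-ones {d} x (_ ∷ y) i j c o r = sem-ones {d} x y i j c (one# ∷ o) r

    -- The loop runs |x| times whatever `i` is. After `i` iterations the two counters agree, and the
    -- remaining ones do nothing.
    sem-outVertex : ∀ {d} (x : List Γ) i j c o r → i ≤ length x → sem (outVertex {d}) x (at i j c o r) ≡ at i i c (unary i ʳ++ o) r
    sem-outVertex {d} x i j c o r le = subst (λ n → foldl body (at n 0 c o r) x ≡ at n n c (unary i ʳ++ o) r) (+-identityʳ i) (go x i 0 o le)
      where
      body : State {Γ} {2} {3} → Γ → State {Γ} {2} {3}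
      body s _ = sem {d = d} (cmp (suc zero) zero tick) x s
      go : ∀ y m j o → m ≤ length y → foldl body (at (m + j) j c o r) y ≡ at (m + j) (m + j) c (unary m ʳ++ o) r
      go [] zero j o le = refl
      go (_ ∷ y) zero j o le rewrite compareℕ-equal j = go y zero j o z≤n
      go (_ ∷ y) (suc m) j o (s≤s le) rewrite compare-less j m =
        subst (λ n → foldl body (at n (suc j) c (one# ∷ o) r) y ≡ at n n c (unary m ʳ++ (one# ∷ o)) r) (+-suc m j) (go y m (suc j) (one# ∷ o) le)

    sem-outEdge : ∀ {d} (x : List Γ) a i j c o r → i < length x → sem (outEdge {d} (inn a)) x (at i j c o r) ≡ at (suc i) (suc i) c (encRaw (i , a , suc i) ʳ++ o) r
    sem-outEdge {d} x a i j c o r lt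
      rewrite sem-outVertex {d} x i j c o r (≤-trans (n≤1+n i) lt)
            | sem-outVertex {d} x (suc i) i c (suc (suc a) ∷ sep# ∷ (unary i ʳ++ o)) r lt =
      cong (λ o → at (suc i) (suc i) c o r) (sym (trans (++-ʳ++ (unary i)) (++-ʳ++ (unary (suc i)))))

    sem-outEdges : ∀ {d} (x : List Γ) w i j c o r → i + length w ≤ length x → Σ ℕ λ i' → Σ ℕ λ j' →
      foldl (λ s a → sem (outEdge {d} a) x s) (at i j c o r) (map inn w) ≡ at i' j' c (concatMap encRaw (lineRaw i w) ʳ++ o) r
    sem-outEdges x [] i j c o r le = i , j , refl
    sem-outEdges {d} x (a ∷ w) i j c o r le =
      let le' = subst (_≤ length x) (+-suc i (length w)) le
          (i' , j' , e) = sem-outEdges {d} x w (suc i) (suc i) c (encRaw (i , a , suc i) ʳ++ o) r le'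
      in i' , j' , trans (cong (λ s → foldl (λ s a → sem (outEdge {d} a) x s) s (map inn w)) (sem-outEdge {d} x a i j c o r (≤-trans (s≤s (m≤m+n i (length w))) le')))
        (trans e (cong (λ o → at i' j' c o r) (sym (++-ʳ++ (encRaw (i , a , suc i))))))

    unary-snoc : ∀ n {o : List (Fin (suc (suc k)))} → one# ∷ (unary n ʳ++ o) ≡ unary (suc n) ʳ++ o
    unary-snoc zero = refl
    unary-snoc (suc n) {o} = unary-snoc n

  sem-line : ∀ w c → Σ ℕ λ i → Σ ℕ λ j →
    sem lineProg (map inn w) (0 ∷ 0 ∷ [] , c ∷ [] ∷ [] ∷ []) ≡ (i ∷ j ∷ [] , c ∷ reverse (map out (encode (line w))) ∷ (tok ∷ []) ∷ [])
  sem-line w c = i , j , trans step₁ (trans (cong (sem (emit {d = 2} (suc (suc zero)) tok) x) e) step₃)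
    where
    x : List Γ
    x = map inn w
    n : ℕ
    n = length w
    len : length x ≡ n
    len = length-map inn w
    o₁ o₂ : List (Fin (suc (suc k)))
    o₁ = sep# ∷ sep# ∷ one# ∷ (unary (length x) ʳ++ [])
    o₂ = sep# ∷ (unary (length x) ʳ++ o₁)
    fin-edges : Σ ℕ λ i' → Σ ℕ λ j' → foldl (λ s a → sem (outEdge {0} a) x s) (at 0 0 c o₂ []) x ≡ at i' j' c (concatMap encRaw (lineRaw 0 w) ʳ++ o₂) []
    fin-edges = sem-outEdges {0} x w 0 0 c o₂ [] (≤-reflexive (sym (length-map (inn {k} {suc (suc k)} {q} {g}) w)))
    i j : ℕ
    i = proj₁ fin-edges
    j = proj₁ (proj₂ fin-edges)
    e : foldl (λ s a → sem (outEdge {0} a) x s) (at 0 0 c o₂ []) x ≡ at i j c (concatMap encRaw (lineRaw 0 w) ʳ++ o₂) []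
    e = proj₂ (proj₂ fin-edges)
    ones : ∀ o → foldl (λ s _ → sem {d = 1} (outSym one#) x s) (at 0 0 c o []) x ≡ at 0 0 c (unary (length x) ʳ++ o) []
    ones o = sem-ones {1} x x 0 0 c o []
    rest : State {Γ} {2} {3} → State {Γ} {2} {3}
    rest = sem (for {d = 1} (λ _ → outSym one#) » outSym sep# » for outEdge » emit (suc (suc zero)) tok) x
    step₁ : sem lineProg x (0 ∷ 0 ∷ [] , c ∷ [] ∷ [] ∷ []) ≡ sem (emit {d = 2} (suc (suc zero)) tok) x (foldl (λ s a → sem (outEdge {0} a) x s) (at 0 0 c o₂ []) x)
    step₁ = trans (cong (λ s → rest (sem (outSym {2} one# » outSym sep# » outSym sep#) x s)) (ones []))
      (cong (λ s → sem (outSym sep# » for outEdge » emit {d = 2} (suc (suc zero)) tok) x s) (ones o₁))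
    str : concatMap encRaw (lineRaw 0 w) ʳ++ o₂ ≡ reverse (encode (line w))
    str = trans (cong (concatMap encRaw (lineRaw 0 w) ʳ++_) o₂≡) (trans (sym flat) (cong reverse (sym (encode-line w))))
      where
      h : List (Fin (suc (suc k)))
      h = unary (suc n) ʳ++ []
      o₂≡ : o₂ ≡ sep# ∷ (unary n ʳ++ (sep# ∷ sep# ∷ h))
      o₂≡ = cong₂ (λ m u → sep# ∷ (unary m ʳ++ (sep# ∷ sep# ∷ u))) (len)
        (trans (unary-snoc (length x)) (cong (λ m → unary (suc m) ʳ++ []) (len)))
      flat : encodeRaw (suc n) 0 n (lineRaw 0 w) ʳ++ [] ≡ concatMap encRaw (lineRaw 0 w) ʳ++ (sep# ∷ (unary n ʳ++ (sep# ∷ sep# ∷ h)))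
      flat = trans (++-ʳ++ (unary (suc n)) {sep# ∷ sep# ∷ (unary n ++ sep# ∷ concatMap encRaw (lineRaw 0 w))}) (++-ʳ++ (unary n))
    step₃ : sem (emit {d = 2} (suc (suc zero)) tok) x (at i j c (concatMap encRaw (lineRaw 0 w) ʳ++ o₂) []) ≡ (i ∷ j ∷ [] , c ∷ reverse (map out (encode (line w))) ∷ (tok ∷ []) ∷ [])
    step₃ = cong (λ o → i ∷ j ∷ [] , c ∷ o ∷ (tok ∷ []) ∷ []) (trans (cong (map out) str) (reverse-map out (encode (line w))))

lineSelector : ∀ k → Selector k (suc (suc k)) (λ x y → y ≡ encode (line x))
lineSelector k = record
  { C = 2 ; W = 3 ; D = 0 ; prog = λ q g → LineProgram.lineProg k q g
  ; certS = zero ; outS = suc zero ; okS = suc (suc zero)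
  ; okS≢outS = λ () ; okS≢certS = λ () ; outS≢certS = λ ()
  ; sound = λ q g x c _ → let (_ , _ , e) = LineProgram.sem-line k q g x c in
      encode (line x) , refl , cong (λ s → lookup (proj₂ s) (suc zero)) e
  ; complete = λ { q g x _ refl → [] , z≤n , λ rest → let (_ , _ , e) = LineProgram.sem-line k q g x rest in
      (tok , [] , cong (λ s → lookup (proj₂ s) (suc (suc zero))) e) ,
      cong (λ s → lookup (proj₂ s) (suc zero)) e , cong (λ s → lookup (proj₂ s) zero) e } }

-- Selecting the yields of the paths of an acyclic graph

pattern f0 = zero
pattern f1 = suc f0
pattern f2 = suc f1
pattern f3 = suc f2
pattern f4 = suc f3
pattern f5 = suc f4
pattern f6 = suc f5
pattern f7 = suc f6

-- The states of the format check: 0, 1, 2 in the header blocks, 3 between edges, 6 inside a source block,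
-- 4 before a label, 5 inside a target block, 7 failure.
module _ {k : ℕ} where

  parse : Fin 8 → Fin (suc (suc k)) → Fin 8
  parse f0 zero = f0
  parse f0 (suc zero) = f1
  parse f1 zero = f1
  parse f1 (suc zero) = f2
  parse f2 zero = f2
  parse f2 (suc zero) = f3
  -- State 6 behaves like 3 except that it is not final: a code cannot end within a source block.
  parse f3 zero = f6
  parse f3 (suc zero) = f4
  parse f4 (suc (suc a)) = f5
  parse f5 zero = f5
  parse f5 (suc zero) = f3
  parse f6 zero = f6
  parse f6 (suc zero) = f4
  parse _ _ = f7

  private
    Str : Set
    Str = List (Fin (suc (suc k)))

    -- The suffixes that lead from each state to the final state 3. The failure state is a sink and
    -- has none.
    Shape : Fin 8 → Str → Set
    Shape f0 z = ∃ λ n → ∃ λ s → ∃ λ t → ∃ λ E → z ≡ encodeRaw n s t E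
    Shape f1 z = ∃ λ s → ∃ λ t → ∃ λ E → z ≡ unary s ++ sep# ∷ unary t ++ sep# ∷ concatMap encRaw E
    Shape f2 z = ∃ λ t → ∃ λ E → z ≡ unary t ++ sep# ∷ concatMap encRaw E
    Shape f3 z = ∃ λ E → z ≡ concatMap encRaw E
    Shape f4 z = ∃ λ a → ∃ λ v → ∃ λ E → z ≡ suc (suc a) ∷ unary v ++ sep# ∷ concatMap encRaw E
    Shape f5 z = ∃ λ v → ∃ λ E → z ≡ unary v ++ sep# ∷ concatMap encRaw E
    Shape f6 z = ∃ λ u → ∃ λ a → ∃ λ v → ∃ λ E → z ≡ unary u ++ sep# ∷ suc (suc a) ∷ unary v ++ sep# ∷ concatMap encRaw E
    Shape f7 z = ⊥

    shape-cons : ∀ p c z → Shape (parse p c) z → Shape p (c ∷ z)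
    shape-cons f0 zero z (n , s , t , E , refl) = suc n , s , t , E , refl
    shape-cons f0 (suc zero) z (s , t , E , refl) = 0 , s , t , E , refl
    shape-cons f1 zero z (s , t , E , refl) = suc s , t , E , refl
    shape-cons f1 (suc zero) z (t , E , refl) = 0 , t , E , refl
    shape-cons f2 zero z (t , E , refl) = suc t , E , refl
    shape-cons f2 (suc zero) z (E , refl) = 0 , E , refl
    shape-cons f3 zero z (u , a , v , E , refl) = (suc u , a , v) ∷ E , sym (encRaw-++ (suc u) a v (concatMap encRaw E))
    shape-cons f3 (suc zero) z (a , v , E , refl) = (0 , a , v) ∷ E , sym (encRaw-++ 0 a v (concatMap encRaw E))
    shape-cons f4 (suc (suc a)) z (v , E , refl) = a , v , E , refl
    shape-cons f5 zero z (v , E , refl) = suc v , E , refl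
    shape-cons f5 (suc zero) z (E , refl) = 0 , E , refl
    shape-cons f6 zero z (u , a , v , E , refl) = suc u , a , v , E , refl
    shape-cons f6 (suc zero) z (a , v , E , refl) = 0 , a , v , E , refl

    shape : ∀ p z → foldl parse p z ≡ f3 → Shape p z
    shape f3 [] e = [] , refl
    shape p (c ∷ z) e = shape-cons p c z (shape (parse p c) z e)

    parse-unary : ∀ p m → parse p zero ≡ p → foldl parse p (unary m) ≡ p
    parse-unary p zero e = refl
    parse-unary p (suc m) e = trans (cong (λ q → foldl parse q (unary m)) e) (parse-unary p m e)

    parse-block : ∀ p m z → parse p zero ≡ p → foldl parse p (unary m ++ z) ≡ foldl parse p z
    parse-block p m z e = trans (foldl-++ parse p (unary m) z) (cong (λ q → foldl parse q z) (parse-unary p m e))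

    parse-edges : ∀ E → foldl parse f3 (concatMap encRaw E) ≡ f3
    parse-edges [] = refl
    parse-edges ((u , a , v) ∷ E) = trans (cong (foldl parse f3) (encRaw-++ u a v (concatMap encRaw E)))
      (trans (source u) (trans (parse-block f5 v (sep# ∷ concatMap encRaw E) refl) (parse-edges E)))
      where
      z : Str
      z = suc (suc a) ∷ unary v ++ sep# ∷ concatMap encRaw E
      source : ∀ u → foldl parse f3 (unary u ++ sep# ∷ z) ≡ foldl parse f4 z
      source zero = refl
      source (suc u) = parse-block f6 u (sep# ∷ z) refl

  parse-sound : ∀ z → foldl parse f0 z ≡ f3 → ∃ λ n → ∃ λ s → ∃ λ t → ∃ λ E → z ≡ encodeRaw n s t E
  parse-sound z e = shape f0 z e

  parse-complete : ∀ n s t E → foldl parse f0 (encodeRaw n s t E) ≡ f3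
  parse-complete n s t E = trans (parse-block f0 n _ refl) (trans (parse-block f1 s _ refl) (trans (parse-block f2 t _ refl) (parse-edges E)))

module PathProgram (k q g : ℕ) where

  Γ : Set
  Γ = Sym (suc (suc k)) k q g

  P : ℕ → Set
  P = Prog Γ 8 7

  U# V# N# P# IN# CUR# Z# BAD# : Fin 8
  U#   = f0
  V#   = f1
  N#   = f2
  P#   = f3
  IN#  = f4
  CUR# = f5
  Z#   = f6
  BAD# = f7

  PH# A# CERT# OUT# OK# AL# AM# : Fin 7
  PH#   = f0
  A#    = f1
  CERT# = f2
  OUT#  = f3
  OK#   = f4
  AL#   = f5
  AM#   = f6

  Rest : Set
  Rest = Vec ℕ 6 × Vec (List Γ) 5

  S : ℕ → ℕ → List Γ → List Γ → Rest → State {Γ} {8} {7}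
  S u v ph a (c , w) = u ∷ v ∷ c , ph ∷ a ∷ w

  label : Fin k → Γ
  label a = inn (suc (suc a))

  module _ {d : ℕ} (hn hs ht he : P d) where

    -- The scan runs only on inputs that have passed the format check. So phase 3 can also serve
    -- inside source blocks, and the remaining cases may idle.
    scanPhase : Maybe Γ → Γ → P d
    scanPhase (just (flag f0)) (inn zero) = inc U# » emit PH# (flag f0)
    scanPhase (just (flag f0)) (inn (suc zero)) = hn » clr U# » emit PH# (flag f1)
    scanPhase (just (flag f1)) (inn zero) = inc U# » emit PH# (flag f1)
    scanPhase (just (flag f1)) (inn (suc zero)) = hs » clr U# » emit PH# (flag f2)
    scanPhase (just (flag f2)) (inn zero) = inc U# » emit PH# (flag f2)
    scanPhase (just (flag f2)) (inn (suc zero)) = ht » clr U# » emit PH# (flag f3)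
    scanPhase (just (flag f3)) (inn zero) = inc U# » emit PH# (flag f3)
    scanPhase (just (flag f3)) (inn (suc zero)) = emit PH# (flag f4)
    scanPhase (just (flag f4)) a = emit A# a » emit PH# (flag f5)
    scanPhase (just (flag f5)) (inn zero) = inc V# » emit PH# (flag f5)
    scanPhase (just (flag f5)) (inn (suc zero)) = he » clr U# » clr V# » pull A# (λ _ → idle) » emit PH# (flag f3)
    scanPhase _ _ = idle

    scanStep : Γ → P d
    scanStep c = pull PH# (λ m → scanPhase m c)

    -- One pass over the encoding, calling a handler at the end of each header block and of each edge.
    scan : P (suc d)
    scan = emit PH# (flag f0) » for scanStep » pull PH# (λ _ → idle)

    -- `S` separates what the scan itself uses from the rest. A handler has to restore the former,
    -- so the effect of a pass is the composition of its effects on the rest.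
    data Runs (x : List Γ) : List (RawEdge k) → Rest → Rest → Set where
      []  : ∀ {r} → Runs x [] r r
      _∷_ : ∀ {u a v E r r' r''} → sem he x (S u v [] (label a ∷ []) r) ≡ S u v [] (label a ∷ []) r' →
        Runs x E r' r'' → Runs x ((u , a , v) ∷ E) r r''

    module _ (x : List Γ) where
      private
        F : State {Γ} {8} {7} → List (Fin (suc (suc k))) → State {Γ} {8} {7}
        F s y = foldl (λ s c → sem (scanStep c) x s) s (map inn y)

        block : ∀ p → (∀ u r → sem (scanStep (inn zero)) x (S u 0 (flag p ∷ []) [] r) ≡ S (suc u) 0 (flag p ∷ []) [] r) →
          ∀ m u r z → F (S u 0 (flag p ∷ []) [] r) (unary m ++ z) ≡ F (S (m + u) 0 (flag p ∷ []) [] r) z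
        block p h zero u r z = refl
        block p h (suc m) u r z = trans (cong (λ s → F s (unary m ++ z)) (h u r))
          (trans (block p h m (suc u) r z) (cong (λ n → F (S n 0 (flag p ∷ []) [] r) z) (+-suc m u)))

        block₀ : ∀ p → (∀ u r → sem (scanStep (inn zero)) x (S u 0 (flag p ∷ []) [] r) ≡ S (suc u) 0 (flag p ∷ []) [] r) →
          ∀ m r z → F (S 0 0 (flag p ∷ []) [] r) (unary m ++ z) ≡ F (S m 0 (flag p ∷ []) [] r) z
        block₀ p h m r z = trans (block p h m 0 r z) (cong (λ n → F (S n 0 (flag p ∷ []) [] r) z) (+-identityʳ m))

        target : ∀ a m u v r z → F (S u v (flag f5 ∷ []) (a ∷ []) r) (unary m ++ z) ≡ F (S u (m + v) (flag f5 ∷ []) (a ∷ []) r) z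
        target a zero u v r z = refl
        target a (suc m) u v r z = trans (target a m u (suc v) r z) (cong (λ n → F (S u n (flag f5 ∷ []) (a ∷ []) r) z) (+-suc m v))

        edges : ∀ {E r r'} → Runs x E r r' → F (S 0 0 (flag f3 ∷ []) [] r) (concatMap encRaw E) ≡ S 0 0 (flag f3 ∷ []) [] r'
        edges [] = refl
        edges (_∷_ {u} {a} {v} {E} {r} {r'} h R) = trans (cong (F (S 0 0 (flag f3 ∷ []) [] r)) (encRaw-++ u a v (concatMap encRaw E)))
          (trans (block₀ f3 (λ _ _ → refl) u r _)
          (trans (target (label a) v u 0 r _)
          (trans (cong (λ n → F (S u n (flag f5 ∷ []) (label a ∷ []) r) (sep# ∷ concatMap encRaw E)) (+-identityʳ v))
          (trans (cong (λ s → F (sem (clr U# » clr V# » pull A# (λ _ → idle) » emit {d = d} PH# (flag f3)) x s) (concatMap encRaw E)) h) (edges R)))))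

        header : ∀ (h : P d) p {u r r'} → sem h x (S u 0 [] [] r) ≡ S u 0 [] [] r' →
          sem (h » clr U# » emit PH# (flag p)) x (S u 0 [] [] r) ≡ S 0 0 (flag p ∷ []) [] r'
        header h p e = cong (sem (clr U# » emit {d = d} PH# (flag p)) x) e

      sem-scan : ∀ n s t E → map inn (encodeRaw n s t E) ≡ x → ∀ {r r₁ r₂ r₃ r₄} →
        sem hn x (S n 0 [] [] r) ≡ S n 0 [] [] r₁ → sem hs x (S s 0 [] [] r₁) ≡ S s 0 [] [] r₂ →
        sem ht x (S t 0 [] [] r₂) ≡ S t 0 [] [] r₃ → Runs x E r₃ r₄ →
        sem scan x (S 0 0 [] [] r) ≡ S 0 0 [] [] r₄
      sem-scan n s t E refl {r} {r₁} {r₂} en es et R = cong (sem (pull {d = suc d} PH# (λ _ → idle)) x)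
        (trans (block₀ f0 (λ _ _ → refl) n r _)
        (trans (cong (λ z → F z (unary s ++ sep# ∷ unary t ++ sep# ∷ concatMap encRaw E)) (header hn f1 en))
        (trans (block₀ f1 (λ _ _ → refl) s r₁ _)
        (trans (cong (λ z → F z (unary t ++ sep# ∷ concatMap encRaw E)) (header hs f2 es))
        (trans (block₀ f2 (λ _ _ → refl) t r₂ _)
        (trans (cong (λ z → F z (concatMap encRaw E)) (header ht f3 et))
        (edges R)))))))

  -- Counter CUR holds the current vertex of the walk, IN the number of alive edges into the vertex P,
  -- BAD the number of violations found; Z stays 0.

  bound : ∀ {d} → Fin 8 → P d
  boundCase : ∀ {d} → Ord → P d
  boundCase less = idle
  boundCase _    = inc BAD#
  bound f0 = cmp U# N# boundCase
  bound _  = cmp V# N# boundCase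

  boundEdge : ∀ {d} → P d
  boundEdge = bound U# » bound V# » emit AL# (bit true)

  enterCase : ∀ {d} → Ord → P d
  enterCase equal = inc IN#
  enterCase _     = idle

  countEdge : ∀ {d} → Maybe Γ → P d
  countEdge (just (bit true))  = emit AM# (bit true) » cmp V# P# enterCase
  countEdge (just (bit false)) = emit AM# (bit false)
  countEdge _                  = idle

  sourceCase freeCase : ∀ {d} → Ord → P d
  sourceCase equal = emit AM# (bit false)
  sourceCase _     = emit AM# (bit true)
  freeCase equal = cmp U# P# sourceCase
  freeCase _     = emit AM# (bit true)

  updateEdge : ∀ {d} → Maybe Γ → P d
  updateEdge (just (bit true))  = cmp IN# Z# freeCase
  updateEdge (just (bit false)) = emit AM# (bit false)
  updateEdge _                  = idle

  putBack : ∀ {d} → Maybe Γ → P d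
  putBack (just γ) = emit AL# γ
  putBack nothing  = idle

  -- A pass moves the marks from `AL#` to `AM#` and thereby reverses them. One pull per input symbol
  -- brings them all back, as there are no more edges than symbols.
  restore : ∀ {d} → P (suc d)
  restore = for λ _ → pull AM# putBack

  -- Two passes, because all edges into the vertex have to be counted before any edge out of it may
  -- die.
  killProg : ∀ {d} → P (suc d)
  killProg = clr IN# » scan idle idle idle (pull AL# countEdge) » restore » scan idle idle idle (pull AL# updateEdge) » restore » inc P#

  roundProg : ∀ {d} → P (suc (suc d))
  roundProg = clr P# » for λ _ → killProg

  aliveEdge : ∀ {d} → Maybe Γ → P d
  aliveEdge (just (bit true)) = inc BAD#
  aliveEdge _                 = idle

  outLabel : ∀ {d} → Maybe Γ → P d
  -- The label is put back, as the scan expects to find it after the handler.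
  outLabel (just (inn (suc (suc a)))) = emit OUT# (out a) » emit A# (label a)
  outLabel _                          = idle

  takeCase : ∀ {d} → Ord → P d
  takeCase equal = copy CUR# V# » pull A# outLabel
  takeCase _     = idle

  -- One certificate symbol is spent per edge. A `true` at an edge that does not start at the
  -- current vertex has no effect, so every certificate describes a walk from the source.
  walkEdge : ∀ {d} → Maybe Γ → P d
  walkEdge (just (bit true)) = cmp U# CUR# takeCase
  walkEdge _                 = idle

  goalCase : ∀ {d} → Ord → P d
  goalCase equal = idle
  goalCase _     = inc BAD#

  okCase : ∀ {d} → Ord → P d
  okCase equal = emit OK# tok
  okCase _     = idle

  checkBounds checkAlive loadSource walkRounds checkGoal : ∀ {d} → P (suc (suc d))
  checkBounds = scan (copy N# U#) (bound U#) (bound U#) boundEdge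
  checkAlive  = for λ _ → pull AL# aliveEdge
  loadSource  = scan idle (copy CUR# U#) idle idle
  walkRounds  = for λ _ → scan idle idle idle (pull CERT# walkEdge)
  checkGoal   = scan idle idle (cmp U# CUR# goalCase) idle

  -- All violations are added to one counter and the program runs on, so success is a single test
  -- for zero. |x| deletion rounds are enough: while edges of an acyclic graph are alive, each round
  -- kills one, and there are at most |x| edges.
  graphProg : ∀ {d} → P (suc (suc (suc d)))
  graphProg = checkBounds » (for λ _ → roundProg) » checkAlive » loadSource » walkRounds » checkGoal » cmp BAD# Z# okCase

  parseSym : ∀ {d} → Maybe Γ → Γ → P d
  parseSym (just (flag p)) (inn c) = emit PH# (flag (parse p c))
  parseSym _ _ = idle

  whenParsed : ∀ {d} → Maybe Γ → P (suc (suc (suc d)))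
  whenParsed (just (flag f3)) = graphProg
  whenParsed _                = idle

  pathProg : P 3
  pathProg = emit PH# (flag f0) » for (λ c → pull PH# (λ m → parseSym m c)) » pull PH# whenParsed

  bits : List Bool → List Γ
  bits = map bit

  overBy : Ord → ℕ → ℕ
  overBy less b = b
  overBy _    b = suc b

  overEdges : ℕ → List (RawEdge k) → ℕ → ℕ
  overEdges n [] b = b
  overEdges n ((u , _ , v) ∷ E) b = overEdges n E (overBy (compareℕ v n) (overBy (compareℕ u n) b))

  module _ (n s t : ℕ) (E : List (RawEdge k)) where
    private
      x : List Γ
      x = map inn (encodeRaw n s t E)

      R : ℕ → ℕ → ℕ → ℕ → List Γ → List Γ → List Γ → List Γ → List Γ → Rest
      R p i c b ce o ok al am = n ∷ p ∷ i ∷ c ∷ 0 ∷ b ∷ [] , ce ∷ o ∷ ok ∷ al ∷ am ∷ []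

      T : Rest → State {Γ} {8} {7}
      T = S 0 0 [] []

    length-E : length E ≤ length x
    length-E = ≤-trans (edges-≤-encode n s t E) (≤-reflexive (sym (length-map inn (encodeRaw n s t E))))

    over : ℕ
    over = overEdges n E (overBy (compareℕ t n) (overBy (compareℕ s n) 0))

    private
      sem-boundCase : ∀ {d} o u v ph a p i c b ce o' ok al am → sem (boundCase {d} o) x (S u v ph a (R p i c b ce o' ok al am)) ≡
        S u v ph a (R p i c (overBy o b) ce o' ok al am)
      sem-boundCase less u v ph a p i c b ce o' ok al am = refl
      sem-boundCase equal u v ph a p i c b ce o' ok al am = refl
      sem-boundCase greater u v ph a p i c b ce o' ok al am = refl

      marks : Marked {k} → List Γ
      marks Z = bits (map proj₂ Z)

      fresh : Marked {k}
      fresh = map (_, true) E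

      runs-bounds : ∀ {d} ce E' b Z → Runs {d} (copy N# U#) (bound U#) (bound U#) boundEdge x E' (R 0 0 0 b ce [] [] (marks Z) [])
        (R 0 0 0 (overEdges n E' b) ce [] [] (marks (map (_, true) E' ʳ++ Z)) [])
      runs-bounds ce [] b Z = []
      runs-bounds {d} ce ((u , a , v) ∷ E') b Z =
        trans (cong (sem (bound {d} V# » emit {d = d} AL# (bit true)) x) (sem-boundCase {d} (compareℕ u n) u v [] (label a ∷ []) 0 0 0 b ce [] [] (marks Z) []))
          (cong (sem (emit {d = d} AL# (bit true)) x) (sem-boundCase {d} (compareℕ v n) u v [] (label a ∷ []) 0 0 0 (overBy (compareℕ u n) b) ce [] [] (marks Z) []))
        ∷ runs-bounds ce E' (overBy (compareℕ v n) (overBy (compareℕ u n) b)) (((u , a , v) , true) ∷ Z)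

      -- Pushing one mark per edge reverses their order, which is harmless because all of them are
      -- `true`.
      all-true : ∀ (E' : List (RawEdge k)) Z → marks (map (_, true) E' ʳ++ Z) ≡ marks (map (_, true) E' ++ Z)
      all-true [] Z = refl
      all-true (e ∷ E') Z = trans (all-true E' ((e , true) ∷ Z)) (shift-true E')
        where
        shift-true : ∀ E' → marks (map (_, true) E' ++ (e , true) ∷ Z) ≡ bit true ∷ marks (map (_, true) E' ++ Z)
        shift-true [] = refl
        shift-true (_ ∷ E') = cong (bit true ∷_) (shift-true E')

      sem-checkBounds : ∀ {d} ce → sem (checkBounds {d}) x (T (V.replicate 6 0 , ce ∷ [] ∷ [] ∷ [] ∷ [] ∷ [])) ≡ T (R 0 0 0 over ce [] [] (marks fresh) [])
      sem-checkBounds {d} ce = trans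
        (sem-scan {suc d} (copy N# U#) (bound U#) (bound U#) boundEdge x n s t E refl refl
          (sem-boundCase {suc d} (compareℕ s n) s 0 [] [] 0 0 0 0 ce [] [] [] [])
          (sem-boundCase {suc d} (compareℕ t n) t 0 [] [] 0 0 0 (overBy (compareℕ s n) 0) ce [] [] [] [])
          (runs-bounds ce E (overBy (compareℕ t n) (overBy (compareℕ s n) 0)) []))
        (cong (λ al → T (R 0 0 0 over ce [] [] al [])) (trans (all-true E []) (cong marks (++-identityʳ fresh))))

      entersBy : Ord → ℕ → ℕ
      entersBy equal i = suc i
      entersBy _     i = i

      sem-enterCase : ∀ {d} o u v ph a p i c b ce o' ok al am → sem (enterCase {d} o) x (S u v ph a (R p i c b ce o' ok al am)) ≡
        S u v ph a (R p (entersBy o i) c b ce o' ok al am)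
      sem-enterCase less u v ph a p i c b ce o' ok al am = refl
      sem-enterCase equal u v ph a p i c b ce o' ok al am = refl
      sem-enterCase greater u v ph a p i c b ce o' ok al am = refl

      enters-+ : ∀ o m i → m + entersBy o i ≡ (if isEqual o then suc m else m) + i
      enters-+ less m i = refl
      enters-+ equal m i = +-suc m i
      enters-+ greater m i = refl

      runs-count : ∀ {d} p c b ce o ok Z i am → Runs {d} idle idle idle (pull AL# countEdge) x (map proj₁ Z)
        (R p i c b ce o ok (marks Z) am) (R p (entering p Z + i) c b ce o ok [] (marks Z ʳ++ am))
      runs-count p c b ce o ok [] i am = []
      runs-count p c b ce o ok ((e , false) ∷ Z) i am = refl ∷ runs-count p c b ce o ok Z i (bit false ∷ am)
      runs-count {d} p c b ce o ok (((u , a , v) , true) ∷ Z) i am =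
        sem-enterCase {d} (compareℕ v p) u v [] (label a ∷ []) p i c b ce o ok (marks Z) (bit true ∷ am) ∷
        subst (λ m → Runs {d} idle idle idle (pull AL# countEdge) x (map proj₁ Z) (R p (entersBy (compareℕ v p) i) c b ce o ok (marks Z) (bit true ∷ am))
            (R p m c b ce o ok [] (marks Z ʳ++ (bit true ∷ am))))
          (enters-+ (compareℕ v p) (entering p Z) i)
          (runs-count p c b ce o ok Z (entersBy (compareℕ v p) i) (bit true ∷ am))

      sem-sourceCase : ∀ {d} o r u v ph a p i c b ce o' ok al am → r ≡ isEqual o → sem (sourceCase {d} o) x (S u v ph a (R p i c b ce o' ok al am)) ≡
        S u v ph a (R p i c b ce o' ok al (bit (not r) ∷ am))
      sem-sourceCase less _ u v ph a p i c b ce o' ok al am refl = refl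
      sem-sourceCase equal _ u v ph a p i c b ce o' ok al am refl = refl
      sem-sourceCase greater _ u v ph a p i c b ce o' ok al am refl = refl

      sem-freeCase : ∀ {d} o u v ph a p i c b ce o' ok al am → sem (freeCase {d} o) x (S u v ph a (R p i c b ce o' ok al am)) ≡
        S u v ph a (R p i c b ce o' ok al (bit (not (isEqual o ∧ isEqual (compareℕ u p))) ∷ am))
      sem-freeCase less u v ph a p i c b ce o' ok al am = refl
      sem-freeCase {d} equal u v ph a p i c b ce o' ok al am = sem-sourceCase {d} (compareℕ u p) _ u v ph a p i c b ce o' ok al am refl
      sem-freeCase greater u v ph a p i c b ce o' ok al am = refl

      runs-update : ∀ {d} p i c b ce o ok Z am → Runs {d} idle idle idle (pull AL# updateEdge) x (map proj₁ Z)
        (R p i c b ce o ok (marks Z) am) (R p i c b ce o ok [] (marks (map (killEdge i p) Z) ʳ++ am))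
      runs-update p i c b ce o ok [] am = []
      runs-update p i c b ce o ok ((e , false) ∷ Z) am = refl ∷ runs-update p i c b ce o ok Z (bit false ∷ am)
      runs-update {d} p i c b ce o ok (((u , a , v) , true) ∷ Z) am =
        sem-freeCase {d} (compareℕ i 0) u v [] (label a ∷ []) p i c b ce o ok (marks Z) am ∷ runs-update p i c b ce o ok Z _

      sem-restore : ∀ {d} p i c b ce o ok al am → length am ≤ length x →
        sem (restore {d}) x (T (R p i c b ce o ok al am)) ≡ T (R p i c b ce o ok (am ʳ++ al) [])
      sem-restore {d} p i c b ce o ok al am le = go x al am le
        where
        go : ∀ (y : List Γ) al am → length am ≤ length y →
          foldl (λ s _ → sem (pull {d = d} AM# putBack) x s) (T (R p i c b ce o ok al am)) y ≡ T (R p i c b ce o ok (am ʳ++ al) [])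
        go [] al [] le = refl
        go (_ ∷ y) al [] le = go y al [] z≤n
        go (_ ∷ y) al (γ ∷ am) (s≤s le) = go y (γ ∷ al) am le

      length-marks : ∀ {Z : Marked {k}} → map proj₁ Z ≡ E → length (marks Z ʳ++ []) ≤ length x
      length-marks {Z} e = ≤-trans (≤-reflexive (trans (length-ʳ++ (marks Z)) (trans (+-identityʳ _) (trans (length-map bit (map proj₂ Z))
        (trans (length-map proj₂ Z) (sym (length-map proj₁ Z))))))) (≤-trans (≤-reflexive (cong length e)) length-E)

      unreversed : ∀ (l : List Γ) → (l ʳ++ []) ʳ++ [] ≡ l
      unreversed l = trans (ʳ++-ʳ++ l) (++-identityʳ l)

      sem-kill : ∀ {d} p i c b ce o ok Z → map proj₁ Z ≡ E →
        sem (killProg {d}) x (T (R p i c b ce o ok (marks Z) [])) ≡ T (R (suc p) (entering p Z) c b ce o ok (marks (kill p Z)) [])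
      sem-kill {d} p i c b ce o ok Z e =
        trans (cong (sem (restore {d} » scan {d} idle idle idle (pull AL# updateEdge) » restore {d} » inc {d = suc d} P#) x)
          (trans (sem-scan {d} idle idle idle (pull AL# countEdge) x n s t E refl refl refl refl
              (subst (λ E' → Runs {d} idle idle idle (pull AL# countEdge) x E' (R p 0 c b ce o ok (marks Z) []) (R p (entering p Z + 0) c b ce o ok [] (marks Z ʳ++ [])))
                e (runs-count p c b ce o ok Z 0 [])))
            (cong (λ m → T (R p m c b ce o ok [] (marks Z ʳ++ []))) (+-identityʳ (entering p Z)))))
        (trans (cong (sem (scan {d} idle idle idle (pull AL# updateEdge) » restore {d} » inc {d = suc d} P#) x)
          (trans (sem-restore {d} p (entering p Z) c b ce o ok [] (marks Z ʳ++ []) (length-marks {Z} e))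
            (cong (λ al → T (R p (entering p Z) c b ce o ok al [])) (unreversed (marks Z)))))
        (trans (cong (sem (restore {d} » inc {d = suc d} P#) x)
          (sem-scan {d} idle idle idle (pull AL# updateEdge) x n s t E refl refl refl refl
              (subst (λ E' → Runs {d} idle idle idle (pull AL# updateEdge) x E' (R p (entering p Z) c b ce o ok (marks Z) []) (R p (entering p Z) c b ce o ok [] (marks (kill p Z) ʳ++ [])))
                e (runs-update p (entering p Z) c b ce o ok Z []))))
        (cong (sem (inc {d = suc d} P#) x)
          (trans (sem-restore {d} p (entering p Z) c b ce o ok [] (marks (kill p Z) ʳ++ []) (length-marks {kill p Z} (trans (sym (map-∘ Z)) e)))
            (cong (λ al → T (R p (entering p Z) c b ce o ok al [])) (unreversed (marks (kill p Z))))))))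

      sem-kills : ∀ {d} c b ce o ok (y : List Γ) p i (Z : Marked {k}) → map proj₁ Z ≡ E → Σ ℕ λ p' → Σ ℕ λ i' →
        foldl (λ s _ → sem (killProg {d}) x s) (T (R p i c b ce o ok (marks Z) [])) y ≡ T (R p' i' c b ce o ok (marks (kills (length y) p Z)) [])
      sem-kills c b ce o ok [] p i Z e = p , i , refl
      sem-kills {d} c b ce o ok (_ ∷ y) p i Z e =
        let (p' , i' , h) = sem-kills {d} c b ce o ok y (suc p) (entering p Z) (kill p Z) (trans (sym (map-∘ Z)) e)
        in p' , i' , trans (cong (λ s → foldl (λ s _ → sem (killProg {d}) x s) s y) (sem-kill {d} p i c b ce o ok Z e)) h

      sem-rounds : ∀ {d} c b ce o ok (y : List Γ) p i (Z : Marked {k}) → map proj₁ Z ≡ E → Σ ℕ λ p' → Σ ℕ λ i' →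
        foldl (λ s _ → sem (roundProg {d}) x s) (T (R p i c b ce o ok (marks Z) [])) y ≡ T (R p' i' c b ce o ok (marks (rounds (length y) (length x) Z)) [])
      sem-rounds c b ce o ok [] p i Z e = p , i , refl
      sem-rounds {d} c b ce o ok (_ ∷ y) p i Z e =
        let (p₁ , i₁ , h₁) = sem-kills {d} c b ce o ok x 0 i Z e
            (p' , i' , h) = sem-rounds {d} c b ce o ok y p₁ i₁ (kills (length x) 0 Z) (trans (kills-edges (length x) 0 Z) e)
        in p' , i' , trans (cong (λ s → foldl (λ s _ → sem (roundProg {d}) x s) s y) h₁) h

      sem-checkAlive : ∀ {d} p i c b ce o ok (y : List Γ) Z → length Z ≤ length y →
        foldl (λ s _ → sem (pull {d = d} AL# aliveEdge) x s) (T (R p i c b ce o ok (marks Z) [])) y ≡ T (R p i c (alive Z + b) ce o ok [] [])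
      sem-checkAlive p i c b ce o ok [] [] le = refl
      sem-checkAlive {d} p i c b ce o ok (_ ∷ y) [] le = sem-checkAlive {d} p i c b ce o ok y [] z≤n
      sem-checkAlive {d} p i c b ce o ok (_ ∷ y) ((e , false) ∷ Z) (s≤s le) = sem-checkAlive {d} p i c b ce o ok y Z le
      sem-checkAlive {d} p i c b ce o ok (_ ∷ y) ((e , true) ∷ Z) (s≤s le) =
        trans (sem-checkAlive {d} p i c (suc b) ce o ok y Z le) (cong (λ b → T (R p i c b ce o ok [] [])) (+-suc (alive Z) b))

      runs-idle : ∀ {d} {hn hs ht : P d} E' r → Runs hn hs ht idle x E' r r
      runs-idle [] r = []
      runs-idle (_ ∷ E') r = refl ∷ runs-idle E' r

      sem-loadSource : ∀ {d} p i b ce → sem (loadSource {d}) x (T (R p i 0 b ce [] [] [] [])) ≡ T (R p i s b ce [] [] [] [])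
      sem-loadSource {d} p i b ce = sem-scan {suc d} idle (copy CUR# U#) idle idle x n s t E refl refl refl refl (runs-idle E _)

    takes : Γ → Bool
    takes (bit b) = b
    takes _       = false

    -- The current vertex, the unread part of the certificate and the labels taken so far, latest
    -- first.
    Walker : Set
    Walker = ℕ × List Γ × List (Fin k)

    walkStep : Walker → RawEdge k → Walker
    walkStep (c , [] , y) (u , a , v) = c , [] , y
    walkStep (c , γ ∷ ce , y) (u , a , v) = if takes γ ∧ isEqual (compareℕ u c) then v , ce , a ∷ y else c , ce , y

    walkRound : Walker → Walker
    walkRound w = foldl walkStep w E

    walked : ℕ → Walker → Walker
    walked zero w = w
    walked (suc r) w = walked r (walkRound w)

    private
      W : ℕ → ℕ → ℕ → Walker → Rest
      W p i b (c , ce , y) = R p i c b ce (map out y) [] [] []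

      sem-takeCase : ∀ {d} o r p i b c ce y u a v → r ≡ isEqual o → sem (takeCase {d} o) x (S u v [] (label a ∷ []) (W p i b (c , ce , y))) ≡
        S u v [] (label a ∷ []) (W p i b (if r then v , ce , a ∷ y else c , ce , y))
      sem-takeCase less _ p i b c ce y u a v refl = refl
      sem-takeCase equal _ p i b c ce y u a v refl = refl
      sem-takeCase greater _ p i b c ce y u a v refl = refl

      sem-walkEdge : ∀ {d} p i b w u a v → sem (pull {d = d} CERT# walkEdge) x (S u v [] (label a ∷ []) (W p i b w)) ≡
        S u v [] (label a ∷ []) (W p i b (walkStep w (u , a , v)))
      sem-walkEdge p i b (c , [] , y) u a v = refl
      sem-walkEdge {d} p i b (c , bit true ∷ ce , y) u a v = sem-takeCase {d} (compareℕ u c) _ p i b c ce y u a v refl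
      sem-walkEdge p i b (c , bit false ∷ ce , y) u a v = refl
      sem-walkEdge p i b (c , tok ∷ ce , y) u a v = refl
      sem-walkEdge p i b (c , inn _ ∷ ce , y) u a v = refl
      sem-walkEdge p i b (c , out _ ∷ ce , y) u a v = refl
      sem-walkEdge p i b (c , flag _ ∷ ce , y) u a v = refl
      sem-walkEdge p i b (c , Sym.st _ ∷ ce , y) u a v = refl
      sem-walkEdge p i b (c , tp _ ∷ ce , y) u a v = refl
      sem-walkEdge p i b (c , rule _ ∷ ce , y) u a v = refl

      runs-walk : ∀ {d} p i b E' w → Runs {d} idle idle idle (pull CERT# walkEdge) x E' (W p i b w) (W p i b (foldl walkStep w E'))
      runs-walk p i b [] w = []
      runs-walk {d} p i b ((u , a , v) ∷ E') w = sem-walkEdge {d} p i b w u a v ∷ runs-walk p i b E' (walkStep w (u , a , v))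

      sem-walkRounds : ∀ {d} p i b (y : List Γ) w →
        foldl (λ s _ → sem (scan {d} idle idle idle (pull CERT# walkEdge)) x s) (T (W p i b w)) y ≡ T (W p i b (walked (length y) w))
      sem-walkRounds p i b [] w = refl
      sem-walkRounds {d} p i b (_ ∷ y) w = trans
        (cong (λ s → foldl (λ s _ → sem (scan {d} idle idle idle (pull CERT# walkEdge)) x s) s y)
          (sem-scan {d} idle idle idle (pull CERT# walkEdge) x n s t E refl refl refl refl (runs-walk p i b E w)))
        (sem-walkRounds {d} p i b y (walkRound w))

    goalBy : Ord → ℕ → ℕ
    goalBy equal b = b
    goalBy _     b = suc b

    private
      sem-goalCase : ∀ {d} o p i b c ce y → sem (goalCase {d} o) x (S t 0 [] [] (W p i b (c , ce , y))) ≡ S t 0 [] [] (W p i (goalBy o b) (c , ce , y))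
      sem-goalCase less p i b c ce y = refl
      sem-goalCase equal p i b c ce y = refl
      sem-goalCase greater p i b c ce y = refl

      sem-checkGoal : ∀ {d} p i b c ce y → sem (checkGoal {d}) x (T (W p i b (c , ce , y))) ≡ T (W p i (goalBy (compareℕ t c) b) (c , ce , y))
      sem-checkGoal {d} p i b c ce y = sem-scan {suc d} idle idle (cmp U# CUR# goalCase) idle x n s t E refl refl refl
        (sem-goalCase {suc d} (compareℕ t c) p i b c ce y) (runs-idle E _)

    okOf : Ord → List Γ
    okOf equal = tok ∷ []
    okOf _     = []

    arrival : List Γ → Walker
    arrival ce = walked (length x) (s , ce , [])

    violations : List Γ → ℕ
    violations ce = goalBy (compareℕ t (proj₁ (arrival ce))) (alive (rounds (length x) (length x) fresh) + over)

    private
      sem-okCase : ∀ {d} o p i b c ce y → sem (okCase {d} o) x (T (W p i b (c , ce , y))) ≡ T (R p i c b ce (map out y) (okOf o) [] [])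
      sem-okCase less p i b c ce y = refl
      sem-okCase equal p i b c ce y = refl
      sem-okCase greater p i b c ce y = refl

    sem-graph : ∀ {d} ce → Σ (Vec ℕ 8) λ v → sem (graphProg {d}) x (T (V.replicate 6 0 , ce ∷ [] ∷ [] ∷ [] ∷ [] ∷ [])) ≡
      (v , [] ∷ [] ∷ proj₁ (proj₂ (arrival ce)) ∷ map out (proj₂ (proj₂ (arrival ce))) ∷ okOf (compareℕ (violations ce) 0) ∷ [] ∷ [] ∷ [])
    sem-graph {d} ce =
      let Z = rounds (length x) (length x) fresh
          (p , i , hr) = sem-rounds {d} 0 over ce [] [] x 0 0 fresh (trans (sym (map-∘ E)) (map-id E))
          b = alive Z + over
          eZ = trans (rounds-edges (length x) (length x) fresh) (trans (sym (map-∘ E)) (map-id E))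
          lZ = ≤-trans (≤-reflexive (trans (sym (length-map proj₁ Z)) (cong length eZ))) length-E
          (c' , ce' , y') = arrival ce
      in _ , trans (cong (sem ((for {d = suc (suc d)} λ _ → roundProg) » checkAlive {suc d} » loadSource {suc d} » walkRounds {suc d} » checkGoal {suc d} » cmp BAD# Z# okCase) x) (sem-checkBounds {suc d} ce))
        (trans (cong (sem (checkAlive {suc d} » loadSource {suc d} » walkRounds {suc d} » checkGoal {suc d} » cmp BAD# Z# okCase) x) hr)
        (trans (cong (sem (loadSource {suc d} » walkRounds {suc d} » checkGoal {suc d} » cmp BAD# Z# okCase) x)
          (sem-checkAlive {suc (suc d)} p i 0 over ce [] [] x Z lZ))
        (trans (cong (sem (walkRounds {suc d} » checkGoal {suc d} » cmp BAD# Z# okCase) x) (sem-loadSource {suc d} p i b ce))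
        (trans (cong (sem (checkGoal {suc d} » cmp BAD# Z# okCase) x) (sem-walkRounds {suc d} p i b x (s , ce , [])))
        (trans (cong (sem (cmp {d = suc (suc (suc d))} BAD# Z# okCase) x) (sem-checkGoal {suc d} p i b c' ce' y'))
        (sem-okCase {suc (suc (suc d))} (compareℕ (violations ce) 0) p i (violations ce) c' ce' y'))))))

Selects : ∀ {k} → List (Fin (suc (suc k))) → List (Fin k) → Set
Selects {k} x y = Σ (Instance k) λ I → encode I ≡ x × Acyclic (Instance.edges I) × Path (Instance.edges I) (Instance.s I) (Instance.t I) y

-- Correctness of the selection of path yields.

module PathCorrect (k q g : ℕ) where
  open PathProgram k q g

  private
    compare-less⇒< : ∀ m n → compareℕ m n ≡ less → m < n
    compare-less⇒< zero (suc n) e = s≤s z≤n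
    compare-less⇒< (suc m) (suc n) e = s≤s (compare-less⇒< m n e)

    <⇒compare-less : ∀ {m n} → m < n → compareℕ m n ≡ less
    <⇒compare-less {zero} (s≤s z≤n) = refl
    <⇒compare-less {suc m} {suc n} (s≤s lt) = <⇒compare-less lt

    overBy-0 : ∀ o b → overBy o b ≡ 0 → o ≡ less × b ≡ 0
    overBy-0 less b e = refl , e

    Bounded : ℕ → RawEdge k → Set
    Bounded n (u , _ , v) = u < n × v < n

    overEdges-0 : ∀ n E b → overEdges n E b ≡ 0 → b ≡ 0 × All (Bounded n) E
    overEdges-0 n [] b e = e , []
    overEdges-0 n ((u , a , v) ∷ E) b e =
      let (e₁ , bs) = overEdges-0 n E _ e
          (lv , e₂) = overBy-0 (compareℕ v n) _ e₁
          (lu , e₃) = overBy-0 (compareℕ u n) b e₂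
      in e₃ , (compare-less⇒< u n lu , compare-less⇒< v n lv) ∷ bs

    within : ∀ n E → All (Bounded n) E → Σ (List (Fin n × Fin k × Fin n)) λ E' → map raw E' ≡ E
    within n [] [] = [] , refl
    within n ((u , a , v) ∷ E) ((lu , lv) ∷ bs) =
      let (E' , e) = within n E bs
      in (fromℕ< lu , a , fromℕ< lv) ∷ E' , cong₂ _∷_ (cong₂ _,_ (F.toℕ-fromℕ< lu) (cong (a ,_) (F.toℕ-fromℕ< lv))) e

    within-over : ∀ {n} (E : List (Fin n × Fin k × Fin n)) → overEdges n (map raw E) 0 ≡ 0
    within-over [] = refl
    within-over ((u , a , v) ∷ E) rewrite <⇒compare-less (F.toℕ<n u) | <⇒compare-less (F.toℕ<n v) = within-over E

    okOf-∷ : ∀ {n s t E} m {a : Γ} {l} → okOf n s t E (compareℕ m 0) ≡ a ∷ l → m ≡ 0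
    okOf-∷ zero e = refl

    goalBy-0 : ∀ {n s t E} m c b → goalBy n s t E (compareℕ m c) b ≡ 0 → m ≡ c × b ≡ 0
    goalBy-0 zero zero b e = refl , e
    goalBy-0 {n} {s} {t} {E} (suc m) (suc c) b e = let (p , q) = goalBy-0 {n} {s} {t} {E} m c b e in cong suc p , q

  module _ (n s t : ℕ) (E : List (RawEdge k)) where
    private
      step-sound : ∀ w e → e ∈ E → Walk E s (proj₁ w) (reverse (proj₂ (proj₂ w))) →
        Walk E s (proj₁ (walkStep n s t E w e)) (reverse (proj₂ (proj₂ (walkStep n s t E w e))))
      step-sound (c , [] , y) (u , a , v) e∈ p = p
      step-sound (c , γ ∷ ce , y) (u , a , v) e∈ p with takes n s t E γ ∧ isEqual (compareℕ u c) in h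
      ... | false = p
      ... | true = subst (Walk E s v) (sym (unfold-reverse a y))
        (walk-snoc p (subst (λ u → (u , a , v) ∈ E) (isEqual⇒≡ u c (∧-true (takes n s t E γ) h)) e∈))
        where
        ∧-true : ∀ b {b'} → b ∧ b' ≡ true → b' ≡ true
        ∧-true true e = e

      round-sound : ∀ E' → (∀ {e} → e ∈ E' → e ∈ E) → ∀ w → Walk E s (proj₁ w) (reverse (proj₂ (proj₂ w))) →
        Walk E s (proj₁ (foldl (walkStep n s t E) w E')) (reverse (proj₂ (proj₂ (foldl (walkStep n s t E) w E'))))
      round-sound [] sub w p = p
      round-sound (e ∷ E') sub w p = round-sound E' (sub ∘ later) (walkStep n s t E w e) (step-sound w e (sub (first refl)) p)

    walked-sound : ∀ r w → Walk E s (proj₁ w) (reverse (proj₂ (proj₂ w))) →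
      Walk E s (proj₁ (walked n s t E r w)) (reverse (proj₂ (proj₂ (walked n s t E r w))))
    walked-sound zero w p = p
    walked-sound (suc r) w p = walked-sound r (walkRound n s t E w) (round-sound E id w p)

    private
      falses : ℕ → List Bool
      falses m = replicate m false

      skips : ∀ c y E' rest → foldl (walkStep n s t E) (c , map bit (falses (length E')) ++ rest , y) E' ≡ (c , rest , y)
      skips c y [] rest = refl
      skips c y (_ ∷ E') rest = skips c y E' rest

      takesOne : ∀ {u a v} E' → (u , a , v) ∈ E' → Σ (List Bool) λ bs → length bs ≡ length E' ×
        (∀ rest y → foldl (walkStep n s t E) (u , map bit bs ++ rest , y) E' ≡ (v , rest , a ∷ y))
      takesOne {u} {a} {v} (_ ∷ E') (first refl) = true ∷ falses (length E') , cong suc (length-replicate (length E')) ,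
        λ rest y → trans (cong (λ o → foldl (walkStep n s t E) (if isEqual o then v , map bit (falses (length E')) ++ rest , a ∷ y else u , map bit (falses (length E')) ++ rest , y) E')
          (compareℕ-equal u)) (skips v (a ∷ y) E' rest)
      takesOne (_ ∷ E') (later m) = let (bs , l , h) = takesOne E' m in false ∷ bs , cong suc l , h

      ++-split : ∀ (bs bs' : List Bool) (rest : List Γ) → map bit (bs ++ bs') ++ rest ≡ map bit bs ++ (map bit bs' ++ rest)
      ++-split bs bs' rest = trans (cong (_++ rest) (map-++ bit bs bs')) (++-assoc (map bit bs) (map bit bs') rest)

    -- One edge of the walk is taken per round, by a single `true` among the `length E` bits of that
    -- round; surplus rounds read only `false`. This fixes the number of bits at `r * length E`.
    walked-complete : ∀ r {u v y} → Walk E u v y → length y ≤ r → Σ (List Bool) λ bs → length bs ≡ r * length E ×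
      (∀ rest o → walked n s t E r (u , map bit bs ++ rest , o) ≡ (v , rest , y ʳ++ o))
    walked-complete zero nil le = [] , refl , λ rest o → refl
    walked-complete (suc r) {u} nil le =
      let (bs , l , h) = walked-complete r {u} {u} {[]} nil z≤n
      in falses (length E) ++ bs , trans (length-++ (falses (length E))) (cong₂ _+_ (length-replicate (length E)) l) ,
         λ rest o → trans (cong (λ z → walked n s t E r (walkRound n s t E (u , z , o))) (++-split (falses (length E)) bs rest))
           (trans (cong (walked n s t E r) (skips u o E (map bit bs ++ rest))) (h rest o))
    walked-complete (suc r) {u} (cons {a = a} e p) (s≤s le) =
      let (bs₁ , l₁ , h₁) = takesOne E e
          (bs , l , h) = walked-complete r p le
      in bs₁ ++ bs , trans (length-++ bs₁) (cong₂ _+_ l₁ l) ,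
         λ rest o → trans (cong (λ z → walked n s t E r (walkRound n s t E (u , z , o))) (++-split bs₁ bs rest))
           (trans (cong (walked n s t E r) (h₁ (map bit bs ++ rest) o)) (h rest (a ∷ o)))

  start : List Γ → State {Γ} {8} {7}
  start c = V.replicate 8 0 , V.replicate 7 [] [ CERT# ]≔ c

  final : List (Fin (suc (suc k))) → List Γ → Vec (List Γ) 7
  final x c = proj₂ (sem pathProg (map inn x) (start c))

  private
    sem-parse : ∀ x (y : List (Fin (suc (suc k)))) p v w →
      foldl (λ s c → sem (pull {d = 2} PH# (λ m → parseSym m c)) x s) (v , (flag p ∷ []) ∷ w) (map inn y) ≡ (v , (flag (foldl parse p y) ∷ []) ∷ w)
    sem-parse x [] p v w = refl
    sem-parse x (c ∷ y) p v w = sem-parse x y (parse p c) v w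

    parsed : ∀ x c → final x c ≡ proj₂ (sem (whenParsed {0} (just (flag (foldl parse f0 x)))) (map inn x) (start c))
    parsed x c = cong (λ s → proj₂ (sem (pull {d = 3} PH# whenParsed) (map inn x) s))
      (sem-parse (map inn x) x f0 (V.replicate 8 0) ([] ∷ c ∷ [] ∷ [] ∷ [] ∷ [] ∷ []))

    graph-final : ∀ n s t E c → let z = encodeRaw n s t E ; w = arrival n s t E c in
      final z c ≡ [] ∷ [] ∷ proj₁ (proj₂ w) ∷ map out (proj₂ (proj₂ w)) ∷ okOf n s t E (compareℕ (violations n s t E c) 0) ∷ [] ∷ [] ∷ []
    graph-final n s t E c = trans (parsed (encodeRaw n s t E) c)
      (trans (cong (λ p → proj₂ (sem (whenParsed {0} (just (flag p))) (map inn (encodeRaw n s t E)) (start c))) (parse-complete n s t E))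
        (cong proj₂ (proj₂ (sem-graph n s t E {0} c))))

    parsed-ok : ∀ p x c {a l} → lookup (proj₂ (sem (whenParsed {0} (just (flag p))) (map inn x) (start c))) OK# ≡ a ∷ l → p ≡ f3
    parsed-ok f3 x c e = refl

  sound : ∀ x c {a l} → lookup (final x c) OK# ≡ a ∷ l → Σ (List (Fin k)) λ y → Selects x y × lookup (final x c) OUT# ≡ reverse (map out y)
  sound x c e with parse-sound x (parsed-ok (foldl parse f0 x) x c (trans (cong (λ w → lookup w OK#) (sym (parsed x c))) e))
  ... | n , s , t , E , refl =
    let fin≡ = graph-final n s t E c
        w = arrival n s t E c
        -- The counter of violations is 0, and so is each contribution: the walk ends at the target,
        -- no edge is alive, and all vertices are below `n`.
        viol = okOf-∷ {n} {s} {t} {E} (violations n s t E c) (trans (cong (λ w → lookup w OK#) (sym fin≡)) e)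
        (tc , b) = goalBy-0 {n} {s} {t} {E} t (proj₁ w) _ viol
        dead = m+n≡0⇒m≡0 _ b
        (e₁ , bs) = overEdges-0 n E _ (m+n≡0⇒n≡0 (alive (rounds N N (map (_, true) E))) b)
        (lt , e₂) = overBy-0 (compareℕ t n) _ e₁
        (ls , _) = overBy-0 (compareℕ s n) 0 e₂
        s<n = compare-less⇒< s n ls
        t<n = compare-less⇒< t n lt
        (E' , eE) = within n E bs
        I = inst n (fromℕ< s<n) (fromℕ< t<n) E'
        eI = trans (encode-raw I) (trans (cong₂ (λ s t → encodeRaw n s t (map raw E')) (F.toℕ-fromℕ< s<n) (F.toℕ-fromℕ< t<n)) (cong (encodeRaw n s t) eE))
        y = reverse (proj₂ (proj₂ w))
        p = subst₂ (λ E₁ v → Walk E₁ s v y) (sym eE) (sym tc) (walked-sound n s t E N (s , c , []) nil)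
        p' = subst₂ (λ s t → Walk (map raw E') s t y) (sym (F.toℕ-fromℕ< s<n)) (sym (F.toℕ-fromℕ< t<n)) p
    in y , (I , eI , raw-acyclic (subst AcyclicRaw (sym eE) (dies-acyclic E N N dead)) , walk-path′ p') ,
       trans (cong (λ w → lookup w OUT#) fin≡)
         (trans (cong (map out) (sym (reverse-involutive (proj₂ (proj₂ w))))) (reverse-map out y))
    where
    N : ℕ
    N = length (map (inn {suc (suc k)} {k} {q} {g}) (encodeRaw n s t E))

  complete : ∀ x y → Selects x y → Σ (List Bool) λ bs → length bs ≤ length x * length x ×
    (∀ rest → (∃ λ a → ∃ λ l → lookup (final x (map bit bs ++ rest)) OK# ≡ a ∷ l) ×
      lookup (final x (map bit bs ++ rest)) OUT# ≡ reverse (map out y) × lookup (final x (map bit bs ++ rest)) CERT# ≡ rest)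
  complete _ y (inst n s t E , refl , ac , p) = bs , le , ends
    where
    I : Instance k
    I = inst n s t E
    E' : List (RawEdge k)
    E' = map raw E
    z : List (Fin (suc (suc k)))
    z = encodeRaw n (toℕ s) (toℕ t) E'
    N : ℕ
    N = length (map (inn {suc (suc k)} {k} {q} {g}) z)
    N≡ : N ≡ length z
    N≡ = length-map inn z
    n≤N : n ≤ N
    n≤N = subst (n ≤_) (sym N≡) (vertices-≤ n (toℕ s) (toℕ t) E')
    E≤N : length E' ≤ N
    E≤N = length-E n (toℕ s) (toℕ t) E'
    certificate : Σ (List Bool) λ bs → length bs ≡ N * length E' ×
      (∀ rest o → walked n (toℕ s) (toℕ t) E' N (toℕ s , map bit bs ++ rest , o) ≡ (toℕ t , rest , y ʳ++ o))
    certificate = walked-complete n (toℕ s) (toℕ t) E' N (path-walk p) (≤-trans (<⇒≤ (acyclic-short ac p)) n≤N)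
    bs : List Bool
    bs = proj₁ certificate
    le : length bs ≤ length (encode I) * length (encode I)
    le = ≤-trans (≤-reflexive (proj₁ (proj₂ certificate))) (≤-trans (*-monoʳ-≤ N E≤N)
      (≤-reflexive (cong (λ m → m * m) (trans N≡ (cong length (sym (encode-raw I)))))))
    module _ (rest : List Γ) where
      c : List Γ
      c = map bit bs ++ rest
      arr : arrival n (toℕ s) (toℕ t) E' c ≡ (toℕ t , rest , y ʳ++ [])
      arr = proj₂ (proj₂ certificate) rest []
      none : violations n (toℕ s) (toℕ t) E' c ≡ 0
      none = trans (cong₂ (λ w b → goalBy n (toℕ s) (toℕ t) E' (compareℕ (toℕ t) (proj₁ w)) b) arr
          (cong₂ _+_ (acyclic-dies ac N n≤N (≤-trans (≤-reflexive (sym (length-map raw E))) E≤N)) over≡0))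
        (cong (λ o → goalBy n (toℕ s) (toℕ t) E' o 0) (compareℕ-equal (toℕ t)))
        where
        over≡0 : over n (toℕ s) (toℕ t) E' ≡ 0
        over≡0 = trans (cong₂ (λ o o' → overEdges n E' (overBy o (overBy o' 0))) (<⇒compare-less (F.toℕ<n t)) (<⇒compare-less (F.toℕ<n s))) (within-over E)
      fin≡ : final (encode I) c ≡ [] ∷ [] ∷ rest ∷ map out (reverse y) ∷ (tok ∷ []) ∷ [] ∷ [] ∷ []
      fin≡ = trans (cong (λ x → final x c) (encode-raw I)) (trans (graph-final n (toℕ s) (toℕ t) E' c)
        (cong₂ (λ w m → [] ∷ [] ∷ proj₁ (proj₂ w) ∷ map out (proj₂ (proj₂ w)) ∷ okOf n (toℕ s) (toℕ t) E' (compareℕ m 0) ∷ [] ∷ [] ∷ []) arr none))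
      ends : (∃ λ a → ∃ λ l → lookup (final (encode I) c) OK# ≡ a ∷ l) × lookup (final (encode I) c) OUT# ≡ reverse (map out y) × lookup (final (encode I) c) CERT# ≡ rest
      ends = (tok , [] , cong (λ w → lookup w OK#) fin≡) , trans (cong (λ w → lookup w OUT#) fin≡) (reverse-map out y) , cong (λ w → lookup w CERT#) fin≡

pathSelector : ∀ k → Selector (suc (suc k)) k Selects
pathSelector k = record
  { C = 8 ; W = 7 ; D = 1 ; prog = λ q g → PathProgram.pathProg k q g
  ; certS = f2 ; outS = f3 ; okS = f4
  ; okS≢outS = λ () ; okS≢certS = λ () ; outS≢certS = λ ()
  ; sound = PathCorrect.sound k ; complete = PathCorrect.complete k }

theorem9 : (∀ (k : ℕ) (L : Language k) → InDAGR InPSPACE L ⇔ InPSPACE L)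
    × (∀ (k : ℕ) (L : Language k) → InDAGR InNP L ⇔ InNP L)
theorem9 = (λ k L → mk⇔ (InPSPACE-closed (lineSelector k) L (DAGREACH L) (onLine L)) (InPSPACE-closed (pathSelector k) (DAGREACH L) L (onPaths L))) ,
           (λ k L → mk⇔ (InNP-closed (lineSelector k) L (DAGREACH L) (onLine L)) (InNP-closed (pathSelector k) (DAGREACH L) L (onPaths L)))
  where
  -- For the converse, the instance that `DAGREACH` provides is known only by its code; `line-yield`
  -- still shows its yield to be `w`.
  onLine : ∀ {k} (L : Language k) w → L w ⇔ (Σ (List (Fin (suc (suc k)))) λ x → x ≡ encode (line w) × DAGREACH L x)
  onLine L w = mk⇔
    (λ l → encode (line w) , refl , line w , refl , line-acyclic w , w , line-path w , l)
    (λ { (_ , refl , I , e , _ , y , p , l) → subst L (line-yield w I e p) l })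
  onPaths : ∀ {k} (L : Language k) x → DAGREACH L x ⇔ (Σ (List (Fin k)) λ y → Selects x y × L y)
  onPaths L x = mk⇔ (λ (I , e , ac , y , p , l) → y , (I , e , ac , p) , l) (λ (y , (I , e , ac , p) , l) → I , e , ac , y , p , l)
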